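{- Let $E/k$ be a finite field extension that is potentially Galois over an overfield $L$ of $k$. Let $\widehat E$ be the Galois closure of $E$ over $k$, and set $\Gamma=\mathrm{Gal}(\widehat E/k)$ and $\Gamma_E=\mathrm{Gal}(\widehat E/E)$. Let $\mathbb G(L)=\mathrm{res}(\mathrm{Gal}(EL/L))\subset\Gamma$, let $\mathrm{Subgp}_\Gamma(\mathbb G(L))$ be the set of subgroups $H\subset\mathbb G(L)$ such that the product set $H\Gamma_E=\{hg\mid h\in H,g\in\Gamma_E\}$ is a subgroup of $\Gamma$, and let $\mathrm{Subfld}_k(E)$ be the set of subfields of $E$ containing $k$. Define $$\varepsilon_L:\mathrm{Subgp}_\Gamma(\mathbb G(L))\to\mathrm{Subfld}_k(E),\quad \varepsilon_L(H)=E^H:=E\cap\widehat E^H,$$ $$\eta_L:\mathrm{Subfld}_k(E)\to\mathrm{Subgp}_\Gamma(\mathbb G(L)),\quad \eta_L(E')=\mathrm{res}(\mathrm{Gal}(EL/E'L)).$$ Then $\varepsilon_L$ and $\eta_L$ define a bijective correspondence between the set of subgroups $\mathrm{Subgp}_\Gamma(\mathbb G(L))$ and the set of subfields $\mathrm{Subfld}_k(E)$. More precisely, for every $E'\in\mathrm{Subfld}_k(E)$ and every $H\in\mathrm{Subgp}_\Gamma(\mathbb G(L))$: - $\varepsilon_L(H)=E^H$ is a sub-extension of $E/k$ with $[E:E^H]=|H|$; - $\eta_L(E')=\mathrm{res}(\mathrm{Gal}(EL/E'L))$ is a subgroup of $\mathbb G(L)$ such that $\eta_L(E')\,\Gamma_E$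 is a subgroup of $\Gamma$, and $\eta_L(E')$ is of order $[E:E']$; - $\varepsilon_L\circ\eta_L(E')=E'$ and $\eta_L\circ\varepsilon_L(H)=H$. Furthermore, if $L/k$ is Galois and $H$ is a characteristic subgroup of $\mathbb G(L)$, then $H\Gamma_E$ is a subgroup of $\Gamma$ and the extension $E^H/k$ (with $E^H=E\cap\widehat E^H$) is pre-Galois over $L$, of group $\mathbb G(L)/H$.
   Context: For a finite field extension $E/k$ and an overfield $L$ of $k$ (not necessarily algebraic), $E/k$ is potentially Galois over $L$ with group $G$ if $E\otimes_kL$ is a Galois field extension of $L$ with Galois group $G$; equivalently, after embedding $E$ in a separable closure of $L$ as a $k$-algebra, $EL/L$ is Galois of degree $[E:k]$ with group $G$. If moreover $L/k$ is Galois (not necessarily finite), $E/k$ is called pre-Galois over $L$ with group $G$. If $E/k$ is potentially Galois over $L$ then $E/k$ is separable and $\widehat E\subset EL$; $\mathrm{res}:\mathrm{Gal}(EL/L)\to\Gamma=\mathrm{Gal}(\widehat E/k)$ denotes the restriction map, which is injective. $\widehat E^H$ is the fixed field of $H$ in $\widehat E$. -}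

module Defs where

open import Level using (Level; suc)
open import Algebra.Bundles using (CommutativeRing; Group; AbelianGroup; RawRing; RawGroup)
open import Algebra.Morphism.Structures
  using (IsRingHomomorphism; IsRingMonomorphism; IsRingIsomorphism; IsGroupMonomorphism; IsGroupIsomorphism)
import Algebra.Morphism.RingMonomorphism as RingMono
import Algebra.Morphism.GroupMonomorphism as GroupMono
import Algebra.Morphism.Construct.Identity as Identity
import Algebra.Morphism.Construct.Composition as Composition
import Algebra.Properties.AbelianGroup as AbelianGroupProperties
import Algebra.Properties.Group as GroupProperties
import Algebra.Properties.CommutativeSemigroup as CommutativeSemigroupProperties
import Algebra.Properties.Monoid.Sum as Sum
import Algebra.Properties.Semiring.Exp as Exp
import Relation.Binary.Reasoning.Setoid as SetoidReasoning
open import Data.Nat.Base using (ℕ)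
open import Data.Fin.Base using (Fin; toℕ)
open import Data.Product.Base using (Σ-syntax; ∃; ∃-syntax; _×_; _,_; proj₁; proj₂)
open import Function.Base using (id; _∘_; _on_)
open import Function.Bundles using (Bijection)
import Relation.Binary.Construct.On as On
import Relation.Binary.PropositionalEquality.Properties as ≡
open import Relation.Nullary.Negation using (¬_)
open import Relation.Unary as U using (Pred; _∈_)

private
  variable
    ℓ : Level

------------------------------------------------------------------------
-- Fields and field extensions

CRing : (ℓ : Level) → Set (suc ℓ)
CRing ℓ = CommutativeRing ℓ ℓ

infixr 4 _⟶_

record _⟶_ (A B : CRing ℓ) : Set ℓ where
  private
    module A = CommutativeRing A
    module B = CommutativeRing B
  field
    ⟦_⟧                : A.Carrier → B.Carrier
    isRingHomomorphism : IsRingHomomorphism A.rawRing B.rawRing ⟦_⟧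
  open IsRingHomomorphism isRingHomomorphism public

record IsField (R : CRing ℓ) : Set ℓ where
  open CommutativeRing R
  field
    1≉0     : ¬ (1# ≈ 0#)
    inverse : ∀ x → ¬ (x ≈ 0#) → ∃[ y ] x * y ≈ 1#

record Field (ℓ : Level) : Set (suc ℓ) where
  field
    commutativeRing : CRing ℓ
    isField         : IsField commutativeRing
  open CommutativeRing commutativeRing public
  open IsField isField public

module _ {F K : CRing ℓ} (φ : F ⟶ K) where
  private
    module F = CommutativeRing F
    module K = CommutativeRing K
    module φ = _⟶_ φ
  open Sum K.+-monoid using (sum)
  open Exp K.semiring using (_^_)

  -- [ K : F ] = n, witnessed by a basis of K over F
  HasDegree : ℕ → Set ℓ
  HasDegree n = ∃[ b ]
      (∀ x → ∃[ a ] x K.≈ combination a b)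
    × (∀ a → combination a b K.≈ K.0# → ∀ i → a i F.≈ F.0#)
    where
    combination : (Fin n → F.Carrier) → (Fin n → K.Carrier) → K.Carrier
    combination a b = sum λ i → φ.⟦ a i ⟧ K.* b i

  IsFinite : Set ℓ
  IsFinite = ∃[ n ] HasDegree n

  IsAlgebraic : Set ℓ
  IsAlgebraic = ∀ x → ∃[ n ] Σ[ a ∈ (Fin n → F.Carrier) ]
    (∃[ i ] ¬ (a i F.≈ F.0#)) × (sum λ i → φ.⟦ a i ⟧ K.* x ^ toℕ i) K.≈ K.0#

  record Automorphism : Set ℓ where
    field
      ⟦_⟧               : K.Carrier → K.Carrier
      isRingIsomorphism : IsRingIsomorphism K.rawRing K.rawRing ⟦_⟧
      fixes             : ∀ a → ⟦ φ.⟦ a ⟧ ⟧ K.≈ φ.⟦ a ⟧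
    open IsRingIsomorphism isRingIsomorphism public
      using (isRingMonomorphism; isRingHomomorphism; injective; surjective;
             ⟦⟧-cong; +-homo; *-homo; 0#-homo; 1#-homo; -‿homo)

  open Automorphism

  private
    inv : Automorphism → K.Carrier → K.Carrier
    inv σ y = proj₁ (surjective σ y)

    inv-right : ∀ σ y → ⟦ σ ⟧ (inv σ y) K.≈ y
    inv-right σ y = proj₂ (surjective σ y) K.refl

    inv-unique : ∀ σ {x y} → ⟦ σ ⟧ x K.≈ y → inv σ y K.≈ x
    inv-unique σ eq = injective σ (K.trans (inv-right σ _) (K.sym eq))

    inv-cong : ∀ σ {x y} → x K.≈ y → inv σ x K.≈ inv σ y
    inv-cong σ eq = inv-unique σ (K.trans (inv-right σ _) (K.sym eq))

    idᴬ : Automorphism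
    idᴬ = record
      { ⟦_⟧ = id
      ; isRingIsomorphism = Identity.isRingIsomorphism K.rawRing K.refl
      ; fixes = λ _ → K.refl
      }

    _∘ᴬ_ : Automorphism → Automorphism → Automorphism
    σ ∘ᴬ τ = record
      { ⟦_⟧ = ⟦ σ ⟧ ∘ ⟦ τ ⟧
      ; isRingIsomorphism =
          Composition.isRingIsomorphism K.trans (isRingIsomorphism τ) (isRingIsomorphism σ)
      ; fixes = λ a → K.trans (⟦⟧-cong σ (fixes τ a)) (fixes σ a)
      }

    _⁻¹ᴬ : Automorphism → Automorphism
    σ ⁻¹ᴬ = record
      { ⟦_⟧ = inv σ
      ; isRingIsomorphism = record
        { isRingMonomorphism = record
          { isRingHomomorphism = record
            { isSemiringHomomorphism = record
              { isNearSemiringHomomorphism = record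
                { +-isMonoidHomomorphism = record
                  { isMagmaHomomorphism = record
                    { isRelHomomorphism = record { cong = inv-cong σ }
                    ; homo = λ x y → inv-unique σ
                        (K.trans (+-homo σ _ _) (K.+-cong (inv-right σ x) (inv-right σ y)))
                    }
                  ; ε-homo = inv-unique σ (0#-homo σ)
                  }
                ; *-homo = λ x y → inv-unique σ
                    (K.trans (*-homo σ _ _) (K.*-cong (inv-right σ x) (inv-right σ y)))
                }
              ; 1#-homo = inv-unique σ (1#-homo σ)
              }
            ; -‿homo = λ x → inv-unique σ
                (K.trans (-‿homo σ _) (K.-‿cong (inv-right σ x)))
            }
          ; injective = λ {x} {y} eq → K.trans (K.sym (inv-right σ x))
              (K.trans (⟦⟧-cong σ eq) (inv-right σ y))
          }
        ; surjective = λ y → ⟦ σ ⟧ y , λ eq →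
            K.trans (inv-cong σ eq) (inv-unique σ K.refl)
        }
      ; fixes = λ a → inv-unique σ (fixes σ a)
      }

  -- The group Gal(K/F) of automorphisms of K over F
  Gal : Group ℓ ℓ
  Gal = record
    { Carrier = Automorphism
    ; _≈_ = λ σ τ → ∀ x → ⟦ σ ⟧ x K.≈ ⟦ τ ⟧ x
    ; _∙_ = _∘ᴬ_
    ; ε = idᴬ
    ; _⁻¹ = _⁻¹ᴬ
    ; isGroup = record
      { isMonoid = record
        { isSemigroup = record
          { isMagma = record
            { isEquivalence = record
              { refl = λ _ → K.refl
              ; sym = λ eq x → K.sym (eq x)
              ; trans = λ eq eq′ x → K.trans (eq x) (eq′ x)
              }
            ; ∙-cong = λ {σ} eq eq′ x → K.trans (⟦⟧-cong σ (eq′ x)) (eq _)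
            }
          ; assoc = λ _ _ _ _ → K.refl
          }
        ; identity = (λ _ _ → K.refl) , (λ _ _ → K.refl)
        }
      ; inverse = (λ σ x → inv-unique σ K.refl) , (λ σ x → inv-right σ x)
      ; ⁻¹-cong = λ {σ} {τ} eq x →
          inv-unique σ (K.trans (eq _) (inv-right τ x))
      }
    }

  -- K/F is a (possibly infinite) Galois extension of fields: it is algebraic
  -- and F is the fixed field of Gal(K/F).
  record IsGalois : Set ℓ where
    field
      base-isField : IsField F
      top-isField  : IsField K
      algebraic    : IsAlgebraic
      fixed⇒base   : ∀ x → (∀ σ → ⟦ σ ⟧ x K.≈ x) → ∃[ a ] x K.≈ φ.⟦ a ⟧

------------------------------------------------------------------------
-- Groups

infix 4 _≅_

_≅_ : Group ℓ ℓ → Group ℓ ℓ → Set ℓ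
G ≅ H = ∃ (IsGroupIsomorphism (Group.rawGroup G) (Group.rawGroup H))

module _ (G : Group ℓ ℓ) where
  open Group G

  record IsSubgroup (P : Pred Carrier ℓ) : Set ℓ where
    field
      resp      : ∀ {x y} → x ≈ y → x ∈ P → y ∈ P
      ε-closed  : ε ∈ P
      ∙-closed  : ∀ {x y} → x ∈ P → y ∈ P → x ∙ y ∈ P
      ⁻¹-closed : ∀ {x} → x ∈ P → x ⁻¹ ∈ P

  infixl 7 _⊙_

  _⊙_ : Pred Carrier ℓ → Pred Carrier ℓ → Pred Carrier ℓ
  (P ⊙ Q) g = ∃[ x ] ∃[ y ] x ∈ P × y ∈ Q × g ≈ x ∙ y

  HasOrder : Pred Carrier ℓ → ℕ → Set ℓ
  HasOrder P n = Bijection (≡.setoid (Fin n)) (On.setoid {B = ∃ P} setoid proj₁)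

  subgroup : {P : Pred Carrier ℓ} → IsSubgroup P → Group ℓ ℓ
  subgroup {P} S = record
    { isGroup = GroupMono.isGroup {G₁ = raw} {G₂ = rawGroup} mono isGroup }
    where
    open IsSubgroup S
    raw : RawGroup _ _
    raw = record
      { Carrier = ∃ P
      ; _≈_ = _≈_ on proj₁
      ; _∙_ = λ (x , p) (y , q) → x ∙ y , ∙-closed p q
      ; ε = ε , ε-closed
      ; _⁻¹ = λ (x , p) → x ⁻¹ , ⁻¹-closed p
      }
    mono : IsGroupMonomorphism raw rawGroup proj₁
    mono = record
      { isGroupHomomorphism = record
        { isMonoidHomomorphism = record
          { isMagmaHomomorphism = record
            { isRelHomomorphism = record { cong = id }
            ; homo = λ _ _ → refl
            }
          ; ε-homo = refl
          }
        ; ⁻¹-homo = λ _ → refl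
        }
      ; injective = id
      }

  IsNormal : Pred Carrier ℓ → Set ℓ
  IsNormal N = ∀ g {x} → x ∈ N → g ∙ x ∙ g ⁻¹ ∈ N

  IsCharacteristic : Pred Carrier ℓ → Set ℓ
  IsCharacteristic N = ∀ α → IsGroupIsomorphism rawGroup rawGroup α → ∀ {x} → x ∈ N → α x ∈ N

  private
    conj-cancel : ∀ g x → g ∙ (g ⁻¹ ∙ x ∙ g) ∙ g ⁻¹ ≈ x
    conj-cancel g x = begin
      g ∙ (g ⁻¹ ∙ x ∙ g) ∙ g ⁻¹   ≈⟨ ∙-congʳ (∙-congˡ (assoc _ _ _)) ⟩
      g ∙ (g ⁻¹ ∙ (x ∙ g)) ∙ g ⁻¹ ≈⟨ ∙-congʳ (assoc _ _ _) ⟨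
      g ∙ g ⁻¹ ∙ (x ∙ g) ∙ g ⁻¹   ≈⟨ ∙-congʳ (∙-congʳ (inverseʳ g)) ⟩
      ε ∙ (x ∙ g) ∙ g ⁻¹          ≈⟨ ∙-congʳ (identityˡ _) ⟩
      x ∙ g ∙ g ⁻¹                ≈⟨ assoc _ _ _ ⟩
      x ∙ (g ∙ g ⁻¹)              ≈⟨ ∙-congˡ (inverseʳ g) ⟩
      x ∙ ε                       ≈⟨ identityʳ x ⟩
      x                           ∎
      where open SetoidReasoning setoid

    conj-homo : ∀ g x y → g ∙ (x ∙ y) ∙ g ⁻¹ ≈ (g ∙ x ∙ g ⁻¹) ∙ (g ∙ y ∙ g ⁻¹)
    conj-homo g x y = sym (begin
      (g ∙ x ∙ g ⁻¹) ∙ (g ∙ y ∙ g ⁻¹)   ≈⟨ assoc _ _ _ ⟩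
      g ∙ x ∙ (g ⁻¹ ∙ (g ∙ y ∙ g ⁻¹))   ≈⟨ ∙-congˡ (∙-congˡ (assoc _ _ _)) ⟩
      g ∙ x ∙ (g ⁻¹ ∙ (g ∙ (y ∙ g ⁻¹))) ≈⟨ ∙-congˡ (\\-leftDividesʳ g _) ⟩
      g ∙ x ∙ (y ∙ g ⁻¹)                ≈⟨ assoc _ _ _ ⟨
      g ∙ x ∙ y ∙ g ⁻¹                  ≈⟨ ∙-congʳ (assoc _ _ _) ⟩
      g ∙ (x ∙ y) ∙ g ⁻¹                ∎)
      where
      open SetoidReasoning setoid
      open GroupProperties G

    conj-ε : ∀ g → g ∙ ε ∙ g ⁻¹ ≈ ε
    conj-ε g = trans (∙-congʳ (identityʳ g)) (inverseʳ g)

    conj-isIso : ∀ g → IsGroupIsomorphism rawGroup rawGroup (λ x → g ∙ x ∙ g ⁻¹)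
    conj-isIso g = record
      { isGroupMonomorphism = record
        { isGroupHomomorphism = record
          { isMonoidHomomorphism = record
            { isMagmaHomomorphism = record
              { isRelHomomorphism = record { cong = λ eq → ∙-congʳ (∙-congˡ eq) }
              ; homo = conj-homo g
              }
            ; ε-homo = conj-ε g
            }
          ; ⁻¹-homo = λ x → inverseˡ-unique _ _
              (trans (sym (conj-homo g _ _))
                (trans (∙-congʳ (∙-congˡ (inverseˡ x))) (conj-ε g)))
          }
        ; injective = λ eq → ∙-cancelˡ g _ _ (∙-cancelʳ (g ⁻¹) _ _ eq)
        }
      ; surjective = λ y → g ⁻¹ ∙ y ∙ g , λ eq →
          trans (∙-congʳ (∙-congˡ eq)) (conj-cancel g y)
      }
      where open GroupProperties G

  characteristic⇒normal : ∀ {N} → IsCharacteristic N → IsNormal N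
  characteristic⇒normal char g = char _ (conj-isIso g)

  quotient : {N : Pred Carrier ℓ} → IsSubgroup N → IsNormal N → Group ℓ ℓ
  quotient {N} S normal = record
    { Carrier = Carrier
    ; _≈_ = λ x y → x ⁻¹ ∙ y ∈ N
    ; _∙_ = _∙_
    ; ε = ε
    ; _⁻¹ = _⁻¹
    ; isGroup = record
      { isMonoid = record
        { isSemigroup = record
          { isMagma = record
            { isEquivalence = record
              { refl = ≈⇒ refl
              ; sym = symᴺ
              ; trans = λ {x} {y} {z} p q → resp (begin
                  x ⁻¹ ∙ y ∙ (y ⁻¹ ∙ z)   ≈⟨ assoc _ _ _ ⟩
                  x ⁻¹ ∙ (y ∙ (y ⁻¹ ∙ z)) ≈⟨ ∙-congˡ (\\-leftDividesˡ y z) ⟩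
                  x ⁻¹ ∙ z                ∎) (∙-closed p q)
              }
            ; ∙-cong = λ {x} {y} {u} {v} p q → resp (begin
                (u ⁻¹ ∙ (x ⁻¹ ∙ y) ∙ u ⁻¹ ⁻¹) ∙ (u ⁻¹ ∙ v) ≈⟨ assoc _ _ _ ⟩
                u ⁻¹ ∙ (x ⁻¹ ∙ y) ∙ (u ⁻¹ ⁻¹ ∙ (u ⁻¹ ∙ v)) ≈⟨ ∙-congˡ (\\-leftDividesʳ (u ⁻¹) v) ⟩
                u ⁻¹ ∙ (x ⁻¹ ∙ y) ∙ v                     ≈⟨ ∙-congʳ (assoc _ _ _) ⟨
                u ⁻¹ ∙ x ⁻¹ ∙ y ∙ v                       ≈⟨ assoc _ _ _ ⟩
                u ⁻¹ ∙ x ⁻¹ ∙ (y ∙ v)                     ≈⟨ ∙-congʳ (⁻¹-anti-homo-∙ x u) ⟨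
                (x ∙ u) ⁻¹ ∙ (y ∙ v)                      ∎)
                (∙-closed (normal (u ⁻¹) p) q)
            }
          ; assoc = λ x y z → ≈⇒ (assoc x y z)
          }
        ; identity = (λ x → ≈⇒ (identityˡ x)) , (λ x → ≈⇒ (identityʳ x))
        }
      ; inverse = (λ x → ≈⇒ (inverseˡ x)) , (λ x → ≈⇒ (inverseʳ x))
      ; ⁻¹-cong = λ {x} {y} p → resp (begin
          x ∙ (y ⁻¹ ∙ x) ∙ x ⁻¹ ≈⟨ assoc _ _ _ ⟩
          x ∙ (y ⁻¹ ∙ x ∙ x ⁻¹) ≈⟨ ∙-congˡ (//-rightDividesʳ x (y ⁻¹)) ⟩
          x ∙ y ⁻¹              ≈⟨ ∙-congʳ (⁻¹-involutive x) ⟨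
          x ⁻¹ ⁻¹ ∙ y ⁻¹        ∎) (normal x (symᴺ p))
      }
    }
    where
    open IsSubgroup S
    open SetoidReasoning setoid
    open GroupProperties G
    ≈⇒ : ∀ {x y} → x ≈ y → x ⁻¹ ∙ y ∈ N
    ≈⇒ {x} eq = resp (trans (sym (inverseˡ x)) (∙-congˡ eq)) ε-closed
    symᴺ : ∀ {x y} → x ⁻¹ ∙ y ∈ N → y ⁻¹ ∙ x ∈ N
    symᴺ {x} {y} p = resp
      (trans (⁻¹-anti-homo-∙ (x ⁻¹) y) (∙-congˡ (⁻¹-involutive x))) (⁻¹-closed p)

------------------------------------------------------------------------
-- Tensor product of commutative algebras

-- A ⊗ B over R: the abelian group generated by the symbols a ⊗ b modulo
-- bilinearity and balancedness, with (a ⊗ b)(a′ ⊗ b′) = aa′ ⊗ bb′.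
module Tensor {R A B : CRing ℓ} (f : R ⟶ A) (g : R ⟶ B) where
  private
    module R = CommutativeRing R
    module A = CommutativeRing A
    module B = CommutativeRing B
    module f = _⟶_ f
    module g = _⟶_ g

  infix  8 ⊖_
  infixl 7 _⊗_ _⊠_
  infixl 6 _⊕_
  infix  4 _∼_

  data T : Set ℓ where
    _⊗_ : A.Carrier → B.Carrier → T
    𝟘   : T
    _⊕_ : T → T → T
    ⊖_  : T → T

  data _∼_ : T → T → Set ℓ where
    ∼-refl   : ∀ {s} → s ∼ s
    ∼-sym    : ∀ {s t} → s ∼ t → t ∼ s
    ∼-trans  : ∀ {s t u} → s ∼ t → t ∼ u → s ∼ u
    ⊕-cong   : ∀ {s s′ t t′} → s ∼ s′ → t ∼ t′ → s ⊕ t ∼ s′ ⊕ t′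
    ⊖-cong   : ∀ {s t} → s ∼ t → ⊖ s ∼ ⊖ t
    ⊕-assoc  : ∀ s t u → (s ⊕ t) ⊕ u ∼ s ⊕ (t ⊕ u)
    ⊕-comm   : ∀ s t → s ⊕ t ∼ t ⊕ s
    ⊕-idˡ    : ∀ s → 𝟘 ⊕ s ∼ s
    ⊖-invˡ   : ∀ s → ⊖ s ⊕ s ∼ 𝟘
    ⊗-cong   : ∀ {a a′ b b′} → a A.≈ a′ → b B.≈ b′ → a ⊗ b ∼ a′ ⊗ b′
    ⊗-addˡ   : ∀ a a′ b → (a A.+ a′) ⊗ b ∼ a ⊗ b ⊕ a′ ⊗ b
    ⊗-addʳ   : ∀ a b b′ → a ⊗ (b B.+ b′) ∼ a ⊗ b ⊕ a ⊗ b′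
    balanced : ∀ a r b → (a A.* f.⟦ r ⟧) ⊗ b ∼ a ⊗ (g.⟦ r ⟧ B.* b)

  _⊠_ : T → T → T
  (a ⊗ b)  ⊠ (c ⊗ d)  = (a A.* c) ⊗ (b B.* d)
  (a ⊗ b)  ⊠ 𝟘        = 𝟘
  (a ⊗ b)  ⊠ (t ⊕ u)  = (a ⊗ b) ⊠ t ⊕ (a ⊗ b) ⊠ u
  (a ⊗ b)  ⊠ (⊖ t)    = ⊖ ((a ⊗ b) ⊠ t)
  𝟘        ⊠ u        = 𝟘
  (s ⊕ t)  ⊠ u        = s ⊠ u ⊕ t ⊠ u
  (⊖ s)    ⊠ u        = ⊖ (s ⊠ u)

  𝟙 : T
  𝟙 = A.1# ⊗ B.1#

  private
    additive : AbelianGroup ℓ ℓ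
    additive = record
      { _≈_ = _∼_
      ; _∙_ = _⊕_
      ; ε = 𝟘
      ; _⁻¹ = ⊖_
      ; isAbelianGroup = record
        { isGroup = record
          { isMonoid = record
            { isSemigroup = record
              { isMagma = record
                { isEquivalence = record { refl = ∼-refl ; sym = ∼-sym ; trans = ∼-trans }
                ; ∙-cong = ⊕-cong
                }
              ; assoc = ⊕-assoc
              }
            ; identity = ⊕-idˡ , λ s → ∼-trans (⊕-comm s 𝟘) (⊕-idˡ s)
            }
          ; inverse = ⊖-invˡ , λ s → ∼-trans (⊕-comm s (⊖ s)) (⊖-invˡ s)
          ; ⁻¹-cong = ⊖-cong
          }
        ; comm = ⊕-comm
        }
      }
    module + = AbelianGroup additive
    open AbelianGroupProperties additive using (⁻¹-∙-comm; ε⁻¹≈ε)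
    open CommutativeSemigroupProperties +.commutativeSemigroup using (interchange)

    ⊠-zeroʳ : ∀ s → s ⊠ 𝟘 ∼ 𝟘
    ⊠-zeroʳ (a ⊗ b) = ∼-refl
    ⊠-zeroʳ 𝟘       = ∼-refl
    ⊠-zeroʳ (s ⊕ t) = ∼-trans (⊕-cong (⊠-zeroʳ s) (⊠-zeroʳ t)) (⊕-idˡ 𝟘)
    ⊠-zeroʳ (⊖ s)   = ∼-trans (⊖-cong (⊠-zeroʳ s)) ε⁻¹≈ε

    ⊠-addʳ : ∀ s t u → s ⊠ (t ⊕ u) ∼ s ⊠ t ⊕ s ⊠ u
    ⊠-addʳ (a ⊗ b) t u = ∼-refl
    ⊠-addʳ 𝟘       t u = ∼-sym (⊕-idˡ 𝟘)
    ⊠-addʳ (s ⊕ r) t u = ∼-trans (⊕-cong (⊠-addʳ s t u) (⊠-addʳ r t u)) (interchange _ _ _ _)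
    ⊠-addʳ (⊖ s)   t u = ∼-trans (⊖-cong (⊠-addʳ s t u)) (∼-sym (⁻¹-∙-comm _ _))

    ⊠-negʳ : ∀ s t → s ⊠ (⊖ t) ∼ ⊖ (s ⊠ t)
    ⊠-negʳ (a ⊗ b) t = ∼-refl
    ⊠-negʳ 𝟘       t = ∼-sym ε⁻¹≈ε
    ⊠-negʳ (s ⊕ r) t = ∼-trans (⊕-cong (⊠-negʳ s t) (⊠-negʳ r t)) (⁻¹-∙-comm _ _)
    ⊠-negʳ (⊖ s)   t = ⊖-cong (⊠-negʳ s t)

    ⊠-comm : ∀ s t → s ⊠ t ∼ t ⊠ s
    ⊠-comm (a ⊗ b) (c ⊗ d) = ⊗-cong (A.*-comm a c) (B.*-comm b d)
    ⊠-comm (a ⊗ b) 𝟘       = ∼-refl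
    ⊠-comm (a ⊗ b) (t ⊕ u) = ⊕-cong (⊠-comm (a ⊗ b) t) (⊠-comm (a ⊗ b) u)
    ⊠-comm (a ⊗ b) (⊖ t)   = ⊖-cong (⊠-comm (a ⊗ b) t)
    ⊠-comm 𝟘       t       = ∼-sym (⊠-zeroʳ t)
    ⊠-comm (s ⊕ r) t       = ∼-trans (⊕-cong (⊠-comm s t) (⊠-comm r t)) (∼-sym (⊠-addʳ t s r))
    ⊠-comm (⊖ s)   t       = ∼-trans (⊖-cong (⊠-comm s t)) (∼-sym (⊠-negʳ t s))

    -- Right multiplication respects the generating relations.
    ⊠-⊗-cong : ∀ {a a′ b b′} → a A.≈ a′ → b B.≈ b′ → ∀ u → (a ⊗ b) ⊠ u ∼ (a′ ⊗ b′) ⊠ u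
    ⊠-⊗-cong p q (c ⊗ d) = ⊗-cong (A.*-congʳ p) (B.*-congʳ q)
    ⊠-⊗-cong p q 𝟘       = ∼-refl
    ⊠-⊗-cong p q (t ⊕ u) = ⊕-cong (⊠-⊗-cong p q t) (⊠-⊗-cong p q u)
    ⊠-⊗-cong p q (⊖ t)   = ⊖-cong (⊠-⊗-cong p q t)

    ⊠-⊗-addˡ : ∀ a a′ b u → ((a A.+ a′) ⊗ b) ⊠ u ∼ (a ⊗ b) ⊠ u ⊕ (a′ ⊗ b) ⊠ u
    ⊠-⊗-addˡ a a′ b (c ⊗ d) =
      ∼-trans (⊗-cong (A.distribʳ c a a′) B.refl) (⊗-addˡ _ _ _)
    ⊠-⊗-addˡ a a′ b 𝟘       = ∼-sym (⊕-idˡ 𝟘)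
    ⊠-⊗-addˡ a a′ b (t ⊕ u) =
      ∼-trans (⊕-cong (⊠-⊗-addˡ a a′ b t) (⊠-⊗-addˡ a a′ b u)) (interchange _ _ _ _)
    ⊠-⊗-addˡ a a′ b (⊖ t)   =
      ∼-trans (⊖-cong (⊠-⊗-addˡ a a′ b t)) (∼-sym (⁻¹-∙-comm _ _))

    ⊠-⊗-addʳ : ∀ a b b′ u → (a ⊗ (b B.+ b′)) ⊠ u ∼ (a ⊗ b) ⊠ u ⊕ (a ⊗ b′) ⊠ u
    ⊠-⊗-addʳ a b b′ (c ⊗ d) =
      ∼-trans (⊗-cong A.refl (B.distribʳ d b b′)) (⊗-addʳ _ _ _)
    ⊠-⊗-addʳ a b b′ 𝟘       = ∼-sym (⊕-idˡ 𝟘)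
    ⊠-⊗-addʳ a b b′ (t ⊕ u) =
      ∼-trans (⊕-cong (⊠-⊗-addʳ a b b′ t) (⊠-⊗-addʳ a b b′ u)) (interchange _ _ _ _)
    ⊠-⊗-addʳ a b b′ (⊖ t)   =
      ∼-trans (⊖-cong (⊠-⊗-addʳ a b b′ t)) (∼-sym (⁻¹-∙-comm _ _))

    ⊠-balanced : ∀ a r b u → ((a A.* f.⟦ r ⟧) ⊗ b) ⊠ u ∼ (a ⊗ (g.⟦ r ⟧ B.* b)) ⊠ u
    ⊠-balanced a r b (c ⊗ d) = ∼-trans
      (⊗-cong (A.trans (A.*-assoc a _ c) (A.trans (A.*-congˡ (A.*-comm _ c)) (A.sym (A.*-assoc a c _)))) B.refl)
      (∼-trans (balanced (a A.* c) r (b B.* d)) (⊗-cong A.refl (B.sym (B.*-assoc _ b d))))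
    ⊠-balanced a r b 𝟘       = ∼-refl
    ⊠-balanced a r b (t ⊕ u) = ⊕-cong (⊠-balanced a r b t) (⊠-balanced a r b u)
    ⊠-balanced a r b (⊖ t)   = ⊖-cong (⊠-balanced a r b t)

    ⊠-congʳ : ∀ {s t} → s ∼ t → ∀ u → s ⊠ u ∼ t ⊠ u
    ⊠-congʳ ∼-refl           u = ∼-refl
    ⊠-congʳ (∼-sym p)        u = ∼-sym (⊠-congʳ p u)
    ⊠-congʳ (∼-trans p q)    u = ∼-trans (⊠-congʳ p u) (⊠-congʳ q u)
    ⊠-congʳ (⊕-cong p q)     u = ⊕-cong (⊠-congʳ p u) (⊠-congʳ q u)
    ⊠-congʳ (⊖-cong p)       u = ⊖-cong (⊠-congʳ p u)
    ⊠-congʳ (⊕-assoc _ _ _)  u = ⊕-assoc _ _ _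
    ⊠-congʳ (⊕-comm _ _)     u = ⊕-comm _ _
    ⊠-congʳ (⊕-idˡ _)        u = ⊕-idˡ _
    ⊠-congʳ (⊖-invˡ _)       u = ⊖-invˡ _
    ⊠-congʳ (⊗-cong p q)     u = ⊠-⊗-cong p q u
    ⊠-congʳ (⊗-addˡ a a′ b)  u = ⊠-⊗-addˡ a a′ b u
    ⊠-congʳ (⊗-addʳ a b b′)  u = ⊠-⊗-addʳ a b b′ u
    ⊠-congʳ (balanced a r b) u = ⊠-balanced a r b u

    ⊠-cong : ∀ {s s′ t t′} → s ∼ s′ → t ∼ t′ → s ⊠ t ∼ s′ ⊠ t′
    ⊠-cong {s} {s′} {t} {t′} p q = ∼-trans (⊠-congʳ p t)
      (∼-trans (⊠-comm s′ t) (∼-trans (⊠-congʳ q s′) (⊠-comm t′ s′)))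

    ⊠-assoc : ∀ s t u → (s ⊠ t) ⊠ u ∼ s ⊠ (t ⊠ u)
    ⊠-assoc (a ⊗ b) (c ⊗ d) (x ⊗ y)   = ⊗-cong (A.*-assoc a c x) (B.*-assoc b d y)
    ⊠-assoc (a ⊗ b) (c ⊗ d) 𝟘         = ∼-refl
    ⊠-assoc (a ⊗ b) (c ⊗ d) (u ⊕ u′)  = ⊕-cong (⊠-assoc (a ⊗ b) (c ⊗ d) u) (⊠-assoc (a ⊗ b) (c ⊗ d) u′)
    ⊠-assoc (a ⊗ b) (c ⊗ d) (⊖ u)     = ⊖-cong (⊠-assoc (a ⊗ b) (c ⊗ d) u)
    ⊠-assoc (a ⊗ b) 𝟘        u        = ∼-refl
    ⊠-assoc (a ⊗ b) (t ⊕ t′) u        = ⊕-cong (⊠-assoc (a ⊗ b) t u) (⊠-assoc (a ⊗ b) t′ u)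
    ⊠-assoc (a ⊗ b) (⊖ t)    u        = ⊖-cong (⊠-assoc (a ⊗ b) t u)
    ⊠-assoc 𝟘        t u = ∼-refl
    ⊠-assoc (s ⊕ s′) t u = ⊕-cong (⊠-assoc s t u) (⊠-assoc s′ t u)
    ⊠-assoc (⊖ s)    t u = ⊖-cong (⊠-assoc s t u)

    ⊠-idˡ : ∀ s → 𝟙 ⊠ s ∼ s
    ⊠-idˡ (a ⊗ b) = ⊗-cong (A.*-identityˡ a) (B.*-identityˡ b)
    ⊠-idˡ 𝟘       = ∼-refl
    ⊠-idˡ (s ⊕ t) = ⊕-cong (⊠-idˡ s) (⊠-idˡ t)
    ⊠-idˡ (⊖ s)   = ⊖-cong (⊠-idˡ s)

  tensorRing : CRing ℓ
  tensorRing = record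
    { _≈_ = _∼_
    ; _+_ = _⊕_
    ; _*_ = _⊠_
    ; -_ = ⊖_
    ; 0# = 𝟘
    ; 1# = 𝟙
    ; isCommutativeRing = record
      { isRing = record
        { +-isAbelianGroup = +.isAbelianGroup
        ; *-cong = ⊠-cong
        ; *-assoc = ⊠-assoc
        ; *-identity = ⊠-idˡ , λ s → ∼-trans (⊠-comm s 𝟙) (⊠-idˡ s)
        ; distrib = ⊠-addʳ , λ _ _ _ → ∼-refl
        }
      ; *-comm = ⊠-comm
      }
    }

  ι₂ : B ⟶ tensorRing
  ι₂ = record
    { ⟦_⟧ = A.1# ⊗_
    ; isRingHomomorphism = record
      { isSemiringHomomorphism = record
        { isNearSemiringHomomorphism = record
          { +-isMonoidHomomorphism = record
            { isMagmaHomomorphism = record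
              { isRelHomomorphism = record { cong = ⊗-cong A.refl }
              ; homo = ⊗-addʳ A.1#
              }
            ; ε-homo = 1⊗0
            }
          ; *-homo = λ x y → ⊗-cong (A.sym (A.*-identityˡ A.1#)) B.refl
          }
        ; 1#-homo = ∼-refl
        }
      ; -‿homo = λ x → GroupProperties.inverseˡ-unique +.group _ _
          (∼-trans (∼-sym (⊗-addʳ A.1# (B.- x) x))
            (∼-trans (⊗-cong A.refl (B.-‿inverseˡ x)) 1⊗0))
      }
    }
    where
    1⊗0 : A.1# ⊗ B.0# ∼ 𝟘
    1⊗0 = GroupProperties.identityʳ-unique +.group (A.1# ⊗ B.0#) (A.1# ⊗ B.0#)
      (∼-trans (∼-sym (⊗-addʳ _ _ _)) (⊗-cong A.refl (B.+-identityʳ B.0#)))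

------------------------------------------------------------------------
-- Potentially Galois and pre-Galois extensions

module _ {k E L : CRing ℓ} (φ : k ⟶ E) (ψ : k ⟶ L) where
  open Tensor φ ψ using (ι₂)

  record IsPotentiallyGalois : Set ℓ where
    field
      k-isField : IsField k
      E-isField : IsField E
      L-isField : IsField L
      finite    : IsFinite φ
      galois    : IsGalois ι₂

  IsPotentiallyGaloisWithGroup : Group ℓ ℓ → Set ℓ
  IsPotentiallyGaloisWithGroup G = IsPotentiallyGalois × Gal ι₂ ≅ G

  IsPreGaloisWithGroup : Group ℓ ℓ → Set ℓ
  IsPreGaloisWithGroup G = IsGalois ψ × IsPotentiallyGaloisWithGroup G

------------------------------------------------------------------------
-- Subfields of an ambient field

module Subfields (Ω : Field ℓ) where
  open Field Ω

  record Subfield : Set (suc ℓ) where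
    field
      member     : Pred Carrier ℓ
      resp       : ∀ {x y} → x ≈ y → member x → member y
      0-closed   : member 0#
      1-closed   : member 1#
      +-closed   : ∀ {x y} → member x → member y → member (x + y)
      *-closed   : ∀ {x y} → member x → member y → member (x * y)
      neg-closed : ∀ {x} → member x → member (- x)
      inv-closed : ∀ {x y} → member x → x * y ≈ 1# → member y

  open Subfield public using (member)

  infix 4 _∈ᶠ_ _⊆_

  _∈ᶠ_ : Carrier → Subfield → Set ℓ
  x ∈ᶠ F = member F x

  _⊆_ : Subfield → Subfield → Set ℓ
  F ⊆ K = ∀ {x} → x ∈ᶠ F → x ∈ᶠ K

  ⌞_⌟ : Subfield → CRing ℓ
  ⌞ F ⌟ = record
    { isCommutativeRing =
        RingMono.isCommutativeRing {R₁ = raw} {R₂ = rawRing} mono isCommutativeRing }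
    where
    open Subfield F hiding (member)
    raw : RawRing _ _
    raw = record
      { Carrier = ∃ (member F)
      ; _≈_ = _≈_ on proj₁
      ; _+_ = λ (x , p) (y , q) → x + y , +-closed p q
      ; _*_ = λ (x , p) (y , q) → x * y , *-closed p q
      ; -_ = λ (x , p) → - x , neg-closed p
      ; 0# = 0# , 0-closed
      ; 1# = 1# , 1-closed
      }
    mono : IsRingMonomorphism raw rawRing proj₁
    mono = record
      { isRingHomomorphism = record
        { isSemiringHomomorphism = record
          { isNearSemiringHomomorphism = record
            { +-isMonoidHomomorphism = record
              { isMagmaHomomorphism = record
                { isRelHomomorphism = record { cong = id }
                ; homo = λ _ _ → refl
                }
              ; ε-homo = refl
              }
            ; *-homo = λ _ _ → refl
            }
          ; 1#-homo = refl
          }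
        ; -‿homo = λ _ → refl
        }
      ; injective = id
      }

  incl : (F K : Subfield) → F ⊆ K → ⌞ F ⌟ ⟶ ⌞ K ⌟
  incl F K F⊆K = record
    { ⟦_⟧ = λ (x , p) → x , F⊆K p
    ; isRingHomomorphism = record
      { isSemiringHomomorphism = record
        { isNearSemiringHomomorphism = record
          { +-isMonoidHomomorphism = record
            { isMagmaHomomorphism = record
              { isRelHomomorphism = record { cong = id }
              ; homo = λ _ _ → refl
              }
            ; ε-homo = refl
            }
          ; *-homo = λ _ _ → refl
          }
        ; 1#-homo = refl
        }
      ; -‿homo = λ _ → refl
      }
    }

  -- Membership in the smallest subfield containing K and L
  data Generated (K L : Subfield) : Pred Carrier ℓ where
    left     : ∀ {x} → x ∈ᶠ K → Generated K L x
    right    : ∀ {x} → x ∈ᶠ L → Generated K L x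
    respects : ∀ {x y} → x ≈ y → Generated K L x → Generated K L y
    plus     : ∀ {x y} → Generated K L x → Generated K L y → Generated K L (x + y)
    times    : ∀ {x y} → Generated K L x → Generated K L y → Generated K L (x * y)
    neg      : ∀ {x} → Generated K L x → Generated K L (- x)
    inv      : ∀ {x y} → Generated K L x → x * y ≈ 1# → Generated K L y

  infixl 7 _⋎_

  -- The compositum KL
  _⋎_ : Subfield → Subfield → Subfield
  K ⋎ L = record
    { member = Generated K L
    ; resp = respects
    ; 0-closed = left (Subfield.0-closed K)
    ; 1-closed = left (Subfield.1-closed K)
    ; +-closed = plus
    ; *-closed = times
    ; neg-closed = neg
    ; inv-closed = inv
    }

  -- K is a Galois closure of E/k: a Galois extension of k containing E,
  -- and minimal with this property
  record IsGaloisClosure (k E K : Subfield) (k⊆E : k ⊆ E) (E⊆K : E ⊆ K) : Set (suc ℓ) where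
    field
      galois  : IsGalois (incl k K (λ p → E⊆K (k⊆E p)))
      minimal : ∀ F → (E⊆F : E ⊆ F) → F ⊆ K →
                IsGalois (incl k F (λ p → E⊆F (k⊆E p))) → K ⊆ F

------------------------------------------------------------------------
-- The maps ε_L and η_L

-- Everything takes place in a common overfield Ω of L and Ê.
module Correspondence (Ω : Field ℓ)
    (k E L Ê : Subfields.Subfield Ω)
    (k⊆E : Subfields._⊆_ Ω k E) (k⊆L : Subfields._⊆_ Ω k L)
    (E⊆Ê : Subfields._⊆_ Ω E Ê) where

  open Field Ω
  open Subfields Ω

  k⊆Ê : k ⊆ Ê
  k⊆Ê p = E⊆Ê (k⊆E p)

  EL : Subfield
  EL = E ⋎ L

  L⊆EL : L ⊆ EL
  L⊆EL = right

  Γ : Group ℓ ℓ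
  Γ = Gal (incl k Ê k⊆Ê)

  GalEL : Group ℓ ℓ
  GalEL = Gal (incl L EL L⊆EL)

  private
    module Γ = Group Γ
    module GalEL = Group GalEL
  open Automorphism

  -- Γ_E = Gal(Ê/E), as a subset of Γ
  Γ-E : Pred Γ.Carrier ℓ
  Γ-E γ = ∀ x → (p : x ∈ᶠ E) → proj₁ (⟦ γ ⟧ (x , E⊆Ê p)) ≈ x

  infixl 7 _·_

  _·_ : Pred Γ.Carrier ℓ → Pred Γ.Carrier ℓ → Pred Γ.Carrier ℓ
  _·_ = _⊙_ Γ

  -- E^H = E ∩ Ê^H
  E^_ : Pred Γ.Carrier ℓ → Subfield
  E^ H = record
    { member = λ x → x ∈ᶠ E × Σ[ p ∈ x ∈ᶠ Ê ] (∀ h → h ∈ H → proj₁ (⟦ h ⟧ (x , p)) ≈ x)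
    ; resp = λ eq (p , q , fix) → E.resp eq p , Ê.resp eq q , λ h hH →
        trans (⟦⟧-cong h (sym eq)) (trans (fix h hH) eq)
    ; 0-closed = E.0-closed , Ê.0-closed , λ h _ → 0#-homo h
    ; 1-closed = E.1-closed , Ê.1-closed , λ h _ → 1#-homo h
    ; +-closed = λ (p , q , fix) (p′ , q′ , fix′) →
        E.+-closed p p′ , Ê.+-closed q q′ , λ h hH →
        trans (+-homo h _ _) (+-cong (fix h hH) (fix′ h hH))
    ; *-closed = λ (p , q , fix) (p′ , q′ , fix′) →
        E.*-closed p p′ , Ê.*-closed q q′ , λ h hH →
        trans (*-homo h _ _) (*-cong (fix h hH) (fix′ h hH))
    ; neg-closed = λ (p , q , fix) → E.neg-closed p , Ê.neg-closed q , λ h hH →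
        trans (-‿homo h _) (-‿cong (fix h hH))
    ; inv-closed = λ {x} {y} (p , q , fix) xy≈1 →
        E.inv-closed p xy≈1 , Ê.inv-closed q xy≈1 , λ h hH →
        let q′  = Ê.inv-closed q xy≈1
            hy  = proj₁ (⟦ h ⟧ (y , q′))
            xhy : x * hy ≈ 1#
            xhy = trans (*-congʳ (sym (fix h hH)))
                    (trans (sym (*-homo h (x , q) (y , q′)))
                      (trans (⟦⟧-cong h {_ , Ê.*-closed q q′} {_ , Ê.1-closed} xy≈1) (1#-homo h)))
        in begin
          hy           ≈⟨ *-identityˡ hy ⟨
          1# * hy      ≈⟨ *-congʳ (trans (sym xy≈1) (*-comm x y)) ⟩
          y * x * hy   ≈⟨ *-assoc y x hy ⟩
          y * (x * hy) ≈⟨ *-congˡ xhy ⟩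
          y * 1#       ≈⟨ *-identityʳ y ⟩
          y            ∎
    }
    where
    module E = Subfield E
    module Ê = Subfield Ê
    open SetoidReasoning setoid

  E^⊆E : ∀ H → E^ H ⊆ E
  E^⊆E H = proj₁

  k⊆E^ : ∀ H → k ⊆ E^ H
  k⊆E^ H p = k⊆E p , k⊆Ê p , λ h _ → fixes h (_ , p)

  -- Subfld_k(E)
  record Subfld : Set (suc ℓ) where
    field
      field′ : Subfield
      k⊆     : k ⊆ field′
      ⊆E     : field′ ⊆ E

  open Subfld public

  _≈ᶠ_ : Subfld → Subfld → Set ℓ
  F ≈ᶠ F′ = member (field′ F) U.≐ member (field′ F′)

  -- The inclusion Ê ⊆ EL and the stability of Ê under Gal(EL/L),
  -- which are what make the restriction map Gal(EL/L) → Γ defined.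
  record Restrictable : Set ℓ where
    field
      Ê⊆EL   : Ê ⊆ EL
      stable : ∀ (σ : GalEL.Carrier) {x} (p : x ∈ᶠ Ê) → proj₁ (⟦ σ ⟧ (x , Ê⊆EL p)) ∈ᶠ Ê

  module Restriction (r : Restrictable) where
    open Restrictable r

    res : GalEL.Carrier → Γ.Carrier
    res σ = record
      { ⟦_⟧ = λ (x , p) → proj₁ (⟦ σ ⟧ (x , Ê⊆EL p)) , stable σ p
      ; isRingIsomorphism = record
        { isRingMonomorphism = record
          { isRingHomomorphism = record
            { isSemiringHomomorphism = record
              { isNearSemiringHomomorphism = record
                { +-isMonoidHomomorphism = record
                  { isMagmaHomomorphism = record
                    { isRelHomomorphism = record { cong = ⟦⟧-cong σ }
                    ; homo = λ (x , p) (y , q) → trans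
                        (⟦⟧-cong σ {_ , Ê⊆EL (Subfield.+-closed Ê p q)}
                          {_ , Subfield.+-closed EL (Ê⊆EL p) (Ê⊆EL q)} refl)
                        (+-homo σ _ _)
                    }
                  ; ε-homo = trans
                      (⟦⟧-cong σ {_ , Ê⊆EL (Subfield.0-closed Ê)} {_ , Subfield.0-closed EL} refl)
                      (0#-homo σ)
                  }
                ; *-homo = λ (x , p) (y , q) → trans
                    (⟦⟧-cong σ {_ , Ê⊆EL (Subfield.*-closed Ê p q)}
                      {_ , Subfield.*-closed EL (Ê⊆EL p) (Ê⊆EL q)} refl)
                    (*-homo σ _ _)
                }
              ; 1#-homo = trans
                  (⟦⟧-cong σ {_ , Ê⊆EL (Subfield.1-closed Ê)} {_ , Subfield.1-closed EL} refl)
                  (1#-homo σ)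
              }
            ; -‿homo = λ (x , p) → trans
                (⟦⟧-cong σ {_ , Ê⊆EL (Subfield.neg-closed Ê p)}
                  {_ , Subfield.neg-closed EL (Ê⊆EL p)} refl)
                (-‿homo σ _)
            }
          ; injective = injective σ
          }
        ; surjective = λ (y , q) →
            (proj₁ (⟦ σ GalEL.⁻¹ ⟧ (y , Ê⊆EL q)) , stable (σ GalEL.⁻¹) q) ,
            λ eq → trans (⟦⟧-cong σ eq) (GalEL.inverseʳ σ (y , Ê⊆EL q))
        }
      ; fixes = λ (a , p) → trans
          (⟦⟧-cong σ {a , Ê⊆EL (k⊆Ê p)} {a , L⊆EL (k⊆L p)} refl) (fixes σ (a , k⊆L p))
      }

    -- 𝔾(L) = res(Gal(EL/L))
    𝔾 : Pred Γ.Carrier ℓ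
    𝔾 γ = ∃[ σ ] res σ Γ.≈ γ

    𝔾-isSubgroup : IsSubgroup Γ 𝔾
    𝔾-isSubgroup = record
      { resp = λ {γ} {γ′} eq (σ , p) → σ , Γ.trans {res σ} {γ} {γ′} p eq
      ; ε-closed = GalEL.ε , λ _ → refl
      ; ∙-closed = λ {γ} {γ′} (σ , p) (τ , q) → σ GalEL.∙ τ , λ (x , m) →
          trans (⟦⟧-cong σ {⟦ τ ⟧ (x , Ê⊆EL m)} {_ , Ê⊆EL (stable τ m)} refl)
            (trans (p (_ , stable τ m)) (⟦⟧-cong γ (q (x , m))))
      ; ⁻¹-closed = λ {γ} (σ , p) → σ GalEL.⁻¹ , λ (x , m) →
          injective γ {proj₁ (⟦ σ GalEL.⁻¹ ⟧ (x , Ê⊆EL m)) , stable (σ GalEL.⁻¹) m}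
            (trans (sym (p _))
              (trans (⟦⟧-cong σ {_ , Ê⊆EL (stable (σ GalEL.⁻¹) m)} refl)
                (trans (GalEL.inverseʳ σ (x , Ê⊆EL m)) (sym (Γ.inverseʳ γ (x , m))))))
      }

    -- 𝔾(L) as a group
    𝔾L : Group ℓ ℓ
    𝔾L = subgroup Γ 𝔾-isSubgroup

    -- Membership of H in Subgp_Γ(𝔾(L)); H · Γ-E is the product set HΓ_E.
    record IsSubgp (H : Pred Γ.Carrier ℓ) : Set ℓ where
      field
        isSubgroup   : IsSubgroup Γ H
        ⊆𝔾           : H U.⊆ 𝔾
        HΓE-subgroup : IsSubgroup Γ (H · Γ-E)

    Subgp : Set (suc ℓ)
    Subgp = ∃ IsSubgp

    _≈ᵍ_ : Subgp → Subgp → Set ℓ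
    (H , _) ≈ᵍ (H′ , _) = H U.≐ H′

    -- Gal(EL/E′L), as a subset of Gal(EL/L)
    GalOver : Subfld → Pred GalEL.Carrier ℓ
    GalOver E′ σ = ∀ x → x ∈ᶠ (field′ E′ ⋎ L) → (p : x ∈ᶠ EL) → proj₁ (⟦ σ ⟧ (x , p)) ≈ x

    -- The underlying set of η_L(E′); that it belongs to Subgp_Γ(𝔾(L)) is a theorem.
    ηL-set : Subfld → Pred Γ.Carrier ℓ
    ηL-set E′ γ = ∃[ σ ] σ ∈ GalOver E′ × res σ Γ.≈ γ

    εL : Subgp → Subfld
    εL (H , _) = record { field′ = E^ H ; k⊆ = k⊆E^ H ; ⊆E = E^⊆E H }

    -- A subset H of 𝔾(L) ⊆ Γ, regarded as a subset of the group 𝔾(L)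
    within𝔾 : Pred Γ.Carrier ℓ → Pred (Group.Carrier 𝔾L) ℓ
    within𝔾 H = H ∘ proj₁

    within𝔾-isSubgroup : ∀ {H} → IsSubgroup Γ H → IsSubgroup 𝔾L (within𝔾 H)
    within𝔾-isSubgroup S = record
      { resp = resp
      ; ε-closed = ε-closed
      ; ∙-closed = ∙-closed
      ; ⁻¹-closed = ⁻¹-closed
      }
      where open IsSubgroup S

    𝔾L/ : ∀ {H} → IsSubgroup Γ H → IsCharacteristic 𝔾L (within𝔾 H) → Group ℓ ℓ
    𝔾L/ S char = quotient 𝔾L (within𝔾-isSubgroup S) (characteristic⇒normal 𝔾L char)

{-# OPTIONS --safe #-}

-- No polynomials are needed: everything rests on Artin's lemma (if P is a group of automorphisms of K with
-- fixed field F, and e₁, …, eₘ ∈ K are independent over F, then P has m members pairwise distinct on e) and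
-- on Dedekind's lemma (a field spanned by m elements over F has at most m embeddings over F). Since E ⊗ₖ L is
-- a field, it is EL, so a k-basis of E is an L-basis of EL and Gal(EL/L) realises all [E : k] embeddings of E
-- over k; so does Γ. Hence Γ = 𝔾(L)Γ_E with 𝔾(L) ∩ Γ_E = 1. Galois theory of Ê/k then identifies
-- η_L(E′)Γ_E with Gal(Ê/E′), and both lemmas, applied to Gal(Ê/E′) and to HΓ_E acting on E, give the degrees
-- and the two inverse relations. If L/k is Galois, then 𝔾(L) = Gal(Ê/(Ê ∩ L)) is normal in Γ, hence so is a
-- characteristic subgroup H, and E^H ⊗ₖ L is the fixed field of H in EL.

module Submission where

open import Defs
open import Level using (Level)
open import Axiom.ExcludedMiddle using (ExcludedMiddle)
open import Algebra.Bundles using (CommutativeRing; Group; AbelianGroup)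
import Algebra.Morphism.Construct.Composition as Composition
open import Algebra.Morphism.Structures using (IsGroupHomomorphism; IsGroupIsomorphism)
import Algebra.Properties.AbelianGroup as AbelianGroupProperties
import Algebra.Properties.CommutativeSemigroup as CommutativeSemigroupProperties
import Algebra.Properties.Group as GroupProperties
import Algebra.Properties.Ring as RingProperties
import Algebra.Properties.Semiring.Exp as Exp
import Algebra.Properties.Semiring.Sum as Sum
open import Data.Fin.Base using (Fin; zero; suc; toℕ; punchIn; punchOut; funToFin; finToFun)
open import Data.Fin.Properties
  using (punchIn-punchOut; suc-injective; pigeonhole; finToFun-funToFin; <⇒≢) renaming (_≟_ to _≟ᶠ_)
open import Data.Nat.Base as ℕ using (ℕ; zero; suc; s≤s)
import Data.Nat.Properties as ℕ
open import Data.Product.Base using (Σ-syntax; ∃; ∃-syntax; _×_; _,_; proj₁; proj₂)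
open import Data.Unit.Polymorphic.Base using (⊤)
open import Data.Vec.Functional using (_∷_)
open import Function.Base using (_∘_; id)
import Function.Bundles
open import Function.Definitions using (Inverseᵇ)
import Relation.Binary.Reasoning.Setoid as SetoidReasoning
open import Relation.Binary.PropositionalEquality.Core as ≡ using (_≡_; _≢_)
open import Relation.Nullary using (¬_; yes; no; contradiction)
open import Relation.Nullary.Decidable.Core using (decidable-stable)
open import Relation.Unary as U using (Pred; _∈_)

-- The usual arguments extend embeddings one generator at a time. Here `exhaust` replaces them by
-- counting: a list of as many embeddings as the degree, told apart on a basis, leaves no room for
-- another, so every embedding over the base occurs in the list. For this reason Artin's lemma
-- delivers a list distinct on a prescribed family rather than the order of a group, and it is
-- proved by descent inside Kᵐ for a group P that may be infinite: neither Γ nor Gal(EL/L) is known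
-- to be finite when it is applied. Before restriction from EL to Ê is available, the two groups can
-- be compared only through their values on E in Ω. Minimality of the Galois closure serves one
-- purpose, to show that the conjugates of E generate Ê; then Ê ⊆ EL and the stability of Ê are
-- checked on elements γ(x) with x in E. The group given to Artin's lemma is HΓ_E and not H: the
-- fixed field of H in Ê may leave E, while that of HΓ_E is E^H. Normality of 𝔾(L) meets one more
-- obstacle. Ê/k is given only as algebraic, and its degree is bounded by dᵈ with d = [E : k]
-- through the action on the d embeddings of E.

private
  variable
    ℓ ℓ₁ ℓ₂ : Level

-- Ring homomorphisms and linear algebra

module Classical (em : ∀ {a} → ExcludedMiddle a) where

  by-contradiction : {A : Set ℓ₁} → ¬ ¬ A → A
  by-contradiction = decidable-stable em

  ¬∀⇒∃¬ : {A : Set ℓ₁} {P : A → Set ℓ₂} → ¬ (∀ x → P x) → ∃[ x ] ¬ P x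
  ¬∀⇒∃¬ ¬∀ = by-contradiction λ ¬∃ → ¬∀ λ x → by-contradiction λ ¬Px → ¬∃ (x , ¬Px)

module _ {A B : CRing ℓ} (φ : A ⟶ B) where
  private
    module A = CommutativeRing A
    module B = CommutativeRing B
    module φ = _⟶_ φ
    module ΣA = Sum A.semiring
    module ΣB = Sum B.semiring
    module ^A = Exp A.semiring
    module ^B = Exp B.semiring

  sum-homo : ∀ {n} (f : Fin n → A.Carrier) → φ.⟦ ΣA.sum f ⟧ B.≈ ΣB.sum (φ.⟦_⟧ ∘ f)
  sum-homo {zero}  f = φ.0#-homo
  sum-homo {suc n} f = B.trans (φ.+-homo _ _) (B.+-congˡ (sum-homo (f ∘ suc)))

  ^-homo : ∀ x n → φ.⟦ x ^A.^ n ⟧ B.≈ φ.⟦ x ⟧ ^B.^ n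
  ^-homo x zero    = φ.1#-homo
  ^-homo x (suc n) = B.trans (φ.*-homo _ _) (B.*-congˡ (^-homo x n))

  combination : ∀ {n} → (Fin n → A.Carrier) → (Fin n → B.Carrier) → B.Carrier
  combination a b = ΣB.sum λ i → φ.⟦ a i ⟧ B.* b i

  Independent : ∀ {n} → (Fin n → B.Carrier) → Set ℓ
  Independent b = ∀ a → combination a b B.≈ B.0# → ∀ i → a i A.≈ A.0#

  Spanning : ∀ {n} → (Fin n → B.Carrier) → Set ℓ
  Spanning b = ∀ x → ∃[ a ] x B.≈ combination a b

infixr 9 _∘ʰ_

_∘ʰ_ : {A B C : CRing ℓ} → B ⟶ C → A ⟶ B → A ⟶ C
_∘ʰ_ {C = C} ψ φ = record
  { isRingHomomorphism = Composition.isRingHomomorphism (CommutativeRing.trans C)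
      (_⟶_.isRingHomomorphism φ) (_⟶_.isRingHomomorphism ψ) }

combination-homo : {F A B : CRing ℓ} (φ : F ⟶ A) (ψ : A ⟶ B) → ∀ {n} a (b : Fin n → _) →
  CommutativeRing._≈_ B (_⟶_.⟦_⟧ ψ (combination φ a b)) (combination (ψ ∘ʰ φ) a (_⟶_.⟦_⟧ ψ ∘ b))
combination-homo {A = A} {B} φ ψ {n} a b =
  B.trans (sum-homo ψ λ i → _⟶_.⟦_⟧ φ (a i) A.* b i) (Sum.sum-cong-≋ B.semiring {n} λ i → _⟶_.*-homo ψ _ _)
  where
  module A = CommutativeRing A
  module B = CommutativeRing B

combination-agree : {F A B : CRing ℓ} (φ : F ⟶ A) (s t : A ⟶ B) → let open CommutativeRing B in
  ∀ {n} a (b : Fin n → _) → (∀ i → _⟶_.⟦_⟧ s (_⟶_.⟦_⟧ φ (a i)) ≈ _⟶_.⟦_⟧ t (_⟶_.⟦_⟧ φ (a i))) →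
  (∀ i → _⟶_.⟦_⟧ s (b i) ≈ _⟶_.⟦_⟧ t (b i)) →
  _⟶_.⟦_⟧ s (combination φ a b) ≈ _⟶_.⟦_⟧ t (combination φ a b)
combination-agree {B = B} φ s t {n} a b p q = B.trans (combination-homo φ s a b)
  (B.trans (Sum.sum-cong-≋ B.semiring {n} λ i → B.*-cong (p i) (q i)) (B.sym (combination-homo φ t a b)))
  where module B = CommutativeRing B

IsInjective : {A B : CRing ℓ} → A ⟶ B → Set ℓ
IsInjective {A = A} {B} φ = ∀ {x y} → CommutativeRing._≈_ B (_⟶_.⟦_⟧ φ x) (_⟶_.⟦_⟧ φ y) → CommutativeRing._≈_ A x y

module _ {A B : CRing ℓ} (φ : A ⟶ B) where
  private
    module A = CommutativeRing A
    module B = CommutativeRing B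
    module φ = _⟶_ φ

  trivialKernel⇒injective : (∀ x → φ.⟦ x ⟧ B.≈ B.0# → x A.≈ A.0#) → IsInjective φ
  trivialKernel⇒injective ker {x} {y} eq = x∙y⁻¹≈ε⇒x≈y x y (ker _ (begin
    φ.⟦ x A.- y ⟧           ≈⟨ φ.+-homo x (A.- y) ⟩
    φ.⟦ x ⟧ B.+ φ.⟦ A.- y ⟧ ≈⟨ B.+-cong eq (φ.-‿homo y) ⟩
    φ.⟦ y ⟧ B.- φ.⟦ y ⟧     ≈⟨ B.-‿inverseʳ _ ⟩
    B.0#                    ∎))
    where
    open SetoidReasoning B.setoid
    open GroupProperties A.+-group using (x∙y⁻¹≈ε⇒x≈y)

  module _ (injective : IsInjective φ) where

    -- All laws, including congruence, are checked after applying the injective `φ`, where they hold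
    -- for `h`. A lift `g` of the bare map is therefore enough.
    factor : {C : CRing ℓ} (h : C ⟶ B) (g : CommutativeRing.Carrier C → A.Carrier) →
      (∀ x → φ.⟦ g x ⟧ B.≈ _⟶_.⟦_⟧ h x) → C ⟶ A
    factor {C} h g eq = record
      { ⟦_⟧ = g
      ; isRingHomomorphism = record
        { isSemiringHomomorphism = record
          { isNearSemiringHomomorphism = record
            { +-isMonoidHomomorphism = record
              { isMagmaHomomorphism = record
                { isRelHomomorphism = record { cong = λ x≈y → lift (h.⟦⟧-cong x≈y) (eq _) }
                ; homo = λ x y → lift (h.+-homo x y)
                    (B.trans (φ.+-homo _ _) (B.+-cong (eq x) (eq y)))
                }
              ; ε-homo = lift h.0#-homo φ.0#-homo
              }
            ; *-homo = λ x y → lift (h.*-homo x y)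
                (B.trans (φ.*-homo _ _) (B.*-cong (eq x) (eq y)))
            }
          ; 1#-homo = lift h.1#-homo φ.1#-homo
          }
        ; -‿homo = λ x → lift (h.-‿homo x) (B.trans (φ.-‿homo _) (B.-‿cong (eq x)))
        }
      }
      where
      module h = _⟶_ h
      lift : ∀ {x z y} → h.⟦ x ⟧ B.≈ z → φ.⟦ y ⟧ B.≈ z → g x A.≈ y
      lift p q = injective (B.trans (eq _) (B.trans p (B.sym q)))

module _ {F K : CRing ℓ} {φ : F ⟶ K} where

  automorphism⇒homomorphism : Automorphism φ → K ⟶ K
  automorphism⇒homomorphism σ = record { isRingHomomorphism = Automorphism.isRingHomomorphism σ }

-- Stability of the image of `θ` under σ and its inverse is passed in as the lifts `f` and `f⁻¹`;
-- injectivity does the rest. This form covers transport along an isomorphism, restriction to a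
-- subfield, and descent to `E^H ⊗ L`.
restrictAutomorphism : {F A B : CRing ℓ} (φ : F ⟶ A) (ψ : F ⟶ B) (θ : A ⟶ B) → IsInjective θ →
  let module A = CommutativeRing A; module B = CommutativeRing B
      θ⟦_⟧ = _⟶_.⟦_⟧ θ
  in (∀ x → θ⟦ _⟶_.⟦_⟧ φ x ⟧ B.≈ _⟶_.⟦_⟧ ψ x) →
  (σ : Automorphism ψ) →
  (f : A.Carrier → A.Carrier) → (∀ x → θ⟦ f x ⟧ B.≈ Automorphism.⟦_⟧ σ θ⟦ x ⟧) →
  (f⁻¹ : A.Carrier → A.Carrier) → (∀ x → θ⟦ f⁻¹ x ⟧ B.≈ Automorphism.⟦_⟧ (Group._⁻¹ (Gal ψ) σ) θ⟦ x ⟧) →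
  Automorphism φ
restrictAutomorphism {B = B} φ ψ θ injective over σ f eq f⁻¹ eq⁻¹ = record
  { ⟦_⟧ = f
  ; isRingIsomorphism = record
    { isRingMonomorphism = record
      { isRingHomomorphism = fʰ.isRingHomomorphism
      ; injective = λ {x} {y} p → injective (σ.injective
          (B.trans (B.sym (eq x)) (B.trans (θ.⟦⟧-cong p) (eq y))))
      }
    ; surjective = λ y → f⁻¹ y , λ z≈ → injective
        (B.trans (θ.⟦⟧-cong (fʰ.⟦⟧-cong z≈))
          (B.trans (eq _) (B.trans (σ.⟦⟧-cong (eq⁻¹ y)) (Group.inverseʳ (Gal ψ) σ θ.⟦ y ⟧))))
    }
  ; fixes = λ x → injective (B.trans (eq _)
      (B.trans (σ.⟦⟧-cong (over x)) (B.trans (σ.fixes x) (B.sym (over x)))))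
  }
  where
  module B = CommutativeRing B
  module θ = _⟶_ θ
  module σ = Automorphism σ
  module fʰ = _⟶_ (factor θ injective (automorphism⇒homomorphism σ ∘ʰ θ) f eq)

module FieldProperties {R : CRing ℓ} (isField : IsField R) where
  open CommutativeRing R hiding (zero)
  open IsField isField

  inverse-unique : ∀ {x y z} → x * y ≈ 1# → x * z ≈ 1# → y ≈ z
  inverse-unique {x} {y} {z} xy≈1 xz≈1 = begin
    y           ≈⟨ *-identityʳ y ⟨
    y * 1#      ≈⟨ *-congˡ xz≈1 ⟨
    y * (x * z) ≈⟨ *-assoc y x z ⟨
    y * x * z   ≈⟨ *-congʳ (*-comm y x) ⟩
    x * y * z   ≈⟨ *-congʳ xy≈1 ⟩
    1# * z      ≈⟨ *-identityˡ z ⟩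
    z           ∎
    where open SetoidReasoning setoid

  *-cancelˡ-≉0 : ∀ {x y} → ¬ x ≈ 0# → x * y ≈ 0# → y ≈ 0#
  *-cancelˡ-≉0 {x} {y} x≉0 xy≈0 = let (x⁻¹ , eq) = inverse x x≉0 in begin
    y             ≈⟨ *-identityˡ y ⟨
    1# * y        ≈⟨ *-congʳ (trans (*-comm x⁻¹ x) eq) ⟨
    x⁻¹ * x * y   ≈⟨ *-assoc _ _ _ ⟩
    x⁻¹ * (x * y) ≈⟨ *-congˡ xy≈0 ⟩
    x⁻¹ * 0#      ≈⟨ zeroʳ _ ⟩
    0#            ∎
    where open SetoidReasoning setoid

isInvertible⇒≉0 : (R : CRing ℓ) → let open CommutativeRing R in
  ¬ 1# ≈ 0# → ∀ {x y} → x * y ≈ 1# → ¬ x ≈ 0#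
isInvertible⇒≉0 R 1≉0 {x} {y} xy≈1 x≈0 = 1≉0 (trans (sym xy≈1) (trans (*-congʳ x≈0) (zeroˡ y)))
  where open CommutativeRing R

-- Homogeneous linear systems over a field

module LinearAlgebra (em : ∀ {a} → ExcludedMiddle a) {R : CRing ℓ} (isField : IsField R) where
  open Classical em
  open CommutativeRing R hiding (zero)
  open IsField isField
  open Sum semiring
  open RingProperties ring
  open SetoidReasoning setoid

  NonZero : ∀ {n} → (Fin n → Carrier) → Set ℓ
  NonZero y = ∃[ i ] ¬ y i ≈ 0#

  ¬nonZero⇒≈0 : ∀ {n} {y : Fin n → Carrier} → ¬ NonZero y → ∀ i → y i ≈ 0#
  ¬nonZero⇒≈0 ¬nz i = by-contradiction λ yᵢ≉0 → ¬nz (i , yᵢ≉0)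

  sum-zero : ∀ n {f : Fin n → Carrier} → (∀ i → f i ≈ 0#) → sum f ≈ 0#
  sum-zero n eq = trans (sum-cong-≋ {n} eq) (sum-replicate-zero n)

  sum-linear : ∀ n (f g : Fin n → Carrier) c → sum (λ i → f i + c * g i) ≈ sum f + c * sum g
  sum-linear n f g c = trans (∑-distrib-+ {n} f _) (+-congˡ (sym (*-distribˡ-sum {n} c g)))

  -- Gaussian elimination on the first column, by induction on the number of rows. The rows other
  -- than the pivot `p` are indexed through `punchIn p`.
  homogeneousSystem : ∀ {r m} → r ℕ.< m → (A : Fin r → Fin m → Carrier) →
    ∃[ y ] NonZero y × (∀ i → sum (λ j → A i j * y j) ≈ 0#)
  homogeneousSystem {zero}  {suc m} _ A = (λ _ → 1#) , (zero , 1≉0) , λ ()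
  homogeneousSystem {suc r} {suc m} (s≤s r<m) A with em {P = ∃[ p ] ¬ A p zero ≈ 0#}
  -- The first unknown occurs in no equation, so the first unit vector is a solution.
  ... | no none = (1# ∷ λ _ → 0#) , (zero , 1≉0) , λ i → begin
    A i zero * 1# + sum (λ j → A i (suc j) * 0#) ≈⟨ +-cong (*-identityʳ _) (sum-zero m λ j → zeroʳ _) ⟩
    A i zero + 0#                                ≈⟨ +-identityʳ _ ⟩
    A i zero                                     ≈⟨ ¬nonZero⇒≈0 {y = λ p → A p zero} none i ⟩
    0#                                           ∎
  ... | yes (p , Aₚ≉0) =
    (y₀ ∷ y) , (let (j , yⱼ≉0) = y-nonZero in suc j , yⱼ≉0) , rows
    where
    d = proj₁ (inverse _ Aₚ≉0)
    c : Fin r → Carrier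
    c i = - (A (punchIn p i) zero * d)
    eliminated = homogeneousSystem r<m λ i j → A (punchIn p i) (suc j) + c i * A p (suc j)
    y = proj₁ eliminated
    y-nonZero = proj₁ (proj₂ eliminated)
    S : Fin (suc r) → Carrier
    S q = sum λ j → A q (suc j) * y j
    -- Row `p` solved for its first unknown. With this value any other row becomes its eliminated
    -- form, because `c i` is the coefficient with which the pivot row was added to it.
    y₀ = - (d * S p)
    pivot : ∀ q → A q zero * y₀ ≈ - (A q zero * d) * S p
    pivot q = begin
      A q zero * - (d * S p)   ≈⟨ -‿distribʳ-* _ _ ⟨
      - (A q zero * (d * S p)) ≈⟨ -‿cong (*-assoc _ _ _) ⟨
      - (A q zero * d * S p)   ≈⟨ -‿distribˡ-* _ _ ⟩
      - (A q zero * d) * S p   ∎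
    rows : ∀ q → A q zero * y₀ + S q ≈ 0#
    rows q with p ≟ᶠ q
    ... | yes ≡.refl = begin
      A p zero * y₀ + S p          ≈⟨ +-congʳ (pivot p) ⟩
      - (A p zero * d) * S p + S p ≈⟨ +-congʳ (*-congʳ (-‿cong (proj₂ (inverse _ Aₚ≉0)))) ⟩
      - 1# * S p + S p             ≈⟨ +-congʳ (-1*x≈-x (S p)) ⟩
      - S p + S p                  ≈⟨ -‿inverseˡ (S p) ⟩
      0#                           ∎
    ... | no p≢q = ≡.subst (λ q → A q zero * y₀ + S q ≈ 0#) (punchIn-punchOut p≢q) (begin
      A (punchIn p i) zero * y₀ + S (punchIn p i) ≈⟨ +-congʳ (pivot _) ⟩
      c i * S p + S (punchIn p i)                 ≈⟨ +-comm _ _ ⟩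
      S (punchIn p i) + c i * S p                 ≈⟨ sum-linear m _ _ (c i) ⟨
      sum (λ j → A (punchIn p i) (suc j) * y j + c i * (A p (suc j) * y j))
        ≈⟨ sum-cong-≋ {m} (λ j → trans (distribʳ _ _ _) (+-congˡ (*-assoc _ _ _))) ⟨
      sum (λ j → (A (punchIn p i) (suc j) + c i * A p (suc j)) * y j)
        ≈⟨ proj₂ (proj₂ eliminated) i ⟩
      0#                                          ∎)
      where i = punchOut p≢q

-- Linear combinations, bases and dimension

module _ (F : CRing ℓ) where
  private
    module F = CommutativeRing F

  unit : ∀ {n} → Fin n → Fin n → F.Carrier
  unit zero    zero    = F.1#
  unit zero    (suc j) = F.0#
  unit (suc i) zero    = F.0#
  unit (suc i) (suc j) = unit i j

  unit-sym : ∀ {n} (i j : Fin n) → unit i j ≡ unit j i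
  unit-sym zero    zero    = ≡.refl
  unit-sym zero    (suc j) = ≡.refl
  unit-sym (suc i) zero    = ≡.refl
  unit-sym (suc i) (suc j) = unit-sym i j

module Combination {F K : CRing ℓ} (φ : F ⟶ K) where
  private
    module F = CommutativeRing F
    module φ = _⟶_ φ
  open CommutativeRing K hiding (zero)
  open Sum semiring
  open SetoidReasoning setoid

  combination-cong : ∀ {n} {a a′ : Fin n → F.Carrier} {b b′ : Fin n → Carrier} →
    (∀ i → a i F.≈ a′ i) → (∀ i → b i ≈ b′ i) → combination φ a b ≈ combination φ a′ b′
  combination-cong {n} p q = sum-cong-≋ {n} λ i → *-cong (φ.⟦⟧-cong (p i)) (q i)

  combination-0 : ∀ {n} (b : Fin n → Carrier) → combination φ (λ _ → F.0#) b ≈ 0#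
  combination-0 {n} b = trans (sum-cong-≋ {n} λ i → trans (*-congʳ φ.0#-homo) (zeroˡ (b i))) (sum-replicate-zero n)

  combination-+ : ∀ {n} a a′ (b : Fin n → Carrier) →
    combination φ (λ i → a i F.+ a′ i) b ≈ combination φ a b + combination φ a′ b
  combination-+ {n} a a′ b = trans
    (sum-cong-≋ {n} λ i → trans (*-congʳ (φ.+-homo _ _)) (distribʳ _ _ _))
    (∑-distrib-+ {n} _ _)

  combination-scale : ∀ {n} c a (b : Fin n → Carrier) →
    combination φ (λ i → c F.* a i) b ≈ φ.⟦ c ⟧ * combination φ a b
  combination-scale {n} c a b = trans
    (sum-cong-≋ {n} λ i → trans (*-congʳ (φ.*-homo _ _)) (*-assoc _ _ _))
    (sym (*-distribˡ-sum {n} _ _))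

  combination-unit : ∀ {n} i (b : Fin n → Carrier) → combination φ (unit F i) b ≈ b i
  combination-unit zero    b = trans (+-cong (trans (*-congʳ φ.1#-homo) (*-identityˡ _)) (combination-0 (b ∘ suc))) (+-identityʳ _)
  combination-unit (suc i) b = trans (+-cong (trans (*-congʳ φ.0#-homo) (zeroˡ _)) (combination-unit i (b ∘ suc))) (+-identityˡ _)

  independent⇒unique : ∀ {n} {b : Fin n → Carrier} → Independent φ b → ∀ a a′ →
    combination φ a b ≈ combination φ a′ b → ∀ i → a i F.≈ a′ i
  independent⇒unique {b = b} independent a a′ eq i = x∙y⁻¹≈ε⇒x≈y _ _
    (independent (λ i → a i F.- a′ i) (begin
      combination φ (λ i → a i F.- a′ i) b
        ≈⟨ combination-cong (λ i → F.+-congˡ (F.sym (-1*x≈-x (a′ i)))) (λ _ → refl) ⟩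
      combination φ (λ i → a i F.+ F.- F.1# F.* a′ i) b ≈⟨ combination-+ a _ b ⟩
      combination φ a b + combination φ (λ i → F.- F.1# F.* a′ i) b ≈⟨ +-cong eq (combination-scale _ a′ b) ⟩
      combination φ a′ b + φ.⟦ F.- F.1# ⟧ * combination φ a′ b
        ≈⟨ +-congˡ (trans (*-congʳ (trans (φ.-‿homo _) (-‿cong φ.1#-homo))) (RingProperties.-1*x≈-x ring _)) ⟩
      combination φ a′ b - combination φ a′ b ≈⟨ -‿inverseʳ _ ⟩
      0# ∎) i)
    where
    open RingProperties F.ring using (-1*x≈-x; x∙y⁻¹≈ε⇒x≈y)

module Dimension (em : ∀ {a} → ExcludedMiddle a) {F K : CRing ℓ} (φ : F ⟶ K) (F-isField : IsField F) where
  open Classical em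
  private
    module F = CommutativeRing F
    module K = CommutativeRing K
    module φ = _⟶_ φ
    module LA = LinearAlgebra em F-isField
    module ΣF = Sum F.semiring
  open Combination φ using (combination-scale)
  open IsField F-isField
  open Sum K.semiring
  open SetoidReasoning K.setoid

  -- The coordinates of `v` with respect to `b` form `n` equations in `N` unknowns; a nonzero
  -- solution is a relation on `v`.
  spanning⇒dependent : ∀ {n N} → n ℕ.< N → (b : Fin n → K.Carrier) → Spanning φ b →
    (v : Fin N → K.Carrier) → ¬ Independent φ v
  spanning⇒dependent {n} {N} n<N b span v independent = cᵢ≉0 (independent c dependence i)
    where
    A : Fin N → Fin n → F.Carrier
    A i = proj₁ (span (v i))
    system = LA.homogeneousSystem n<N λ j i → A i j
    c = proj₁ system
    i = proj₁ (proj₁ (proj₂ system))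
    cᵢ≉0 = proj₂ (proj₁ (proj₂ system))
    column : ∀ j → sum (λ i → φ.⟦ c i ⟧ K.* (φ.⟦ A i j ⟧ K.* b j)) K.≈ K.0#
    column j = begin
      sum (λ i → φ.⟦ c i ⟧ K.* (φ.⟦ A i j ⟧ K.* b j))
        ≈⟨ sum-cong-≋ {N} (λ i → K.trans (K.sym (K.*-assoc _ _ _)) (K.*-congʳ
             (K.trans (K.sym (φ.*-homo _ _)) (φ.⟦⟧-cong (F.*-comm _ _))))) ⟩
      sum (λ i → φ.⟦ A i j F.* c i ⟧ K.* b j) ≈⟨ *-distribʳ-sum {N} (b j) _ ⟨
      sum (λ i → φ.⟦ A i j F.* c i ⟧) K.* b j ≈⟨ K.*-congʳ (sum-homo φ λ i → A i j F.* c i) ⟨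
      φ.⟦ ΣF.sum (λ i → A i j F.* c i) ⟧ K.* b j ≈⟨ K.*-congʳ (φ.⟦⟧-cong (proj₂ (proj₂ system) j)) ⟩
      φ.⟦ F.0# ⟧ K.* b j ≈⟨ K.*-congʳ φ.0#-homo ⟩
      K.0# K.* b j ≈⟨ K.zeroˡ (b j) ⟩
      K.0# ∎
    dependence : combination φ c v K.≈ K.0#
    dependence = begin
      sum (λ i → φ.⟦ c i ⟧ K.* v i)
        ≈⟨ sum-cong-≋ {N} (λ i → K.trans (K.*-congˡ (proj₂ (span (v i))))
             (*-distribˡ-sum {n} φ.⟦ c i ⟧ λ j → φ.⟦ A i j ⟧ K.* b j)) ⟩
      sum (λ i → sum λ j → φ.⟦ c i ⟧ K.* (φ.⟦ A i j ⟧ K.* b j)) ≈⟨ ∑-comm {N} {n} _ ⟩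
      sum (λ j → sum λ i → φ.⟦ c i ⟧ K.* (φ.⟦ A i j ⟧ K.* b j)) ≈⟨ sum-cong-≋ {n} column ⟩
      sum (λ (j : Fin n) → K.0#) ≈⟨ sum-replicate-zero n ⟩
      K.0# ∎

  -- Stands in for finite degree while no basis is at hand: unlike a basis, such a bound passes to
  -- subfields at once, and `bounded⇒finite` recovers a basis from it.
  Bounded : ℕ → Set ℓ
  Bounded n = ∀ {r} → n ℕ.< r → (v : Fin r → K.Carrier) → ¬ Independent φ v

  independent-∷ : ∀ {n} {v : Fin n → K.Carrier} {x} → Independent φ v →
    ¬ (∃[ a ] x K.≈ combination φ a v) → Independent φ (x ∷ v)
  independent-∷ {n} {v} {x} independent x∉span a eq = λ
    { zero    → a₀≈0
    ; (suc i) → independent (a ∘ suc) (begin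
        combination φ (a ∘ suc) v                        ≈⟨ K.+-identityˡ _ ⟨
        K.0# K.+ combination φ (a ∘ suc) v               ≈⟨ K.+-congʳ (K.zeroˡ x) ⟨
        K.0# K.* x K.+ combination φ (a ∘ suc) v         ≈⟨ K.+-congʳ (K.*-congʳ φ.0#-homo) ⟨
        φ.⟦ F.0# ⟧ K.* x K.+ combination φ (a ∘ suc) v   ≈⟨ K.+-congʳ (K.*-congʳ (φ.⟦⟧-cong a₀≈0)) ⟨
        φ.⟦ a zero ⟧ K.* x K.+ combination φ (a ∘ suc) v ≈⟨ eq ⟩
        K.0#                                             ∎) i
    }
    where
    open RingProperties K.ring
    a₀≈0 : a zero F.≈ F.0#
    a₀≈0 = by-contradiction λ a₀≉0 → let (d , a₀d≈1) = inverse _ a₀≉0 in x∉span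
      ( (λ i → F.- d F.* a (suc i))
      , (begin
          x                                                ≈⟨ K.*-identityˡ x ⟨
          K.1# K.* x
            ≈⟨ K.*-congʳ (K.trans (φ.⟦⟧-cong (F.trans (F.*-comm d _) a₀d≈1)) φ.1#-homo) ⟨
          φ.⟦ d F.* a zero ⟧ K.* x                         ≈⟨ K.*-congʳ (φ.*-homo _ _) ⟩
          φ.⟦ d ⟧ K.* φ.⟦ a zero ⟧ K.* x                   ≈⟨ K.*-assoc _ _ _ ⟩
          φ.⟦ d ⟧ K.* (φ.⟦ a zero ⟧ K.* x)                 ≈⟨ K.*-congˡ (+-inverseˡ-unique _ _ eq) ⟩
          φ.⟦ d ⟧ K.* K.- combination φ (a ∘ suc) v        ≈⟨ -‿distribʳ-* _ _ ⟨
          K.- (φ.⟦ d ⟧ K.* combination φ (a ∘ suc) v)      ≈⟨ -‿distribˡ-* _ _ ⟩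
          K.- φ.⟦ d ⟧ K.* combination φ (a ∘ suc) v        ≈⟨ K.*-congʳ (φ.-‿homo d) ⟨
          φ.⟦ F.- d ⟧ K.* combination φ (a ∘ suc) v        ≈⟨ combination-scale (F.- d) (a ∘ suc) v ⟨
          combination φ (λ i → F.- d F.* a (suc i)) v      ∎) )

  -- Extension to a basis, as an induction principle: the family grows until it spans, and `Q` is
  -- then pulled back along the added vectors. A constant `Q` gives the existence of a basis; with
  -- `Q` independence over L, a fact about bases reaches every independent family.
  extension-induction : ∀ {n} → Bounded n → (Q : ∀ {r} → (Fin r → K.Carrier) → Set ℓ) →
    (∀ {r} (v : Fin r → K.Carrier) → Spanning φ v → Independent φ v → Q v) →
    (∀ {r} x (v : Fin r → K.Carrier) → Q (x ∷ v) → Q v) →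
    ∀ {r} (v : Fin r → K.Carrier) → Independent φ v → Q v
  extension-induction {n} bounded Q Q-basis Q-tail {r} = extend (suc n) (ℕ.m≤n+m (suc n) r)
    where
    -- `t` is fuel. The invariant `n < r + t` survives each added vector, and at `t = 0` the family
    -- has outgrown the bound.
    extend : ∀ t {r} → n ℕ.< r ℕ.+ t → (v : Fin r → K.Carrier) → Independent φ v → Q v
    extend zero    {r} n<r+0 v independent = contradiction independent
      (bounded (≡.subst (n ℕ.<_) (ℕ.+-identityʳ r) n<r+0) v)
    extend (suc t) {r} n<r+1+t v independent with em {P = Spanning φ v}
    ... | yes span = Q-basis v span independent
    ... | no ¬span = let (x , x∉span) = ¬∀⇒∃¬ ¬span in Q-tail x v
      (extend t (≡.subst (n ℕ.<_) (ℕ.+-suc r t) n<r+1+t) (x ∷ v) (independent-∷ independent x∉span))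

  bounded⇒finite : ∀ {n} → Bounded n → IsFinite φ
  bounded⇒finite bounded = extension-induction bounded (λ _ → IsFinite φ)
    (λ v span independent → _ , v , span , independent) (λ _ _ finite → finite) {0} (λ ()) λ _ _ ()

  -- The powers 1, x, ..., xⁿ are n + 1 vectors in a space spanned by n.
  spanning⇒algebraic : ∀ {n} (b : Fin n → K.Carrier) → Spanning φ b → IsAlgebraic φ
  spanning⇒algebraic {n} b span x =
    let (a , ¬a≈0) = ¬∀⇒∃¬ (spanning⇒dependent ℕ.≤-refl b span λ i → x ^ toℕ i)
        (eq , ¬a≈0) = by-contradiction λ ¬p → ¬a≈0 λ eq → by-contradiction λ ¬q → ¬p (eq , ¬q)
    in suc n , a , ¬∀⇒∃¬ ¬a≈0 , eq
    where open Exp K.semiring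

-- Characters and groups of automorphisms

module Dedekind (em : ∀ {a} → ExcludedMiddle a) {R : CRing ℓ} (isField : IsField R)
    {X : Set ℓ} (_∙_ : X → X → X) (u : X) where
  open Classical em
  open CommutativeRing R hiding (zero)
  open IsField isField
  open FieldProperties isField
  open Sum semiring
  open LinearAlgebra em isField
  open RingProperties ring
  open SetoidReasoning setoid

  -- `X` carries a bare operation and a point, so the multiplication and unit of any ring serve, and
  -- ring homomorphisms into the field are characters. The value at `u` rules out the zero map.
  record IsCharacter (χ : X → Carrier) : Set ℓ where
    field
      ∙-homo : ∀ x y → χ (x ∙ y) ≈ χ x * χ y
      u-homo : χ u ≈ 1#
  open IsCharacter

  Distinct : ∀ {n} → (Fin n → X → Carrier) → Set ℓ
  Distinct χ = ∀ i j → i ≢ j → ∃[ x ] ¬ χ i x ≈ χ j x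

  -- The relation at `m ∙ x` minus `t` times the relation at `x`. For `t` equal to the value of one
  -- character at `m`, that character drops out.
  shift-relation : ∀ {n} (χ : Fin n → X → Carrier) → (∀ i → IsCharacter (χ i)) →
    ∀ (c : Fin n → Carrier) → (∀ x → sum (λ i → c i * χ i x) ≈ 0#) →
    ∀ m t x → sum (λ i → c i * (χ i m - t) * χ i x) ≈ 0#
  shift-relation {n} χ isChar c relation m t x = begin
    sum (λ i → c i * (χ i m - t) * χ i x) ≈⟨ sum-cong-≋ {n} (λ i → split (c i) (∙-homo (isChar i) m x)) ⟩
    sum (λ i → c i * χ i (m ∙ x) + - t * (c i * χ i x)) ≈⟨ sum-linear n _ _ _ ⟩
    sum (λ i → c i * χ i (m ∙ x)) + - t * sum (λ i → c i * χ i x) ≈⟨ +-cong (relation (m ∙ x)) (*-congˡ (relation x)) ⟩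
    0# + - t * 0# ≈⟨ trans (+-identityˡ _) (zeroʳ _) ⟩
    0# ∎
    where
    split : ∀ c {s y sy} → sy ≈ s * y → c * (s - t) * y ≈ c * sy + - t * (c * y)
    split c {s} {y} {sy} eq = begin
      c * (s - t) * y         ≈⟨ *-assoc _ _ _ ⟩
      c * ((s - t) * y)       ≈⟨ *-congˡ (distribʳ y s (- t)) ⟩
      c * (s * y + - t * y)   ≈⟨ distribˡ c _ _ ⟩
      c * (s * y) + c * (- t * y)
        ≈⟨ +-cong (*-congˡ (sym eq)) (trans (sym (*-assoc _ _ _)) (trans (*-congʳ (*-comm _ _)) (*-assoc _ _ _))) ⟩
      c * sy + - t * (c * y)  ∎

  -- Dedekind's induction: shifting by `χ zero m` leaves a relation among the remaining characters
  -- with coefficients `c i * (χ i m - χ zero m)`, all zero by induction. Choosing `m` to separate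
  -- `χ i` from `χ zero` kills `c i`, and evaluation at `u` kills `c zero`.
  characters-independent : ∀ {n} (χ : Fin n → X → Carrier) → (∀ i → IsCharacter (χ i)) → Distinct χ →
    ∀ (c : Fin n → Carrier) → (∀ x → sum (λ i → c i * χ i x) ≈ 0#) → ∀ i → c i ≈ 0#
  characters-independent {suc n} χ isChar distinct c relation = λ
    { zero    → begin
        c zero                                        ≈⟨ *-identityʳ _ ⟨
        c zero * 1#                                   ≈⟨ *-congˡ (u-homo (isChar zero)) ⟨
        c zero * χ zero u                             ≈⟨ +-identityʳ _ ⟨
        c zero * χ zero u + 0#
          ≈⟨ +-congˡ (sum-zero n (λ i → trans (*-congʳ (tail≈0 i)) (zeroˡ _))) ⟨
        c zero * χ zero u + sum (λ i → c (suc i) * χ (suc i) u) ≈⟨ relation u ⟩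
        0#                                            ∎
    ; (suc i) → tail≈0 i
    }
    where
    shifted : ∀ m x → sum (λ i → c (suc i) * (χ (suc i) m - χ zero m) * χ (suc i) x) ≈ 0#
    shifted m x = begin
      sum (λ i → c (suc i) * (χ (suc i) m - χ zero m) * χ (suc i) x) ≈⟨ +-identityˡ _ ⟨
      0# + sum (λ i → c (suc i) * (χ (suc i) m - χ zero m) * χ (suc i) x)
        ≈⟨ +-congʳ (trans (*-congʳ (trans (*-congˡ (-‿inverseʳ _)) (zeroʳ _))) (zeroˡ _)) ⟨
      sum (λ i → c i * (χ i m - χ zero m) * χ i x) ≈⟨ shift-relation χ isChar c relation m (χ zero m) x ⟩
      0# ∎
    tail≈0 : ∀ i → c (suc i) ≈ 0#
    tail≈0 i = by-contradiction λ cᵢ≉0 →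
      let (m , χᵢm≉χ₀m) = distinct (suc i) zero λ () in
      χᵢm≉χ₀m (x∙y⁻¹≈ε⇒x≈y _ _ (*-cancelˡ-≉0 cᵢ≉0
        (characters-independent (χ ∘ suc) (isChar ∘ suc)
          (λ i j i≢j → distinct (suc i) (suc j) (i≢j ∘ suc-injective)) _ (shifted m) i)))

  -- The coefficients `a` depend on `x` but not on `i`; this encodes linearity of all `χ i` over a
  -- common base. A nonzero `c` with Σ cᵢ χᵢ = 0 at the `n` points `b j` exists since n < N, and the
  -- relation spreads to all `x`, contradicting independence unless two characters agree.
  characters-coincide : ∀ {n N} → n ℕ.< N → (χ : Fin N → X → Carrier) → (∀ i → IsCharacter (χ i)) →
    (b : Fin n → X) → (∀ x → Σ[ a ∈ (Fin n → Carrier) ] ∀ i → χ i x ≈ sum (λ j → a j * χ i (b j))) →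
    ∃[ i ] ∃[ j ] i ≢ j × ∀ x → χ i x ≈ χ j x
  characters-coincide {n} {N} n<N χ isChar b span = by-contradiction λ none →
    cᵢ≉0 (characters-independent χ isChar
      (λ i j i≢j → ¬∀⇒∃¬ λ eq → none (i , j , i≢j , eq)) c relation i)
    where
    system = homogeneousSystem n<N λ j i → χ i (b j)
    c = proj₁ system
    i = proj₁ (proj₁ (proj₂ system))
    cᵢ≉0 = proj₂ (proj₁ (proj₂ system))
    relation : ∀ x → sum (λ i → c i * χ i x) ≈ 0#
    relation x = begin
      sum (λ i → c i * χ i x)
        ≈⟨ sum-cong-≋ {N} (λ i → trans (*-congˡ (proj₂ (span x) i)) (*-distribˡ-sum {n} _ _)) ⟩
      sum (λ i → sum λ j → c i * (a j * χ i (b j))) ≈⟨ ∑-comm {N} {n} _ ⟩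
      sum (λ j → sum λ i → c i * (a j * χ i (b j)))
        ≈⟨ sum-cong-≋ {n} (λ j → trans (sum-cong-≋ {N} λ i → trans (*-comm _ _) (*-assoc _ _ _))
             (sym (*-distribˡ-sum {N} _ _))) ⟩
      sum (λ j → a j * sum λ i → χ i (b j) * c i)
        ≈⟨ sum-zero n (λ j → trans (*-congˡ (proj₂ (proj₂ system) j)) (zeroʳ _)) ⟩
      0# ∎
      where a = proj₁ (span x)

-- F′ is the fixed field of P; the base field F of φ only serves to state that P consists of automorphisms.
module Artin (em : ∀ {a} → ExcludedMiddle a) {F F′ K : CRing ℓ} (φ : F ⟶ K) (ψ : F′ ⟶ K)
    (K-isField : IsField K) (F′-isField : IsField F′)
    {P : Pred (Automorphism φ) ℓ} (S : IsSubgroup (Gal φ) P)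
    (fixed⇒base : ∀ x → (∀ γ → γ ∈ P → CommutativeRing._≈_ K (Automorphism.⟦_⟧ γ x) x) →
      ∃[ a ] CommutativeRing._≈_ K x (_⟶_.⟦_⟧ ψ a))
    (fixes-base : ∀ γ → γ ∈ P → ∀ a →
      CommutativeRing._≈_ K (Automorphism.⟦_⟧ γ (_⟶_.⟦_⟧ ψ a)) (_⟶_.⟦_⟧ ψ a))
    where
  open Classical em
  private
    module F′ = CommutativeRing F′
    module ψ = _⟶_ ψ
    module S = IsSubgroup S
  open CommutativeRing K hiding (zero)
  open IsField K-isField
  open Sum semiring
  open LinearAlgebra em K-isField
  open RingProperties ring
  open SetoidReasoning setoid
  open Automorphism
  open Group (Gal φ) using (ε; _∙_; _⁻¹; inverseʳ)

  record IsStableSubspace {m} (V : Pred (Fin m → Carrier) ℓ) : Set ℓ where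
    field
      resp       : ∀ {v w} → (∀ j → v j ≈ w j) → v ∈ V → w ∈ V
      +-closed   : ∀ {v w} → v ∈ V → w ∈ V → (λ j → v j + w j) ∈ V
      *-closed   : ∀ c {v} → v ∈ V → (λ j → c * v j) ∈ V
      act-closed : ∀ γ → γ ∈ P → ∀ {v} → v ∈ V → (λ j → ⟦ γ ⟧ (v j)) ∈ V

  -- Galois descent, by induction on `m`. A nonzero vector of `V` with first coordinate 0 leads to
  -- the subspace of all such vectors, which lives in one dimension less and is again stable.
  stableSubspace-rationalVector : ∀ {m} {V : Pred (Fin m → Carrier) ℓ} → IsStableSubspace V →
    ∀ {y} → y ∈ V → NonZero y → ∃[ a ] (ψ.⟦_⟧ ∘ a) ∈ V × NonZero (ψ.⟦_⟧ ∘ a)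
  stableSubspace-rationalVector {zero}  V-stable y∈V (() , _)
  stableSubspace-rationalVector {suc m} {V} V-stable {y} y∈V (i , yᵢ≉0)
    with em {P = ∃[ v ] v ∈ V × v zero ≈ 0# × NonZero v}
  ... | yes (v , v∈V , v₀≈0 , zero , vⱼ≉0) = contradiction v₀≈0 vⱼ≉0
  ... | yes (v , v∈V , v₀≈0 , suc j , vⱼ≉0) =
    let (a , a∈V′ , (j , aⱼ≉0)) = stableSubspace-rationalVector {V = λ w → (0# ∷ w) ∈ V} V′-stable
          (resp (λ { zero → v₀≈0 ; (suc j) → refl }) v∈V) (j , vⱼ≉0)
    in (F′.0# ∷ a) , resp (λ { zero → sym ψ.0#-homo ; (suc j) → refl }) a∈V′ , (suc j , aⱼ≉0)
    where
    open IsStableSubspace V-stable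
    V′-stable : IsStableSubspace (λ w → (0# ∷ w) ∈ V)
    V′-stable = record
      { resp       = λ eq → resp λ { zero → refl ; (suc j) → eq j }
      ; +-closed   = λ v∈ w∈ → resp (λ { zero → +-identityˡ 0# ; (suc j) → refl }) (+-closed v∈ w∈)
      ; *-closed   = λ c v∈ → resp (λ { zero → zeroʳ c ; (suc j) → refl }) (*-closed c v∈)
      ; act-closed = λ γ γ∈P v∈ → resp (λ { zero → 0#-homo γ ; (suc j) → refl }) (act-closed γ γ∈P v∈)
      }
  -- Now a vector of `V` that starts with 0 vanishes. After scaling the first coordinate to 1, the
  -- difference γz - z starts with 0, so z is fixed by P and its entries come from F′.
  ... | no none = a , resp z≈ψa z∈V , (zero , λ ψa₀≈0 → 1≉0 (trans (sym z₀≈1) (trans (z≈ψa zero) ψa₀≈0)))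
    where
    open IsStableSubspace V-stable
    normalised = inverse (y zero) λ y₀≈0 → none (y , y∈V , y₀≈0 , i , yᵢ≉0)
    d = proj₁ normalised
    z : Fin (suc m) → Carrier
    z j = d * y j
    z∈V : z ∈ V
    z∈V = *-closed d y∈V
    z₀≈1 : z zero ≈ 1#
    z₀≈1 = trans (*-comm _ _) (proj₂ normalised)
    z-fixed : ∀ γ → γ ∈ P → ∀ j → ⟦ γ ⟧ (z j) ≈ z j
    z-fixed γ γ∈P j = x∙y⁻¹≈ε⇒x≈y _ _ (trans (+-congˡ (sym (-1*x≈-x _))) (¬nonZero⇒≈0
      (λ nonZero → none (_ , +-closed (act-closed γ γ∈P z∈V) (*-closed (- 1#) z∈V) , (begin
        ⟦ γ ⟧ (z zero) + - 1# * z zero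
          ≈⟨ +-cong (trans (⟦⟧-cong γ z₀≈1) (1#-homo γ)) (trans (*-congˡ z₀≈1) (*-identityʳ _)) ⟩
        1# + - 1#                      ≈⟨ -‿inverseʳ 1# ⟩
        0#                             ∎) , nonZero)) j))
    a : Fin (suc m) → F′.Carrier
    a j = proj₁ (fixed⇒base (z j) λ γ γ∈P → z-fixed γ γ∈P j)
    z≈ψa : ∀ j → z j ≈ ψ.⟦ a j ⟧
    z≈ψa j = proj₂ (fixed⇒base (z j) λ γ γ∈P → z-fixed γ γ∈P j)

  module _ {m} (e : Fin m → Carrier) (independent : Independent ψ e) where

    Relation : Pred (Fin m → Carrier) ℓ
    Relation y = ∀ γ → γ ∈ P → sum (λ j → y j * ⟦ γ ⟧ (e j)) ≈ 0#

    relations-stable : IsStableSubspace Relation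
    relations-stable = record
      { resp       = λ eq v∈ γ γ∈P → trans (sum-cong-≋ {m} λ j → *-congʳ (sym (eq j))) (v∈ γ γ∈P)
      ; +-closed   = λ {v} {w} v∈ w∈ γ γ∈P → begin
          sum (λ j → (v j + w j) * ⟦ γ ⟧ (e j)) ≈⟨ sum-cong-≋ {m} (λ j → distribʳ _ _ _) ⟩
          sum (λ j → v j * ⟦ γ ⟧ (e j) + w j * ⟦ γ ⟧ (e j)) ≈⟨ ∑-distrib-+ {m} _ _ ⟩
          sum (λ j → v j * ⟦ γ ⟧ (e j)) + sum (λ j → w j * ⟦ γ ⟧ (e j)) ≈⟨ +-cong (v∈ γ γ∈P) (w∈ γ γ∈P) ⟩
          0# + 0# ≈⟨ +-identityˡ 0# ⟩
          0# ∎
      ; *-closed   = λ c {v} v∈ γ γ∈P → begin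
          sum (λ j → c * v j * ⟦ γ ⟧ (e j)) ≈⟨ sum-cong-≋ {m} (λ j → *-assoc _ _ _) ⟩
          sum (λ j → c * (v j * ⟦ γ ⟧ (e j))) ≈⟨ *-distribˡ-sum {m} _ _ ⟨
          c * sum (λ j → v j * ⟦ γ ⟧ (e j)) ≈⟨ *-congˡ (v∈ γ γ∈P) ⟩
          c * 0# ≈⟨ zeroʳ c ⟩
          0# ∎
      -- The relation at γ for the image of `v` under δ is δ applied to the relation at δ⁻¹γ for
      -- `v`.
      ; act-closed = λ δ δ∈P {v} v∈ γ γ∈P → begin
          sum (λ j → ⟦ δ ⟧ (v j) * ⟦ γ ⟧ (e j))
            ≈⟨ sum-cong-≋ {m} (λ j → trans (*-congˡ (sym (inverseʳ δ (⟦ γ ⟧ (e j))))) (sym (*-homo δ _ _))) ⟩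
          sum (λ j → ⟦ δ ⟧ (v j * ⟦ (δ ⁻¹) ∙ γ ⟧ (e j)))
            ≈⟨ sum-homo (automorphism⇒homomorphism δ) {m} _ ⟨
          ⟦ δ ⟧ (sum (λ j → v j * ⟦ (δ ⁻¹) ∙ γ ⟧ (e j)))
            ≈⟨ ⟦⟧-cong δ (v∈ ((δ ⁻¹) ∙ γ) (S.∙-closed (S.⁻¹-closed δ∈P) γ∈P)) ⟩
          ⟦ δ ⟧ 0# ≈⟨ 0#-homo δ ⟩
          0# ∎
      }

    -- Descent would turn a nonzero member into one with entries in F′, which at the identity of P
    -- is a linear dependence of `e` over F′.
    relation⇒≈0 : ∀ {y} → y ∈ Relation → ∀ j → y j ≈ 0#
    relation⇒≈0 y∈ = ¬nonZero⇒≈0 λ y-nonZero →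
      let (a , a∈ , (j , ψaⱼ≉0)) = stableSubspace-rationalVector relations-stable y∈ y-nonZero in
      ψaⱼ≉0 (trans (ψ.⟦⟧-cong (independent a (a∈ ε S.ε-closed) j)) ψ.0#-homo)

    -- Greedy choice. As long as r < m, the equations Σⱼ gᵢ(eⱼ) yⱼ = 0 have a nonzero solution `y`.
    -- By `relation⇒≈0` some γ in P violates the equation for `y`, so γ differs from every gᵢ
    -- somewhere on `e`.
    distinctAutomorphisms : ∀ {r} → r ℕ.≤ m → Σ[ g ∈ (Fin r → Automorphism φ) ]
      (∀ i → g i ∈ P) × (∀ i j → i ≢ j → ∃[ l ] ¬ ⟦ g i ⟧ (e l) ≈ ⟦ g j ⟧ (e l))
    distinctAutomorphisms {zero}  _   = (λ ()) , (λ ()) , λ ()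
    distinctAutomorphisms {suc r} r<m =
      (γ ∷ g) , (λ { zero → γ∈P ; (suc i) → g∈P i }) , λ
        { zero    zero    0≢0 → contradiction ≡.refl 0≢0
        ; zero    (suc j) _   → differs j
        ; (suc i) zero    _   → let (l , γ≉g) = differs i in l , γ≉g ∘ sym
        ; (suc i) (suc j) i≢j → distinct i j (i≢j ∘ ≡.cong suc)
        }
      where
      previous = distinctAutomorphisms (ℕ.<⇒≤ r<m)
      g = proj₁ previous
      g∈P = proj₁ (proj₂ previous)
      distinct = proj₂ (proj₂ previous)
      system = homogeneousSystem r<m λ i j → ⟦ g i ⟧ (e j)
      y = proj₁ system
      new : ∃[ γ ] γ ∈ P × ¬ sum (λ j → y j * ⟦ γ ⟧ (e j)) ≈ 0#
      new = by-contradiction λ none → let (j , yⱼ≉0) = proj₁ (proj₂ system) in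
        yⱼ≉0 (relation⇒≈0 (λ γ γ∈P → by-contradiction λ ≉0 → none (γ , γ∈P , ≉0)) j)
      γ = proj₁ new
      γ∈P = proj₁ (proj₂ new)
      differs : ∀ i → ∃[ l ] ¬ ⟦ γ ⟧ (e l) ≈ ⟦ g i ⟧ (e l)
      differs i = ¬∀⇒∃¬ λ agree → proj₂ (proj₂ new) (begin
        sum (λ j → y j * ⟦ γ ⟧ (e j))   ≈⟨ sum-cong-≋ {m} (λ j → trans (*-congˡ (agree j)) (*-comm _ _)) ⟩
        sum (λ j → ⟦ g i ⟧ (e j) * y j) ≈⟨ proj₂ (proj₂ system) i ⟩
        0#                              ∎)

  module _ {M : CRing ℓ} (ι : M ⟶ K) where
    private
      module M = CommutativeRing M
      module ι = _⟶_ ι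

    -- Otherwise e and y are independent over F′, so P has m + 1 members pairwise distinct on
    -- (e , y), hence on M; this contradicts Dedekind's lemma, M being spanned by m elements.
    fixedByStabiliser⇒inSpan : ∀ {m} (e : Fin m → M.Carrier) → Independent ψ (ι.⟦_⟧ ∘ e) →
      (∀ x → ∃[ a ] ι.⟦ x ⟧ ≈ combination ψ a (ι.⟦_⟧ ∘ e)) →
      ∀ y → (∀ γ → γ ∈ P → (∀ x → ⟦ γ ⟧ ι.⟦ x ⟧ ≈ ι.⟦ x ⟧) → ⟦ γ ⟧ y ≈ y) →
      ∃[ a ] y ≈ combination ψ a (ι.⟦_⟧ ∘ e)
    fixedByStabiliser⇒inSpan {m} e independent span y y-fixed = by-contradiction λ y∉span →
      let (g , g∈P , distinct) = distinctAutomorphisms (y ∷ (ι.⟦_⟧ ∘ e))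
            (independent-∷ independent y∉span) ℕ.≤-refl
          χ i x = ⟦ g i ⟧ ι.⟦ x ⟧
          (i , j , i≢j , agree) = characters-coincide ℕ.≤-refl χ
            (λ i → record
              { ∙-homo = λ x y → trans (⟦⟧-cong (g i) (ι.*-homo x y)) (*-homo (g i) _ _)
              ; u-homo = trans (⟦⟧-cong (g i) ι.1#-homo) (1#-homo (g i))
              })
            e
            (λ x → let (a , x≈) = span x in (ψ.⟦_⟧ ∘ a) , λ i → begin
              ⟦ g i ⟧ ι.⟦ x ⟧ ≈⟨ ⟦⟧-cong (g i) x≈ ⟩
              ⟦ g i ⟧ (combination ψ a (ι.⟦_⟧ ∘ e)) ≈⟨ sum-homo (automorphism⇒homomorphism (g i)) {m} _ ⟩
              sum (λ j → ⟦ g i ⟧ (ψ.⟦ a j ⟧ * ι.⟦ e j ⟧))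
                ≈⟨ sum-cong-≋ {m} (λ j → trans (*-homo (g i) _ _) (*-congʳ (fixes-base (g i) (g∈P i) (a j)))) ⟩
              sum (λ j → ψ.⟦ a j ⟧ * χ i (e j)) ∎)
          -- `g i` and `g j` agree on M, so gᵢ⁻¹gⱼ fixes M and by assumption `y`. They then agree on
          -- the whole family (y, e), on which they were chosen distinct.
          gⱼy≈gᵢy = begin
            ⟦ g j ⟧ y                      ≈⟨ inverseʳ (g i) _ ⟨
            ⟦ g i ⟧ (⟦ (g i ⁻¹) ∙ g j ⟧ y) ≈⟨ ⟦⟧-cong (g i) (y-fixed ((g i ⁻¹) ∙ g j)
                (S.∙-closed (S.⁻¹-closed (g∈P i)) (g∈P j))
                λ x → injective (g i) (trans (inverseʳ (g i) _) (sym (agree x)))) ⟩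
            ⟦ g i ⟧ y                      ∎
      in case-distinct (g i) (g j) (distinct i j i≢j) (sym gⱼy≈gᵢy) agree
      where
      open Dimension em ψ F′-isField using (independent-∷)
      open Dedekind em K-isField M._*_ M.1# using (characters-coincide)
      case-distinct : ∀ γ δ → (∃[ l ] ¬ ⟦ γ ⟧ ((y ∷ (ι.⟦_⟧ ∘ e)) l) ≈ ⟦ δ ⟧ ((y ∷ (ι.⟦_⟧ ∘ e)) l)) →
        ⟦ γ ⟧ y ≈ ⟦ δ ⟧ y → ¬ (∀ x → ⟦ γ ⟧ ι.⟦ x ⟧ ≈ ⟦ δ ⟧ ι.⟦ x ⟧)
      case-distinct γ δ (zero , ≉) eq agree = ≉ eq
      case-distinct γ δ (suc l , ≉) eq agree = ≉ (agree (e l))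

-- Tensor products

fieldHomomorphism-injective : (∀ {a} → ExcludedMiddle a) → {A B : CRing ℓ} (φ : A ⟶ B) → IsField A →
  ¬ CommutativeRing._≈_ B (CommutativeRing.1# B) (CommutativeRing.0# B) → IsInjective φ
fieldHomomorphism-injective em {A} {B} φ A-isField 1≉0 = trivialKernel⇒injective φ λ x φx≈0 →
  Classical.by-contradiction em λ x≉0 → let (y , xy≈1) = IsField.inverse A-isField x x≉0 in
  isInvertible⇒≉0 B 1≉0 (B.trans (B.sym (φ.*-homo x y)) (B.trans (φ.⟦⟧-cong xy≈1) φ.1#-homo)) φx≈0
  where
  module B = CommutativeRing B
  module φ = _⟶_ φ

module TensorProperties {R A B : CRing ℓ} (f : R ⟶ A) (g : R ⟶ B) where
  open Tensor f g
  private
    module R = CommutativeRing R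
    module A = CommutativeRing A
    module B = CommutativeRing B
    module f = _⟶_ f
    module g = _⟶_ g
    module ⊗R = CommutativeRing tensorRing
    module ι₂ = _⟶_ ι₂

  ι₁ : A ⟶ tensorRing
  ι₁ = record
    { ⟦_⟧ = _⊗ B.1#
    ; isRingHomomorphism = record
      { isSemiringHomomorphism = record
        { isNearSemiringHomomorphism = record
          { +-isMonoidHomomorphism = record
            { isMagmaHomomorphism = record
              { isRelHomomorphism = record { cong = λ eq → ⊗-cong eq B.refl }
              ; homo = λ a a′ → ⊗-addˡ a a′ B.1#
              }
            ; ε-homo = 0⊗1
            }
          ; *-homo = λ a a′ → ⊗-cong A.refl (B.sym (B.*-identityˡ B.1#))
          }
        ; 1#-homo = ∼-refl
        }
      ; -‿homo = λ a → inverseˡ-unique _ _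
          (∼-trans (∼-sym (⊗-addˡ (A.- a) a B.1#))
            (∼-trans (⊗-cong (A.-‿inverseˡ a) B.refl) 0⊗1))
      }
    }
    where
    open GroupProperties ⊗R.+-group using (inverseˡ-unique; identityʳ-unique)
    0⊗1 : A.0# ⊗ B.1# ∼ 𝟘
    0⊗1 = identityʳ-unique (A.0# ⊗ B.1#) (A.0# ⊗ B.1#)
      (∼-trans (∼-sym (⊗-addˡ _ _ _)) (⊗-cong (A.+-identityʳ A.0#) B.refl))

  private
    module ι₁ = _⟶_ ι₁

  ι₁∘f∼ι₂∘g : ∀ r → ι₁.⟦ f.⟦ r ⟧ ⟧ ∼ ι₂.⟦ g.⟦ r ⟧ ⟧
  ι₁∘f∼ι₂∘g r = ∼-trans (⊗-cong (A.sym (A.*-identityˡ _)) B.refl)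
    (∼-trans (balanced A.1# r B.1#) (⊗-cong A.refl (B.*-identityʳ _)))

  ⊗-factors : ∀ a b → a ⊗ b ∼ ι₂.⟦ b ⟧ ⊠ ι₁.⟦ a ⟧
  ⊗-factors a b = ⊗-cong (A.sym (A.*-identityˡ a)) (B.sym (B.*-identityʳ b))

  module Extend (M : AbelianGroup ℓ ℓ) where
    open AbelianGroup M renaming (_∙_ to _+_; ε to 0#; _⁻¹ to -_; ∙-cong to +-cong)
    open AbelianGroupProperties M
    open CommutativeSemigroupProperties commutativeSemigroup using (interchange)

    record IsBalanced (β : A.Carrier → B.Carrier → Carrier) : Set ℓ where
      field
        β-cong     : ∀ {a a′ b b′} → a A.≈ a′ → b B.≈ b′ → β a b ≈ β a′ b′
        β-addˡ     : ∀ a a′ b → β (a A.+ a′) b ≈ β a b + β a′ b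
        β-addʳ     : ∀ a b b′ → β a (b B.+ b′) ≈ β a b + β a b′
        β-balanced : ∀ a r b → β (a A.* f.⟦ r ⟧) b ≈ β a (g.⟦ r ⟧ B.* b)

    -- The universal property of the tensor product, for values in an abelian group rather than a
    -- ring: `independent-⊗` applies it to a coordinate functional, which is only additive.
    extend : (A.Carrier → B.Carrier → Carrier) → T → Carrier
    extend β (a ⊗ b) = β a b
    extend β 𝟘       = 0#
    extend β (s ⊕ t) = extend β s + extend β t
    extend β (⊖ t)   = - extend β t

    extend-cong : ∀ {β} → IsBalanced β → ∀ {s t} → s ∼ t → extend β s ≈ extend β t
    extend-cong β-isBalanced = go
      where
      open IsBalanced β-isBalanced
      go : ∀ {s t} → s ∼ t → extend _ s ≈ extend _ t
      go ∼-refl           = refl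
      go (∼-sym p)        = sym (go p)
      go (∼-trans p q)    = trans (go p) (go q)
      go (⊕-cong p q)     = +-cong (go p) (go q)
      go (⊖-cong p)       = ⁻¹-cong (go p)
      go (⊕-assoc _ _ _)  = assoc _ _ _
      go (⊕-comm _ _)     = comm _ _
      go (⊕-idˡ _)        = identityˡ _
      go (⊖-invˡ _)       = inverseˡ _
      go (⊗-cong p q)     = β-cong p q
      go (⊗-addˡ a a′ b)  = β-addˡ a a′ b
      go (⊗-addʳ a b b′)  = β-addʳ a b b′
      go (balanced a r b) = β-balanced a r b

  module Lift {C : CRing ℓ} (s : A ⟶ C) (t : B ⟶ C)
      (compatible : ∀ r → CommutativeRing._≈_ C (_⟶_.⟦_⟧ s f.⟦ r ⟧) (_⟶_.⟦_⟧ t g.⟦ r ⟧)) where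
    open CommutativeRing C hiding (zero)
    open RingProperties ring
    open Extend +-abelianGroup
    private
      module s = _⟶_ s
      module t = _⟶_ t

    lift : tensorRing ⟶ C
    lift = record
      { ⟦_⟧ = ⟦_⟧
      ; isRingHomomorphism = record
        { isSemiringHomomorphism = record
          { isNearSemiringHomomorphism = record
            { +-isMonoidHomomorphism = record
              { isMagmaHomomorphism = record
                { isRelHomomorphism = record { cong = extend-cong isBalanced }
                ; homo = λ _ _ → refl
                }
              ; ε-homo = refl
              }
            ; *-homo = *-homo
            }
          ; 1#-homo = trans (*-cong s.1#-homo t.1#-homo) (*-identityˡ 1#)
          }
        ; -‿homo = λ _ → refl
        }
      }
      where
      ⟦_⟧ : T → Carrier
      ⟦_⟧ = extend λ a b → s.⟦ a ⟧ * t.⟦ b ⟧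
      isBalanced : IsBalanced λ a b → s.⟦ a ⟧ * t.⟦ b ⟧
      isBalanced = record
        { β-cong     = λ p q → *-cong (s.⟦⟧-cong p) (t.⟦⟧-cong q)
        ; β-addˡ     = λ a a′ b → trans (*-congʳ (s.+-homo a a′)) (distribʳ _ _ _)
        ; β-addʳ     = λ a b b′ → trans (*-congˡ (t.+-homo b b′)) (distribˡ _ _ _)
        ; β-balanced = λ a r b → trans (*-congʳ (s.*-homo _ _)) (trans (*-assoc _ _ _)
            (*-congˡ (trans (*-congʳ (compatible r)) (sym (t.*-homo _ _)))))
        }
      open CommutativeSemigroupProperties *-commutativeSemigroup using (interchange)
      *-homo : ∀ u v → ⟦ u ⊠ v ⟧ ≈ ⟦ u ⟧ * ⟦ v ⟧
      *-homo (a ⊗ b) (c ⊗ d) = trans (*-cong (s.*-homo a c) (t.*-homo b d)) (interchange _ _ _ _)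
      *-homo (a ⊗ b) 𝟘       = sym (zeroʳ _)
      *-homo (a ⊗ b) (v ⊕ w) = trans (+-cong (*-homo (a ⊗ b) v) (*-homo (a ⊗ b) w)) (sym (distribˡ _ _ _))
      *-homo (a ⊗ b) (⊖ v)   = trans (-‿cong (*-homo (a ⊗ b) v)) (-‿distribʳ-* _ _)
      *-homo 𝟘       v       = sym (zeroˡ _)
      *-homo (u ⊕ w) v       = trans (+-cong (*-homo u v) (*-homo w v)) (sym (distribʳ _ _ _))
      *-homo (⊖ u)   v       = trans (-‿cong (*-homo u v)) (-‿distribˡ-* _ _)

  -- Induction on the term. For `x ⊗ y` the coefficients of `x` cross the tensor sign by balancing
  -- and are multiplied by `y`.
  spanning-⊗ : ∀ {n} (b : Fin n → A.Carrier) → Spanning f b → Spanning ι₂ (ι₁.⟦_⟧ ∘ b)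
  spanning-⊗ b span 𝟘       = (λ _ → B.0#) , ⊗R.sym (combination-0 (ι₁.⟦_⟧ ∘ b))
    where open Combination ι₂
  spanning-⊗ b span (s ⊕ t) =
    let (l , s∼) = spanning-⊗ b span s; (l′ , t∼) = spanning-⊗ b span t in
    (λ i → l i B.+ l′ i) , ⊗R.trans (⊕-cong s∼ t∼) (⊗R.sym (combination-+ l l′ _))
    where open Combination ι₂
  spanning-⊗ b span (⊖ t)   = let (l , t∼) = spanning-⊗ b span t in
    (λ i → B.- B.1# B.* l i) , ⊗R.trans (⊖-cong t∼) (⊗R.sym (⊗R.trans (combination-scale (B.- B.1#) l _)
      (⊗R.trans (⊗R.*-congʳ (ι₂.-‿homo B.1#)) (RingProperties.-1*x≈-x ⊗R.ring _))))
    where open Combination ι₂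
  spanning-⊗ b span (x ⊗ y) = let (a , x≈) = span x in
    (λ i → y B.* g.⟦ a i ⟧) , (begin
      x ⊗ y                                             ≈⟨ ⊗-factors x y ⟩
      ι₂.⟦ y ⟧ ⊠ ι₁.⟦ x ⟧                               ≈⟨ ⊗R.*-congˡ {ι₂.⟦ y ⟧} (ι₁.⟦⟧-cong x≈) ⟩
      ι₂.⟦ y ⟧ ⊠ ι₁.⟦ combination f a b ⟧               ≈⟨ ⊗R.*-congˡ {ι₂.⟦ y ⟧} (combination-homo f ι₁ a b) ⟩
      ι₂.⟦ y ⟧ ⊠ combination (ι₁ ∘ʰ f) a (ι₁.⟦_⟧ ∘ b)   ≈⟨ ⊗R.*-congˡ {ι₂.⟦ y ⟧} (change-scalars a (ι₁.⟦_⟧ ∘ b)) ⟩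
      ι₂.⟦ y ⟧ ⊠ combination ι₂ (g.⟦_⟧ ∘ a) (ι₁.⟦_⟧ ∘ b) ≈⟨ combination-scale y (g.⟦_⟧ ∘ a) (ι₁.⟦_⟧ ∘ b) ⟨
      combination ι₂ (λ i → y B.* g.⟦ a i ⟧) (ι₁.⟦_⟧ ∘ b) ∎)
    where
    open SetoidReasoning ⊗R.setoid
    open Combination ι₂
    change-scalars : ∀ {n} a (v : Fin n → T) → combination (ι₁ ∘ʰ f) a v ∼ combination ι₂ (g.⟦_⟧ ∘ a) v
    change-scalars {n} a v = Sum.sum-cong-≋ ⊗R.semiring {n} λ i → ⊗R.*-congʳ {v i} (ι₁∘f∼ι₂∘g (a i))

  -- The i-th coordinate on A induces an additive map from the tensor product to B that reads off
  -- `l i`. `Spanning` provides the coordinate, `Independent` makes it additive and R-linear.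
  independent-⊗ : ∀ {n} (b : Fin n → A.Carrier) → Spanning f b → Independent f b →
    Independent ι₂ (ι₁.⟦_⟧ ∘ b)
  independent-⊗ {n} b span independent l eq i = begin
    l i                                          ≈⟨ Combination.combination-unit g i l ⟨
    combination g (unit R i) l       ≈⟨ ΣB.sum-cong-≋ {n} (λ j → B.*-congʳ (g.⟦⟧-cong (unit-coordinate j))) ⟨
    combination g (λ j → coordinate (A.1# A.* b j)) l ≈⟨ ΣB.sum-cong-≋ {n} (λ j → B.*-congˡ (B.*-identityʳ (l j))) ⟨
    ΣB.sum (λ j → g.⟦ coordinate (A.1# A.* b j) ⟧ B.* (l j B.* B.1#)) ≈⟨ extend-sum (λ j → ι₂.⟦ l j ⟧ ⊠ ι₁.⟦ b j ⟧) ⟨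
    extend β (combination ι₂ l (ι₁.⟦_⟧ ∘ b))     ≈⟨ extend-cong isBalanced eq ⟩
    B.0#                                         ∎
    where
    open SetoidReasoning B.setoid
    open Extend B.+-abelianGroup
    open Combination f
    module ΣB = Sum B.semiring
    module ΣT = Sum ⊗R.semiring
    coordinate : A.Carrier → R.Carrier
    coordinate x = proj₁ (span x) i
    coordinate-unique : ∀ {x} a → x A.≈ combination f a b → coordinate x R.≈ a i
    coordinate-unique {x} a eq = independent⇒unique independent (proj₁ (span x)) a
      (A.trans (A.sym (proj₂ (span x))) eq) i
    unit-coordinate : ∀ j → coordinate (A.1# A.* b j) R.≈ unit R i j
    unit-coordinate j = R.trans
      (coordinate-unique (unit R j) (A.trans (A.*-identityˡ _) (A.sym (combination-unit j b))))
      (R.reflexive (unit-sym R j i))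
    β : A.Carrier → B.Carrier → B.Carrier
    β a b = g.⟦ coordinate a ⟧ B.* b
    isBalanced : IsBalanced β
    isBalanced = record
      { β-cong = λ {a} {a′} p q → B.*-cong
          (g.⟦⟧-cong (coordinate-unique (proj₁ (span a′)) (A.trans p (proj₂ (span a′))))) q
      ; β-addˡ = λ a a′ c → B.trans
          (B.*-congʳ (B.trans
            (g.⟦⟧-cong (coordinate-unique _ (A.trans (A.+-cong (proj₂ (span a)) (proj₂ (span a′)))
              (A.sym (combination-+ (proj₁ (span a)) (proj₁ (span a′)) b)))))
            (g.+-homo _ _)))
          (B.distribʳ _ _ _)
      ; β-addʳ = λ a c c′ → B.distribˡ _ _ _
      ; β-balanced = λ a r c → B.trans
          (B.*-congʳ (B.trans
            (g.⟦⟧-cong (coordinate-unique _ (A.trans (A.*-comm _ _) (A.trans (A.*-congˡ (proj₂ (span a)))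
              (A.sym (combination-scale r (proj₁ (span a)) b))))))
            (B.trans (g.*-homo _ _) (B.*-comm _ _))))
          (B.*-assoc _ _ _)
      }
    extend-sum : ∀ {m} (t : Fin m → T) → extend β (ΣT.sum t) B.≈ ΣB.sum (extend β ∘ t)
    extend-sum {zero}  t = B.refl
    extend-sum {suc m} t = B.+-congˡ (extend-sum (t ∘ suc))

module _ {R A B C : CRing ℓ} (f : R ⟶ A) (g : R ⟶ B) where
  open Tensor f g
  open TensorProperties f g
  private
    module C = CommutativeRing C

  tensor-ext : (φ ψ : tensorRing ⟶ C) →
    (∀ a → _⟶_.⟦_⟧ φ (_⟶_.⟦_⟧ ι₁ a) C.≈ _⟶_.⟦_⟧ ψ (_⟶_.⟦_⟧ ι₁ a)) →
    (∀ b → _⟶_.⟦_⟧ φ (_⟶_.⟦_⟧ ι₂ b) C.≈ _⟶_.⟦_⟧ ψ (_⟶_.⟦_⟧ ι₂ b)) →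
    ∀ t → _⟶_.⟦_⟧ φ t C.≈ _⟶_.⟦_⟧ ψ t
  tensor-ext φ ψ agree₁ agree₂ = go
    where
    module φ = _⟶_ φ
    module ψ = _⟶_ ψ
    go : ∀ t → φ.⟦ t ⟧ C.≈ ψ.⟦ t ⟧
    go (a ⊗ b) = C.trans (φ.⟦⟧-cong (⊗-factors a b)) (C.trans (φ.*-homo _ _)
      (C.trans (C.*-cong (agree₂ b) (agree₁ a)) (C.trans (C.sym (ψ.*-homo _ _)) (ψ.⟦⟧-cong (∼-sym (⊗-factors a b))))))
    go 𝟘       = C.trans φ.0#-homo (C.sym ψ.0#-homo)
    go (s ⊕ t) = C.trans (φ.+-homo s t) (C.trans (C.+-cong (go s) (go t)) (C.sym (ψ.+-homo s t)))
    go (⊖ t)   = C.trans (φ.-‿homo t) (C.trans (C.-‿cong (go t)) (C.sym (ψ.-‿homo t)))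

-- Groups

isGroupHomomorphism-from-∙ : (G H : Group ℓ ℓ) →
  let module G = Group G
      module H = Group H
  in (f : G.Carrier → H.Carrier) → (∀ {x y} → x G.≈ y → f x H.≈ f y) →
  (∀ x y → f (x G.∙ y) H.≈ f x H.∙ f y) → IsGroupHomomorphism G.rawGroup H.rawGroup f
isGroupHomomorphism-from-∙ G H f f-cong homo = record
  { isMonoidHomomorphism = record
    { isMagmaHomomorphism = record { isRelHomomorphism = record { cong = f-cong } ; homo = homo }
    ; ε-homo = ε-homo
    }
  ; ⁻¹-homo = λ x → inverseˡ-unique _ _
      (H.trans (H.sym (homo (x G.⁻¹) x)) (H.trans (f-cong (G.inverseˡ x)) ε-homo))
  }
  where
  module G = Group G
  module H = Group H
  open GroupProperties H
  ε-homo : f G.ε H.≈ H.ε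
  ε-homo = identityʳ-unique _ _ (H.trans (H.sym (homo G.ε G.ε)) (f-cong (G.identityˡ G.ε)))

≅-quotient : (G Q : Group ℓ ℓ) → let module G = Group G; module Q = Group Q in
  {N : Pred Q.Carrier ℓ} (S : IsSubgroup Q N) (normal : IsNormal Q N) (f : G.Carrier → Q.Carrier) →
  (∀ x y → x G.≈ y → f x Q.⁻¹ Q.∙ f y ∈ N) →
  (∀ x y → f (x G.∙ y) Q.⁻¹ Q.∙ (f x Q.∙ f y) ∈ N) →
  (∀ x y → f x Q.⁻¹ Q.∙ f y ∈ N → x G.≈ y) →
  (∀ y → ∃[ x ] ∀ z → z G.≈ x → f z Q.⁻¹ Q.∙ y ∈ N) →
  G ≅ quotient Q S normal
≅-quotient G Q S normal f f-cong f-∙ f-injective f-surjective = f , record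
  { isGroupMonomorphism = record
    { isGroupHomomorphism = isGroupHomomorphism-from-∙ G (quotient Q S normal) f (λ {x} {y} → f-cong x y) f-∙
    ; injective           = λ {x} {y} → f-injective x y
    }
  ; surjective = λ y → let (x , fz≈y) = f-surjective y in x , λ {z} → fz≈y z
  }

module _ (G : Group ℓ ℓ) where
  open Group G
  open GroupProperties G
  open SetoidReasoning setoid

  conjugate-∙ : ∀ g x y → g ∙ (x ∙ y) ∙ g ⁻¹ ≈ (g ∙ x ∙ g ⁻¹) ∙ (g ∙ y ∙ g ⁻¹)
  conjugate-∙ g x y = begin
    g ∙ (x ∙ y) ∙ g ⁻¹                  ≈⟨ ∙-congʳ (assoc g x y) ⟨
    g ∙ x ∙ y ∙ g ⁻¹                    ≈⟨ assoc _ _ _ ⟩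
    g ∙ x ∙ (y ∙ g ⁻¹)                  ≈⟨ ∙-congˡ (\\-leftDividesʳ g _) ⟨
    g ∙ x ∙ (g ⁻¹ ∙ (g ∙ (y ∙ g ⁻¹)))   ≈⟨ assoc _ _ _ ⟨
    g ∙ x ∙ g ⁻¹ ∙ (g ∙ (y ∙ g ⁻¹))     ≈⟨ ∙-congˡ (assoc _ _ _) ⟨
    (g ∙ x ∙ g ⁻¹) ∙ (g ∙ y ∙ g ⁻¹)     ∎

  conjugate-inverse : ∀ g x → g ∙ (g ⁻¹ ∙ x ∙ g ⁻¹ ⁻¹) ∙ g ⁻¹ ≈ x
  conjugate-inverse g x = begin
    g ∙ (g ⁻¹ ∙ x ∙ g ⁻¹ ⁻¹) ∙ g ⁻¹   ≈⟨ ∙-congʳ (∙-congˡ (assoc _ _ _)) ⟩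
    g ∙ (g ⁻¹ ∙ (x ∙ g ⁻¹ ⁻¹)) ∙ g ⁻¹ ≈⟨ ∙-congʳ (\\-leftDividesˡ g _) ⟩
    x ∙ g ⁻¹ ⁻¹ ∙ g ⁻¹                ≈⟨ assoc _ _ _ ⟩
    x ∙ (g ⁻¹ ⁻¹ ∙ g ⁻¹)              ≈⟨ ∙-congˡ (inverseˡ (g ⁻¹)) ⟩
    x ∙ ε                             ≈⟨ identityʳ x ⟩
    x                                 ∎

  -- Conjugation by any `g` of G preserves N, so it is an automorphism of N, not necessarily an
  -- inner one.
  characteristic-in-normal⇒normal : {N Q : Pred Carrier ℓ} (S : IsSubgroup G N) → IsNormal G N →
    (∀ {x} → x ∈ Q → x ∈ N) → IsCharacteristic (subgroup G S) (λ (x , _) → x ∈ Q) → IsNormal G Q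
  characteristic-in-normal⇒normal {N} {Q} S N-normal Q⊆N char g {x} x∈Q =
    char conjugate conjugate-isIso {x , Q⊆N x∈Q} x∈Q
    where
    conjugate : Group.Carrier (subgroup G S) → Group.Carrier (subgroup G S)
    conjugate (x , x∈N) = g ∙ x ∙ g ⁻¹ , N-normal g x∈N
    conjugate-isIso : IsGroupIsomorphism (Group.rawGroup (subgroup G S)) (Group.rawGroup (subgroup G S)) conjugate
    conjugate-isIso = record
      { isGroupMonomorphism = record
        { isGroupHomomorphism = isGroupHomomorphism-from-∙ (subgroup G S) (subgroup G S) conjugate
            (λ eq → ∙-congʳ (∙-congˡ eq)) (λ (x , _) (y , _) → conjugate-∙ g x y)
        ; injective = λ {x} {y} eq → ∙-cancelˡ g _ _ (∙-cancelʳ (g ⁻¹) _ _ eq)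
        }
      ; surjective = λ (y , y∈N) → (g ⁻¹ ∙ y ∙ g ⁻¹ ⁻¹ , N-normal (g ⁻¹) y∈N) , λ eq →
          trans (∙-congʳ (∙-congˡ eq)) (conjugate-inverse g y)
      }

  normal-⊙-isSubgroup : {N Q : Pred Carrier ℓ} → IsSubgroup G N → IsNormal G N → IsSubgroup G Q →
    IsSubgroup G (_⊙_ G N Q)
  normal-⊙-isSubgroup N-sub N-normal Q-sub = record
    { resp      = λ x≈y (h , q , h∈ , q∈ , x≈hq) → h , q , h∈ , q∈ , trans (sym x≈y) x≈hq
    ; ε-closed  = ε , ε , N.ε-closed , Q.ε-closed , sym (identityˡ ε)
    ; ∙-closed  = λ {x} {y} (h , q , h∈ , q∈ , x≈hq) (h′ , q′ , h′∈ , q′∈ , y≈h′q′) →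
        h ∙ (q ∙ h′ ∙ q ⁻¹) , q ∙ q′ , N.∙-closed h∈ (N-normal q h′∈) , Q.∙-closed q∈ q′∈ , (begin
          x ∙ y                                 ≈⟨ ∙-cong x≈hq y≈h′q′ ⟩
          h ∙ q ∙ (h′ ∙ q′)                     ≈⟨ assoc _ _ _ ⟩
          h ∙ (q ∙ (h′ ∙ q′))                   ≈⟨ ∙-congˡ (assoc _ _ _) ⟨
          h ∙ (q ∙ h′ ∙ q′)                     ≈⟨ ∙-congˡ (∙-congˡ (\\-leftDividesʳ q q′)) ⟨
          h ∙ (q ∙ h′ ∙ (q ⁻¹ ∙ (q ∙ q′)))      ≈⟨ ∙-congˡ (assoc _ _ _) ⟨
          h ∙ (q ∙ h′ ∙ q ⁻¹ ∙ (q ∙ q′))        ≈⟨ assoc _ _ _ ⟨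
          h ∙ (q ∙ h′ ∙ q ⁻¹) ∙ (q ∙ q′)        ∎)
    ; ⁻¹-closed = λ {x} (h , q , h∈ , q∈ , x≈hq) →
        q ⁻¹ ∙ h ⁻¹ ∙ q ⁻¹ ⁻¹ , q ⁻¹ , N-normal (q ⁻¹) (N.⁻¹-closed h∈) , Q.⁻¹-closed q∈ , (begin
          x ⁻¹                                  ≈⟨ ⁻¹-cong x≈hq ⟩
          (h ∙ q) ⁻¹                            ≈⟨ ⁻¹-anti-homo-∙ h q ⟩
          q ⁻¹ ∙ h ⁻¹                           ≈⟨ identityʳ _ ⟨
          q ⁻¹ ∙ h ⁻¹ ∙ ε                       ≈⟨ ∙-congˡ (inverseˡ (q ⁻¹)) ⟨
          q ⁻¹ ∙ h ⁻¹ ∙ (q ⁻¹ ⁻¹ ∙ q ⁻¹)        ≈⟨ assoc _ _ _ ⟨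
          q ⁻¹ ∙ h ⁻¹ ∙ q ⁻¹ ⁻¹ ∙ q ⁻¹          ∎)
    }
    where
    module N = IsSubgroup N-sub
    module Q = IsSubgroup Q-sub

module _ (G : Group ℓ ℓ) where
  open Group G

  isSubgroup-≐ : {P Q : Pred Carrier ℓ} → P U.≐ Q → IsSubgroup G P → IsSubgroup G Q
  isSubgroup-≐ (P⊆Q , Q⊆P) S = record
    { resp      = λ eq q → P⊆Q (S.resp eq (Q⊆P q))
    ; ε-closed  = P⊆Q S.ε-closed
    ; ∙-closed  = λ p q → P⊆Q (S.∙-closed (Q⊆P p) (Q⊆P q))
    ; ⁻¹-closed = λ q → P⊆Q (S.⁻¹-closed (Q⊆P q))
    }
    where module S = IsSubgroup S

  ∩-isSubgroup : {P Q : Pred Carrier ℓ} → IsSubgroup G P → IsSubgroup G Q → IsSubgroup G (P U.∩ Q)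
  ∩-isSubgroup S T = record
    { resp      = λ eq (p , q) → S.resp eq p , T.resp eq q
    ; ε-closed  = S.ε-closed , T.ε-closed
    ; ∙-closed  = λ (p , q) (p′ , q′) → S.∙-closed p p′ , T.∙-closed q q′
    ; ⁻¹-closed = λ (p , q) → S.⁻¹-closed p , T.⁻¹-closed q
    }
    where
    module S = IsSubgroup S
    module T = IsSubgroup T

  hasOrder : ∀ {P : Pred Carrier ℓ} {m} (g : Fin m → Carrier) → (∀ i → g i ∈ P) →
    (∀ i j → g i ≈ g j → i ≡ j) → (∀ x → x ∈ P → ∃[ i ] g i ≈ x) → HasOrder G P m
  hasOrder g g∈P injective surjective = record
    { to        = λ i → g i , g∈P i
    ; cong      = λ { ≡.refl → refl }
    ; bijective = (λ {i} {j} → injective i j) , λ (x , x∈P) →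
        let (i , gᵢ≈x) = surjective x x∈P in i , λ { ≡.refl → gᵢ≈x }
    }

  hasOrder-≐ : ∀ {P Q : Pred Carrier ℓ} {m} → P U.≐ Q → HasOrder G P m → HasOrder G Q m
  hasOrder-≐ (P⊆Q , Q⊆P) order = hasOrder (λ i → proj₁ (to i)) (λ i → P⊆Q (proj₂ (to i)))
    (λ i j → injective) λ x x∈Q → let (i , eq) = surjective (x , Q⊆P x∈Q) in i , eq ≡.refl
    where open Function.Bundles.Bijection order

-- Subfields

module SubfieldProperties (Ω : Field ℓ) where
  open Field Ω hiding (zero)
  open Subfields Ω
  open FieldProperties isField
  private
    module _ (K : Subfield) where
      open Subfield K public

  embedding : ∀ K → ⌞ K ⌟ ⟶ commutativeRing
  embedding K = record
    { ⟦_⟧ = proj₁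
    ; isRingHomomorphism = record
      { isSemiringHomomorphism = record
        { isNearSemiringHomomorphism = record
          { +-isMonoidHomomorphism = record
            { isMagmaHomomorphism = record
              { isRelHomomorphism = record { cong = λ eq → eq }
              ; homo = λ _ _ → refl
              }
            ; ε-homo = refl
            }
          ; *-homo = λ _ _ → refl
          }
        ; 1#-homo = refl
        }
      ; -‿homo = λ _ → refl
      }
    }

  subfield-isField : ∀ K → IsField ⌞ K ⌟
  subfield-isField K = record
    { 1≉0 = 1≉0
    ; inverse = λ (x , p) x≉0 → let (y , xy≈1) = inverse x x≉0 in (y , inv-closed K p xy≈1) , xy≈1
    }

  infix 4 _⟶Ω
  -- Embeddings take values in Ω so that restrictions of elements of Γ and of Gal(EL/L), whose own
  -- codomains differ, become comparable.
  _⟶Ω : Subfield → Set ℓ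
  K ⟶Ω = ⌞ K ⌟ ⟶ commutativeRing

  -- An element of ⌞ K ⌟ carries a proof of membership, on which its value under s does not depend.
  value-cong : ∀ K (s : K ⟶Ω) {x y} → x ≈ y → (p : x ∈ᶠ K) (q : y ∈ᶠ K) →
    _⟶_.⟦_⟧ s (x , p) ≈ _⟶_.⟦_⟧ s (y , q)
  value-cong K s eq p q = _⟶_.⟦⟧-cong s {_ , p} {_ , q} eq

  value-inverse : ∀ K (s : K ⟶Ω) {x y} (p : x ∈ᶠ K) (q : y ∈ᶠ K) → x * y ≈ 1# →
    _⟶_.⟦_⟧ s (x , p) * _⟶_.⟦_⟧ s (y , q) ≈ 1#
  value-inverse K s p q xy≈1 = trans (sym (s.*-homo (_ , p) (_ , q)))
    (trans (value-cong K s xy≈1 (*-closed K p q) (1-closed K)) s.1#-homo)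
    where module s = _⟶_ s

  _∩_ : Subfield → Subfield → Subfield
  K ∩ Q = record
    { member     = λ x → x ∈ᶠ K × x ∈ᶠ Q
    ; resp       = λ eq (p , q) → resp K eq p , resp Q eq q
    ; 0-closed   = 0-closed K , 0-closed Q
    ; 1-closed   = 1-closed K , 1-closed Q
    ; +-closed   = λ (p , q) (p′ , q′) → +-closed K p p′ , +-closed Q q q′
    ; *-closed   = λ (p , q) (p′ , q′) → *-closed K p p′ , *-closed Q q q′
    ; neg-closed = λ (p , q) → neg-closed K p , neg-closed Q q
    ; inv-closed = λ (p , q) eq → inv-closed K p eq , inv-closed Q q eq
    }

  -- Inductions over generated subfields are phrased as containment in a `preimage` (for stability)
  -- or an `equalizer` (for agreement), so that only generators need to be examined.
  preimage : ∀ K → K ⟶Ω → Subfield → Subfield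
  preimage K s Q = record
    { member     = λ x → Σ[ p ∈ x ∈ᶠ K ] s.⟦ x , p ⟧ ∈ᶠ Q
    ; resp       = λ eq (p , q) → resp K eq p , resp Q (value-cong K s eq p (resp K eq p)) q
    ; 0-closed   = 0-closed K , resp Q (sym s.0#-homo) (0-closed Q)
    ; 1-closed   = 1-closed K , resp Q (sym s.1#-homo) (1-closed Q)
    ; +-closed   = λ (p , q) (p′ , q′) → +-closed K p p′ ,
        resp Q (sym (s.+-homo (_ , p) (_ , p′))) (+-closed Q q q′)
    ; *-closed   = λ (p , q) (p′ , q′) → *-closed K p p′ ,
        resp Q (sym (s.*-homo (_ , p) (_ , p′))) (*-closed Q q q′)
    ; neg-closed = λ (p , q) → neg-closed K p , resp Q (sym (s.-‿homo (_ , p))) (neg-closed Q q)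
    ; inv-closed = λ (p , q) xy≈1 → inv-closed K p xy≈1 ,
        inv-closed Q q (value-inverse K s p (inv-closed K p xy≈1) xy≈1)
    }
    where module s = _⟶_ s

  equalizer : ∀ K → K ⟶Ω → K ⟶Ω → Subfield
  equalizer K s t = record
    { member     = λ x → Σ[ p ∈ x ∈ᶠ K ] s.⟦ x , p ⟧ ≈ t.⟦ x , p ⟧
    ; resp       = λ eq (p , q) → resp K eq p ,
        trans (value-cong K s (sym eq) (resp K eq p) p) (trans q (value-cong K t eq p (resp K eq p)))
    ; 0-closed   = 0-closed K , trans s.0#-homo (sym t.0#-homo)
    ; 1-closed   = 1-closed K , trans s.1#-homo (sym t.1#-homo)
    ; +-closed   = λ (p , q) (p′ , q′) → +-closed K p p′ ,
        trans (s.+-homo (_ , p) (_ , p′)) (trans (+-cong q q′) (sym (t.+-homo (_ , p) (_ , p′))))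
    ; *-closed   = λ (p , q) (p′ , q′) → *-closed K p p′ ,
        trans (s.*-homo (_ , p) (_ , p′)) (trans (*-cong q q′) (sym (t.*-homo (_ , p) (_ , p′))))
    ; neg-closed = λ (p , q) → neg-closed K p ,
        trans (s.-‿homo (_ , p)) (trans (-‿cong q) (sym (t.-‿homo (_ , p))))
    ; inv-closed = λ (p , q) xy≈1 → inv-closed K p xy≈1 ,
        inverse-unique (value-inverse K s p (inv-closed K p xy≈1) xy≈1)
          (trans (*-congʳ q) (value-inverse K t p (inv-closed K p xy≈1) xy≈1))
    }
    where
    module s = _⟶_ s
    module t = _⟶_ t

  compositum-least : ∀ {K L} Q → K ⊆ Q → L ⊆ Q → K ⋎ L ⊆ Q
  compositum-least Q K⊆Q L⊆Q (left p)         = K⊆Q p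
  compositum-least Q K⊆Q L⊆Q (right p)        = L⊆Q p
  compositum-least Q K⊆Q L⊆Q (respects eq p)  = resp Q eq (compositum-least Q K⊆Q L⊆Q p)
  compositum-least Q K⊆Q L⊆Q (plus p q)       =
    +-closed Q (compositum-least Q K⊆Q L⊆Q p) (compositum-least Q K⊆Q L⊆Q q)
  compositum-least Q K⊆Q L⊆Q (times p q)      =
    *-closed Q (compositum-least Q K⊆Q L⊆Q p) (compositum-least Q K⊆Q L⊆Q q)
  compositum-least Q K⊆Q L⊆Q (neg p)          = neg-closed Q (compositum-least Q K⊆Q L⊆Q p)
  compositum-least Q K⊆Q L⊆Q (inv p eq)       = inv-closed Q (compositum-least Q K⊆Q L⊆Q p) eq

  restriction : ∀ {F} M K {φ : F ⟶ ⌞ K ⌟} → M ⊆ K → Automorphism φ → M ⟶Ω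
  restriction M K M⊆K σ = embedding K ∘ʰ automorphism⇒homomorphism σ ∘ʰ incl M K M⊆K

  Fixes : ∀ B M → B ⊆ M → M ⟶Ω → Set ℓ
  Fixes B M B⊆M s = ∀ x (p : x ∈ᶠ B) → _⟶_.⟦_⟧ s (x , B⊆M p) ≈ x

  combination-value : ∀ B M (B⊆M : B ⊆ M) (s : M ⟶Ω) → Fixes B M B⊆M s → ∀ {n} a (b : Fin n → _) →
    _⟶_.⟦_⟧ s (combination (incl B M B⊆M) a b) ≈ combination (embedding B) a (_⟶_.⟦_⟧ s ∘ b)
  combination-value B M B⊆M s fixes {n} a b = trans (combination-homo (incl B M B⊆M) s a b)
    (Sum.sum-cong-≋ semiring {n} λ i → *-congʳ (fixes (proj₁ (a i)) (proj₂ (a i))))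

  independent-incl : ∀ B M K (B⊆M : B ⊆ M) (M⊆K : M ⊆ K) (B⊆K : B ⊆ K) {n} (b : Fin n → _) →
    Independent (incl B M B⊆M) b → Independent (incl B K B⊆K) (_⟶_.⟦_⟧ (incl M K M⊆K) ∘ b)
  independent-incl B M K B⊆M M⊆K B⊆K b independent a eq = independent a (trans
    (combination-homo (incl B M B⊆M) (embedding M) a b)
    (trans (sym (combination-homo (incl B K B⊆K) (embedding K) a (_⟶_.⟦_⟧ (incl M K M⊆K) ∘ b))) eq))

  module _ (em : ∀ {a} → ExcludedMiddle a) where
    open Classical em

    -- With `t` added there are n + 1 embeddings over B of a field spanned by n elements, so two
    -- coincide. No two members of `s` do, hence `t` is one of them.
    exhaust : ∀ B M (B⊆M : B ⊆ M) {n} (b : Fin n → ∃ (member M)) → Spanning (incl B M B⊆M) b →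
      (s : Fin n → M ⟶Ω) → (∀ i → Fixes B M B⊆M (s i)) →
      (∀ i j → i ≢ j → ∃[ l ] ¬ _⟶_.⟦_⟧ (s i) (b l) ≈ _⟶_.⟦_⟧ (s j) (b l)) →
      (t : M ⟶Ω) → Fixes B M B⊆M t → ∃[ i ] ∀ x → _⟶_.⟦_⟧ t x ≈ _⟶_.⟦_⟧ (s i) x
    exhaust B M B⊆M {n} b span s s-fixes distinct t t-fixes = select (characters-coincide ℕ.≤-refl
      (λ i → _⟶_.⟦_⟧ (u i))
      (λ i → record { ∙-homo = _⟶_.*-homo (u i) ; u-homo = _⟶_.1#-homo (u i) })
      b
      (λ x → let (a , x≈) = span x in (proj₁ ∘ a) , λ i → trans (_⟶_.⟦⟧-cong (u i) x≈)
        (combination-value B M B⊆M (u i) (u-fixes i) a b)))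
      where
      open Dedekind em isField (CommutativeRing._*_ ⌞ M ⌟) (CommutativeRing.1# ⌞ M ⌟) using (characters-coincide)
      u : Fin (suc n) → M ⟶Ω
      u = t ∷ s
      u-fixes : ∀ i → Fixes B M B⊆M (u i)
      u-fixes zero    = t-fixes
      u-fixes (suc i) = s-fixes i
      select : (∃[ i ] ∃[ j ] i ≢ j × ∀ x → _⟶_.⟦_⟧ (u i) x ≈ _⟶_.⟦_⟧ (u j) x) →
        ∃[ i ] ∀ x → _⟶_.⟦_⟧ t x ≈ _⟶_.⟦_⟧ (s i) x
      select (zero  , zero  , 0≢0 , _)  = contradiction ≡.refl 0≢0
      select (zero  , suc j , _   , eq) = j , eq
      select (suc i , zero  , _   , eq) = i , λ x → sym (eq x)
      select (suc i , suc j , i≢j , eq) =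
        let (l , ≉) = distinct i j (i≢j ∘ ≡.cong suc) in contradiction (eq (b l)) ≉

    subfield-bounded : ∀ B M K (B⊆M : B ⊆ M) (M⊆K : M ⊆ K) (B⊆K : B ⊆ K) {n : ℕ} →
      Dimension.Bounded em (incl B K B⊆K) (subfield-isField B) n →
      Dimension.Bounded em (incl B M B⊆M) (subfield-isField B) n
    subfield-bounded B M K B⊆M M⊆K B⊆K bounded n<r b independent =
      bounded n<r (_⟶_.⟦_⟧ (incl M K M⊆K) ∘ b) (independent-incl B M K B⊆M M⊆K B⊆K b independent)

    subfield-finite : ∀ B M K (B⊆M : B ⊆ M) (M⊆K : M ⊆ K) (B⊆K : B ⊆ K) →
      IsFinite (incl B K B⊆K) → IsFinite (incl B M B⊆M)
    subfield-finite B M K B⊆M M⊆K B⊆K (n , b , span , _) =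
      Dimension.bounded⇒finite em (incl B M B⊆M) (subfield-isField B) {n}
        (subfield-bounded B M K B⊆M M⊆K B⊆K {n} λ n<r →
          Dimension.spanning⇒dependent em (incl B K B⊆K) (subfield-isField B) n<r b span)

    finite-over : ∀ B M K (B⊆M : B ⊆ M) (M⊆K : M ⊆ K) (B⊆K : B ⊆ K) →
      IsFinite (incl B K B⊆K) → IsFinite (incl M K M⊆K)
    finite-over B M K B⊆M M⊆K B⊆K (n , b , span , _) =
      Dimension.bounded⇒finite em (incl M K M⊆K) (subfield-isField M) {n} λ n<r →
        Dimension.spanning⇒dependent em (incl M K M⊆K) (subfield-isField M) n<r b
          (λ x → let (a , x≈) = span x in (_⟶_.⟦_⟧ (incl B M B⊆M) ∘ a) , trans x≈ (trans
            (combination-homo (incl B K B⊆K) (embedding K) a b)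
            (sym (combination-homo (incl M K M⊆K) (embedding K) (_⟶_.⟦_⟧ (incl B M B⊆M) ∘ a) b))))

-- Potentially Galois extensions

wholeGroup : (G : Group ℓ ℓ) → IsSubgroup G (λ _ → ⊤)
wholeGroup G = record
  { resp = λ _ _ → _ ; ε-closed = _ ; ∙-closed = λ _ _ → _ ; ⁻¹-closed = λ _ → _ }

algebraic-restrict : {F A B : CRing ℓ} (φ : F ⟶ A) (ψ : F ⟶ B) (θ : A ⟶ B) → IsInjective θ →
  (∀ a → CommutativeRing._≈_ B (_⟶_.⟦_⟧ θ (_⟶_.⟦_⟧ φ a)) (_⟶_.⟦_⟧ ψ a)) →
  IsAlgebraic ψ → IsAlgebraic φ
algebraic-restrict {A = A} {B} φ ψ θ injective over algebraic x =
  let (n , a , a-nonZero , eq) = algebraic θ.⟦ x ⟧ in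
  n , a , a-nonZero , injective (begin
    θ.⟦ combination φ a (λ i → x ^A.^ toℕ i) ⟧ ≈⟨ combination-homo φ θ a (λ i → x ^A.^ toℕ i) ⟩
    combination (θ ∘ʰ φ) a (λ i → θ.⟦ x ^A.^ toℕ i ⟧)
      ≈⟨ Sum.sum-cong-≋ B.semiring {n} (λ i → B.*-cong (over (a i)) (^-homo θ x (toℕ i))) ⟩
    combination ψ a (λ i → θ.⟦ x ⟧ ^B.^ toℕ i) ≈⟨ eq ⟩
    B.0#                                       ≈⟨ θ.0#-homo ⟨
    θ.⟦ CommutativeRing.0# A ⟧                 ∎)
  where
  module θ = _⟶_ θ
  module B = CommutativeRing B
  module ^A = Exp (CommutativeRing.semiring A)
  module ^B = Exp B.semiring
  open SetoidReasoning B.setoid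

module GaloisTheory (em : ∀ {a} → ExcludedMiddle a) (Ω : Field ℓ)
    (k E L Ê : Subfields.Subfield Ω)
    (k⊆E : Subfields._⊆_ Ω k E) (k⊆L : Subfields._⊆_ Ω k L) (E⊆Ê : Subfields._⊆_ Ω E Ê)
    (potentiallyGalois : IsPotentiallyGalois (Subfields.incl Ω k E k⊆E) (Subfields.incl Ω k L k⊆L))
    (galoisClosure : Subfields.IsGaloisClosure Ω k E Ê k⊆E E⊆Ê) where
  open Field Ω hiding (zero)
  open Subfields Ω
  open SubfieldProperties Ω
  open Classical em
  open Correspondence Ω k E L Ê k⊆E k⊆L E⊆Ê
  open Automorphism
  private
    module Γ = Group Γ
    module GalEL = Group GalEL
    module PG = IsPotentiallyGalois potentiallyGalois
    module GC = IsGaloisClosure galoisClosure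
    module Subf (K : Subfield) where
      open Subfield K public
  open Subf

  -- The isomorphism of E ⊗ L with EL, and linear disjointness of E and L

  E⊆EL : E ⊆ EL
  E⊆EL = left

  -- Stated for an intermediate field because it is applied both to E and to E^H.
  module TensorMap (M : Subfield) (k⊆M : k ⊆ M) (M⊆E : M ⊆ E) where
    M⊆EL : M ⊆ EL
    M⊆EL p = E⊆EL (M⊆E p)

    open Tensor (incl k M k⊆M) (incl k L k⊆L) using (ι₂)
    open TensorProperties (incl k M k⊆M) (incl k L k⊆L) using (ι₁)

    θ : Tensor.tensorRing (incl k M k⊆M) (incl k L k⊆L) ⟶ ⌞ EL ⌟
    θ = TensorProperties.Lift.lift (incl k M k⊆M) (incl k L k⊆L) (incl M EL M⊆EL) (incl L EL L⊆EL) (λ _ → refl)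

    module θ = _⟶_ θ

    θ-ι₁ : ∀ x (p : x ∈ᶠ M) → proj₁ θ.⟦ _⟶_.⟦_⟧ ι₁ (x , p) ⟧ ≈ x
    θ-ι₁ x p = *-identityʳ x

    θ-ι₂ : ∀ l (p : l ∈ᶠ L) → proj₁ θ.⟦ _⟶_.⟦_⟧ ι₂ (l , p) ⟧ ≈ l
    θ-ι₂ l p = *-identityˡ l

    θ-combination : ∀ {m} l (b : Fin m → ∃ (member M)) →
      proj₁ θ.⟦ combination ι₂ l (_⟶_.⟦_⟧ ι₁ ∘ b) ⟧ ≈
      proj₁ (combination (incl L EL L⊆EL) l (_⟶_.⟦_⟧ (incl M EL M⊆EL) ∘ b))
    θ-combination {m} l b = trans (combination-homo ι₂ θ l (_⟶_.⟦_⟧ ι₁ ∘ b))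
      (Sum.sum-cong-≋ (CommutativeRing.semiring ⌞ EL ⌟) {m} λ i →
        *-cong (*-identityˡ (proj₁ (l i))) (*-identityʳ (proj₁ (b i))))

  module TE where
    open TensorMap E k⊆E id public
    open Tensor (incl k E k⊆E) (incl k L k⊆L) public
    open TensorProperties (incl k E k⊆E) (incl k L k⊆L) public
  open TE using (_∼_)
  module E⊗L = CommutativeRing TE.tensorRing
  module E⊗L-galois = IsGalois PG.galois

  opaque
    -- For E the tensor product is a field by hypothesis. For E^H this is not known in advance, and
    -- `θ-injectiveM` argues with a basis instead.
    θ-injective : IsInjective TE.θ
    θ-injective = fieldHomomorphism-injective em TE.θ E⊗L-galois.top-isField 1≉0

  -- Closure under inverses rests on E ⊗ L being a field. As a subfield that contains E and L, the
  -- image is all of EL.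
  θ-image : Subfield
  θ-image = record
    { member     = λ x → ∃[ t ] proj₁ TE.θ.⟦ t ⟧ ≈ x
    ; resp       = λ eq (t , p) → t , trans p eq
    ; 0-closed   = TE.𝟘 , TE.θ.0#-homo
    ; 1-closed   = TE.𝟙 , TE.θ.1#-homo
    ; +-closed   = λ (s , p) (t , q) → s TE.⊕ t , trans (TE.θ.+-homo s t) (+-cong p q)
    ; *-closed   = λ (s , p) (t , q) → s TE.⊠ t , trans (TE.θ.*-homo s t) (*-cong p q)
    ; neg-closed = λ (t , p) → TE.⊖ t , trans (TE.θ.-‿homo t) (-‿cong p)
    ; inv-closed = λ (t , p) xy≈1 →
        let (u , tu∼1) = IsField.inverse E⊗L-galois.top-isField t λ t∼0 →
              isInvertible⇒≉0 commutativeRing 1≉0 xy≈1 (trans (sym p) (TE.θ.⟦⟧-cong t∼0))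
        in u , FieldProperties.inverse-unique isField
          (trans (*-congʳ (sym p)) (trans (sym (TE.θ.*-homo t u)) (trans (TE.θ.⟦⟧-cong tu∼1) TE.θ.1#-homo)))
          xy≈1
    }

  opaque
    EL⊆θ-image : EL ⊆ θ-image
    EL⊆θ-image = compositum-least θ-image
      (λ {x} p → _⟶_.⟦_⟧ TE.ι₁ (x , p) , TE.θ-ι₁ x p)
      (λ {x} p → _⟶_.⟦_⟧ TE.ι₂ (x , p) , TE.θ-ι₂ x p)

  θ⁻¹ : ⌞ EL ⌟ ⟶ TE.tensorRing
  θ⁻¹ = factor TE.θ θ-injective {⌞ EL ⌟} (incl EL EL id) (λ (x , p) → proj₁ (EL⊆θ-image p))
    λ (x , p) → proj₂ (EL⊆θ-image p)

  private
    module θ⁻¹ = _⟶_ θ⁻¹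

  θ-θ⁻¹ : ∀ (x : ∃ (member EL)) → proj₁ TE.θ.⟦ θ⁻¹.⟦ x ⟧ ⟧ ≈ proj₁ x
  θ-θ⁻¹ (x , p) = proj₂ (EL⊆θ-image p)

  θ⁻¹-θ : ∀ t → θ⁻¹.⟦ TE.θ.⟦ t ⟧ ⟧ ∼ t
  θ⁻¹-θ t = θ-injective (θ-θ⁻¹ TE.θ.⟦ t ⟧)

  θ⁻¹-injective : IsInjective θ⁻¹
  θ⁻¹-injective {x} {y} eq = trans (sym (θ-θ⁻¹ x)) (trans (TE.θ.⟦⟧-cong eq) (θ-θ⁻¹ y))

  opaque
    -- Every automorphism of E ⊗ L over L, transported along θ, fixes `x`; so the Galois property of
    -- E ⊗ L over L places the element corresponding to `x` in L.
    fixedByGalEL⇒∈L : ∀ (x : ∃ (member EL)) → (∀ (σ : GalEL.Carrier) → proj₁ (⟦ σ ⟧ x) ≈ proj₁ x) → proj₁ x ∈ᶠ L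
    fixedByGalEL⇒∈L x fixed =
      let ((l , l∈L) , eq) = E⊗L-galois.fixed⇒base θ⁻¹.⟦ x ⟧ λ τ →
            E⊗L.trans (E⊗L.sym (θ⁻¹-θ (⟦ τ ⟧ θ⁻¹.⟦ x ⟧))) (θ⁻¹.⟦⟧-cong {⟦ transported τ ⟧ x} {x} (fixed (transported τ)))
      in resp L (trans (sym (TE.θ-ι₂ l l∈L)) (trans (TE.θ.⟦⟧-cong (E⊗L.sym eq)) (θ-θ⁻¹ x))) l∈L
      where
      open Group (Gal TE.ι₂) using (_⁻¹)
      transported : Automorphism TE.ι₂ → Automorphism (incl L EL L⊆EL)
      transported τ = restrictAutomorphism (incl L EL L⊆EL) TE.ι₂ θ⁻¹ (λ {x} {y} → θ⁻¹-injective {x} {y})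
        (λ (l , p) → θ-injective (trans (θ-θ⁻¹ (l , L⊆EL p)) (sym (TE.θ-ι₂ l p)))) τ
        (λ x → TE.θ.⟦ ⟦ τ ⟧ θ⁻¹.⟦ x ⟧ ⟧) (λ x → θ⁻¹-θ _)
        (λ x → TE.θ.⟦ ⟦ τ ⁻¹ ⟧ θ⁻¹.⟦ x ⟧ ⟧) (λ x → θ⁻¹-θ _)

  opaque
    basis-independentOverL : ∀ {m} (b : Fin m → ∃ (member E)) → Spanning (incl k E k⊆E) b →
      Independent (incl k E k⊆E) b → Independent (incl L EL L⊆EL) (_⟶_.⟦_⟧ (incl E EL E⊆EL) ∘ b)
    basis-independentOverL b span independent l eq = TE.independent-⊗ b span independent l
      (θ-injective (trans (TE.θ-combination l b) (trans eq (sym TE.θ.0#-homo))))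

    -- Linear disjointness of E and L over k. The tensor product settles it for bases, and an
    -- arbitrary independent family is part of one.
    independentOverL : ∀ {m} (v : Fin m → ∃ (member E)) →
      Independent (incl k E k⊆E) v → Independent (incl L EL L⊆EL) (_⟶_.⟦_⟧ (incl E EL E⊆EL) ∘ v)
    independentOverL = extension-induction
      (λ n<r → spanning⇒dependent n<r (proj₁ (proj₂ PG.finite)) (proj₁ (proj₂ (proj₂ PG.finite))))
      (λ v → Independent (incl L EL L⊆EL) (_⟶_.⟦_⟧ (incl E EL E⊆EL) ∘ v))
      basis-independentOverL
      -- A relation on `v` is a relation on `x ∷ v` with coefficient 0 at `x`.
      (λ x v independent l eq i → independent ((0# , 0-closed L) ∷ l)
        (trans (+-cong (zeroˡ (proj₁ x)) eq) (+-identityˡ 0#)) (suc i))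
      where open Dimension em (incl k E k⊆E) (subfield-isField k)

  -- Embeddings realised by Gal(EL/L) and by Γ

  module ArtinEL = Artin em (incl L EL L⊆EL) (incl L EL L⊆EL) (subfield-isField EL) (subfield-isField L)
    (wholeGroup GalEL)
    (λ x fixed → (proj₁ x , fixedByGalEL⇒∈L x λ σ → fixed σ _) , refl)
    (λ σ _ → fixes σ)

  module ArtinΓ = Artin em (incl k Ê k⊆Ê) (incl k Ê k⊆Ê) (subfield-isField Ê) (subfield-isField k)
    (wholeGroup Γ)
    (λ x fixed → IsGalois.fixed⇒base GC.galois x λ γ → fixed γ _)
    (λ γ _ → fixes γ)

  -- By Dedekind, M has at most [M : k] embeddings over k in Ω; by Artin, Gal(EL/L) already realises that many.
  opaque
    restricts-to-GalEL : ∀ M (k⊆M : k ⊆ M) (M⊆E : M ⊆ E) (t : M ⟶Ω) → Fixes k M k⊆M t →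
      Σ[ σ ∈ GalEL.Carrier ] ∀ x (p : x ∈ᶠ M) → _⟶_.⟦_⟧ t (x , p) ≈ proj₁ (⟦ σ ⟧ (x , E⊆EL (M⊆E p)))
    restricts-to-GalEL M k⊆M M⊆E t t-fixes =
      let (m , b , span , independent) = subfield-finite em k M E k⊆M M⊆E k⊆E PG.finite
          (σ , _ , distinct) = ArtinEL.distinctAutomorphisms (_⟶_.⟦_⟧ (incl M EL (E⊆EL ∘ M⊆E)) ∘ b)
            (independentOverL (_⟶_.⟦_⟧ (incl M E M⊆E) ∘ b) (independent-incl k M E k⊆M M⊆E k⊆E b independent)) ℕ.≤-refl
          (i , eq) = exhaust em k M k⊆M b span (λ i → restriction M EL (E⊆EL ∘ M⊆E) (σ i))
            (λ i x p → trans (value-cong EL (embedding EL ∘ʰ automorphism⇒homomorphism (σ i)) refl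
                (E⊆EL (M⊆E (k⊆M p))) (L⊆EL (k⊆L p)))
              (fixes (σ i) (x , k⊆L p)))
            distinct t t-fixes
      in σ i , λ x p → eq (x , p)

    restricts-to-Γ : (t : E ⟶Ω) → Fixes k E k⊆E t →
      Σ[ γ ∈ Γ.Carrier ] ∀ x (p : x ∈ᶠ E) → _⟶_.⟦_⟧ t (x , p) ≈ proj₁ (⟦ γ ⟧ (x , E⊆Ê p))
    restricts-to-Γ t t-fixes =
      let (m , b , span , independent) = PG.finite
          (γ , _ , distinct) = ArtinΓ.distinctAutomorphisms (_⟶_.⟦_⟧ (incl E Ê E⊆Ê) ∘ b)
            (independent-incl k E Ê k⊆E E⊆Ê k⊆Ê b independent) ℕ.≤-refl
          (i , eq) = exhaust em k E k⊆E b span (λ i → restriction E Ê E⊆Ê (γ i))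
            (λ i x p → fixes (γ i) (x , p)) distinct t t-fixes
      in γ i , λ x p → eq (x , p)

  -- Conjugates of E, and restriction from EL to Ê

  -- By minimality of the Galois closure this will be all of Ê.
  data Conjugates : Pred Carrier ℓ where
    conjugate : ∀ (γ : Γ.Carrier) {x} (p : x ∈ᶠ E) → Conjugates (proj₁ (⟦ γ ⟧ (x , E⊆Ê p)))
    respects  : ∀ {x y} → x ≈ y → Conjugates x → Conjugates y
    plus      : ∀ {x y} → Conjugates x → Conjugates y → Conjugates (x + y)
    times     : ∀ {x y} → Conjugates x → Conjugates y → Conjugates (x * y)
    neg       : ∀ {x} → Conjugates x → Conjugates (- x)
    inv       : ∀ {x y} → Conjugates x → x * y ≈ 1# → Conjugates y

  conjugateField : Subfield
  conjugateField = record
    { member = Conjugates ; resp = respects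
    ; 0-closed = conjugate Γ.ε (0-closed E) ; 1-closed = conjugate Γ.ε (1-closed E)
    ; +-closed = plus ; *-closed = times ; neg-closed = neg ; inv-closed = inv
    }

  opaque
    conjugateField-least : ∀ Q → (∀ (γ : Γ.Carrier) {x} (p : x ∈ᶠ E) → proj₁ (⟦ γ ⟧ (x , E⊆Ê p)) ∈ᶠ Q) → conjugateField ⊆ Q
    conjugateField-least Q conj (conjugate γ p)  = conj γ p
    conjugateField-least Q conj (respects eq p)  = resp Q eq (conjugateField-least Q conj p)
    conjugateField-least Q conj (plus p q)       =
      +-closed Q (conjugateField-least Q conj p) (conjugateField-least Q conj q)
    conjugateField-least Q conj (times p q)      =
      *-closed Q (conjugateField-least Q conj p) (conjugateField-least Q conj q)
    conjugateField-least Q conj (neg p)          = neg-closed Q (conjugateField-least Q conj p)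
    conjugateField-least Q conj (inv p eq)       = inv-closed Q (conjugateField-least Q conj p) eq

  value : Γ.Carrier → Ê ⟶Ω
  value γ = embedding Ê ∘ʰ automorphism⇒homomorphism γ

  valueEL : GalEL.Carrier → EL ⟶Ω
  valueEL σ = embedding EL ∘ʰ automorphism⇒homomorphism σ

  E⊆conjugateField : E ⊆ conjugateField
  E⊆conjugateField = conjugate Γ.ε

  conjugateField⊆Ê : conjugateField ⊆ Ê
  conjugateField⊆Ê = conjugateField-least Ê λ γ p → proj₂ (⟦ γ ⟧ (_ , E⊆Ê p))

  opaque
    conjugateField-stable : ∀ (γ : Γ.Carrier) {x} → x ∈ᶠ conjugateField → (p : x ∈ᶠ Ê) → proj₁ (⟦ γ ⟧ (x , p)) ∈ᶠ conjugateField
    conjugateField-stable γ x∈ p =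
      let (q , γx∈) = conjugateField-least (preimage Ê (value γ) conjugateField)
            (λ δ r → proj₂ (⟦ δ ⟧ (_ , E⊆Ê r)) , conjugate (γ Γ.∙ δ) r) x∈
      in respects (value-cong Ê (value γ) refl q p) γx∈

    -- Each γ in Γ restricts to the field generated by the conjugates, so an element fixed by all
    -- automorphisms of that field is fixed by Γ and lies in k.
    conjugateField-galois : IsGalois (incl k conjugateField λ p → E⊆conjugateField (k⊆E p))
    conjugateField-galois = record
      { base-isField = subfield-isField k
      ; top-isField  = subfield-isField conjugateField
      ; algebraic    = algebraic-restrict (incl k conjugateField λ p → E⊆conjugateField (k⊆E p)) (incl k Ê k⊆Ê)
          (incl conjugateField Ê conjugateField⊆Ê) id (λ _ → refl) (IsGalois.algebraic GC.galois)
      ; fixed⇒base   = λ (x , x∈) fixed → IsGalois.fixed⇒base GC.galois (x , conjugateField⊆Ê x∈)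
          λ γ → fixed (restricted γ)
      }
      where
      restricted : Γ.Carrier → Automorphism (incl k conjugateField λ p → E⊆conjugateField (k⊆E p))
      restricted γ = restrictAutomorphism (incl k conjugateField λ p → E⊆conjugateField (k⊆E p))
        (incl k Ê k⊆Ê) (incl conjugateField Ê conjugateField⊆Ê) id (λ _ → refl) γ
        (λ (x , x∈) → _ , conjugateField-stable γ x∈ (conjugateField⊆Ê x∈)) (λ _ → refl)
        (λ (x , x∈) → _ , conjugateField-stable (γ Γ.⁻¹) x∈ (conjugateField⊆Ê x∈)) (λ _ → refl)

    Ê⊆conjugateField : Ê ⊆ conjugateField
    Ê⊆conjugateField = GC.minimal conjugateField E⊆conjugateField conjugateField⊆Ê conjugateField-galois

  opaque
    -- γ and σ are compared on E alone, as restriction of σ to Ê is not yet defined; this lemma and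
    -- its converse below are what make it definable.
    restriction-Γ⇒GalEL : ∀ (γ : Γ.Carrier) → Σ[ σ ∈ GalEL.Carrier ] ∀ {x} (p : x ∈ᶠ E) →
      proj₁ (⟦ γ ⟧ (x , E⊆Ê p)) ≈ proj₁ (⟦ σ ⟧ (x , E⊆EL p))
    restriction-Γ⇒GalEL γ =
      let (σ , eq) = restricts-to-GalEL E k⊆E id (restriction E Ê E⊆Ê γ) (λ x p → fixes γ (x , p)) in
      σ , λ p → eq _ p

    restriction-GalEL⇒Γ : ∀ (σ : GalEL.Carrier) → Σ[ γ ∈ Γ.Carrier ] ∀ {x} (p : x ∈ᶠ E) →
      proj₁ (⟦ σ ⟧ (x , E⊆EL p)) ≈ proj₁ (⟦ γ ⟧ (x , E⊆Ê p))
    restriction-GalEL⇒Γ σ =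
      let (γ , eq) = restricts-to-Γ (restriction E EL E⊆EL σ) (λ x p →
            trans (value-cong EL (valueEL σ) refl (E⊆EL (k⊆E p)) (L⊆EL (k⊆L p))) (fixes σ (x , k⊆L p))) in
      γ , λ p → eq _ p

  opaque
    -- Both claims are checked on generators γ(x) of Ê, with x in E. On E, γ acts as some τ of
    -- Gal(EL/L), so γ(x) = τ(x) lies in EL; and στ acts on E as some δ of Γ, so σ(γ(x)) = δ(x) lies
    -- in Ê.
    restrictable : Restrictable
    restrictable = record
      { Ê⊆EL   = Ê⊆EL
      ; stable = λ σ p →
          let (q , σx∈Ê) = conjugateField-least (preimage EL (valueEL σ) Ê)
                (λ γ {x} p →
                  let (τ , γx≈τx) = restriction-Γ⇒GalEL γ
                      (δ , στx≈δx) = restriction-GalEL⇒Γ (σ GalEL.∙ τ)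
                  in Ê⊆EL (proj₂ (⟦ γ ⟧ (x , E⊆Ê p))) ,
                     resp Ê (trans (sym (στx≈δx p)) (value-cong EL (valueEL σ) (sym (γx≈τx p))
                       (proj₂ (⟦ τ ⟧ (x , E⊆EL p))) (Ê⊆EL (proj₂ (⟦ γ ⟧ (x , E⊆Ê p))))))
                       (proj₂ (⟦ δ ⟧ (x , E⊆Ê p))))
                (Ê⊆conjugateField p)
          in resp Ê (value-cong EL (valueEL σ) refl q (Ê⊆EL p)) σx∈Ê
      }
      where
      Ê⊆EL : Ê ⊆ EL
      Ê⊆EL p = conjugateField-least EL
        (λ γ {x} p → let (σ , γx≈σx) = restriction-Γ⇒GalEL γ in
          resp EL (sym (γx≈σx p)) (proj₂ (⟦ σ ⟧ (x , E⊆EL p))))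
        (Ê⊆conjugateField p)

  open Restrictable restrictable
  open Restriction restrictable

  opaque
    agreeOnE⇒≈ : ∀ (σ τ : GalEL.Carrier) → (∀ {x} (p : x ∈ᶠ E) → proj₁ (⟦ σ ⟧ (x , E⊆EL p)) ≈ proj₁ (⟦ τ ⟧ (x , E⊆EL p))) →
      σ GalEL.≈ τ
    agreeOnE⇒≈ σ τ agree (x , p) =
      let (q , eq) = compositum-least (equalizer EL (valueEL σ) (valueEL τ))
            (λ p → E⊆EL p , agree p) (λ {l} p → L⊆EL p , trans (fixes σ (l , p)) (sym (fixes τ (l , p)))) p
      in trans (value-cong EL (valueEL σ) refl p q) (trans eq (value-cong EL (valueEL τ) refl q p))

    res-onE : ∀ (σ : GalEL.Carrier) {x} (p : x ∈ᶠ E) → proj₁ (⟦ res σ ⟧ (x , E⊆Ê p)) ≈ proj₁ (⟦ σ ⟧ (x , E⊆EL p))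
    res-onE σ p = value-cong EL (valueEL σ) refl (Ê⊆EL (E⊆Ê p)) (E⊆EL p)

    res-cong : ∀ (σ τ : GalEL.Carrier) → σ GalEL.≈ τ → res σ Γ.≈ res τ
    res-cong σ τ eq (x , p) = eq (x , Ê⊆EL p)

    -- The triviality of 𝔾 ∩ Γ_E in the form used below: lifts to EL that agree on E also agree on
    -- L, hence everywhere.
    𝔾-agreeOnE⇒≈ : ∀ (γ δ : Γ.Carrier) → γ ∈ 𝔾 → δ ∈ 𝔾 →
      (∀ {x} (p : x ∈ᶠ E) → proj₁ (⟦ γ ⟧ (x , E⊆Ê p)) ≈ proj₁ (⟦ δ ⟧ (x , E⊆Ê p))) → γ Γ.≈ δ
    𝔾-agreeOnE⇒≈ γ δ (σ , σ≈γ) (τ , τ≈δ) agree = Γ.trans {γ} {res σ} {δ} (Γ.sym {res σ} {γ} σ≈γ)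
      (Γ.trans {res σ} {res τ} {δ} (res-cong σ τ (agreeOnE⇒≈ σ τ λ p →
        trans (sym (res-onE σ p)) (trans (σ≈γ _) (trans (agree p) (trans (sym (τ≈δ _)) (res-onE τ p))))))
        τ≈δ)

  -- Stabilisers in Γ and the map η_L

  -- Gal(Ê/F) as a subset of Γ; `Γ-E` is by definition the case F = E.
  Stabiliser : (F : Subfield) → F ⊆ Ê → Pred Γ.Carrier ℓ
  Stabiliser F F⊆Ê γ = ∀ x → (p : x ∈ᶠ F) → proj₁ (⟦ γ ⟧ (x , F⊆Ê p)) ≈ x

  opaque
    stabiliser-isSubgroup : ∀ F (F⊆Ê : F ⊆ Ê) → IsSubgroup Γ (Stabiliser F F⊆Ê)
    stabiliser-isSubgroup F F⊆Ê = record
      { resp      = λ eq γ∈ x p → trans (sym (eq (x , F⊆Ê p))) (γ∈ x p)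
      ; ε-closed  = λ x p → refl
      ; ∙-closed  = λ {γ} {δ} γ∈ δ∈ x p → trans
          (value-cong Ê (value γ) (δ∈ x p) (proj₂ (⟦ δ ⟧ (x , F⊆Ê p))) (F⊆Ê p)) (γ∈ x p)
      ; ⁻¹-closed = λ {γ} γ∈ x p → injective γ {⟦ γ Γ.⁻¹ ⟧ (x , F⊆Ê p)} {x , F⊆Ê p}
          (trans (Γ.inverseʳ γ (x , F⊆Ê p)) (sym (γ∈ x p)))
      }

    agreeOnE⇒quotient∈Γ-E : ∀ (γ δ : Γ.Carrier) →
      (∀ {x} (p : x ∈ᶠ E) → proj₁ (⟦ γ ⟧ (x , E⊆Ê p)) ≈ proj₁ (⟦ δ ⟧ (x , E⊆Ê p))) → (γ Γ.⁻¹) Γ.∙ δ ∈ Γ-E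
    agreeOnE⇒quotient∈Γ-E γ δ agree x p = injective γ {⟦ (γ Γ.⁻¹) Γ.∙ δ ⟧ (x , E⊆Ê p)} {x , E⊆Ê p}
      (trans (Γ.inverseʳ γ (⟦ δ ⟧ (x , E⊆Ê p))) (sym (agree p)))

    restriction-Γ⇒res : ∀ (γ : Γ.Carrier) → Σ[ σ ∈ GalEL.Carrier ] ∀ {x} (p : x ∈ᶠ E) →
      proj₁ (⟦ res σ ⟧ (x , E⊆Ê p)) ≈ proj₁ (⟦ γ ⟧ (x , E⊆Ê p))
    restriction-Γ⇒res γ = let (σ , eq) = restriction-Γ⇒GalEL γ in
      σ , λ p → trans (res-onE σ p) (sym (eq p))

  module _ (E′ : Subfld) where

    E′⊆Ê : field′ E′ ⊆ Ê
    E′⊆Ê p = E⊆Ê (⊆E E′ p)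

    opaque
      -- σ fixes L in any case, so it fixes E′L as soon as it fixes E′.
      η≐𝔾∩Stabiliser : ηL-set E′ U.≐ (𝔾 U.∩ Stabiliser (field′ E′) E′⊆Ê)
      η≐𝔾∩Stabiliser =
        (λ {γ} (σ , σ∈ , eq) → (σ , eq) , λ x p → trans (sym (eq (x , E′⊆Ê p))) (σ∈ x (left p) (Ê⊆EL (E′⊆Ê p)))) ,
        (λ {γ} ((σ , eq) , γ∈) → σ , (λ x x∈ p →
          let (q , σx≈x) = compositum-least {field′ E′} {L} (equalizer EL (valueEL σ) (embedding EL))
                (λ {x} p → Ê⊆EL (E′⊆Ê p) , trans (eq (x , E′⊆Ê p)) (γ∈ x p))
                (λ {l} p → L⊆EL p , fixes σ (l , p)) x∈
          in trans (value-cong EL (valueEL σ) refl p q) σx≈x) , eq)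

      η⇒𝔾 : ∀ γ → γ ∈ ηL-set E′ → γ ∈ 𝔾
      η⇒𝔾 γ γ∈ = proj₁ (proj₁ η≐𝔾∩Stabiliser {γ} γ∈)

      η⇒Stabiliser : ∀ γ → γ ∈ ηL-set E′ → γ ∈ Stabiliser (field′ E′) E′⊆Ê
      η⇒Stabiliser γ γ∈ = proj₂ (proj₁ η≐𝔾∩Stabiliser {γ} γ∈)

      η-isSubgroup : IsSubgroup Γ (ηL-set E′)
      η-isSubgroup = isSubgroup-≐ Γ {𝔾 U.∩ Stabiliser (field′ E′) E′⊆Ê} {ηL-set E′}
        ((λ {γ} → proj₂ η≐𝔾∩Stabiliser {γ}) , λ {γ} → proj₁ η≐𝔾∩Stabiliser {γ})
        (∩-isSubgroup Γ {𝔾} {Stabiliser (field′ E′) E′⊆Ê} 𝔾-isSubgroup (stabiliser-isSubgroup (field′ E′) E′⊆Ê))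

      Stabiliser⇒η : ∀ (γ : Γ.Carrier) → γ ∈ Stabiliser (field′ E′) E′⊆Ê →
        Σ[ δ ∈ Γ.Carrier ] δ ∈ ηL-set E′ × ∀ {x} (p : x ∈ᶠ E) → proj₁ (⟦ δ ⟧ (x , E⊆Ê p)) ≈ proj₁ (⟦ γ ⟧ (x , E⊆Ê p))
      Stabiliser⇒η γ γ∈ = let (σ , eq) = restriction-Γ⇒res γ in
        res σ , proj₂ η≐𝔾∩Stabiliser {res σ} ((σ , λ _ → refl) , λ x p → trans (eq (⊆E E′ p)) (γ∈ x p)) , eq

      -- A γ fixing E′ agrees on E with some δ in η_L(E′), and γ = δ(δ⁻¹γ) is the required
      -- factorisation. The product set inherits the subgroup property from the stabiliser.
      ηΓ-E≐Stabiliser : (ηL-set E′ · Γ-E) U.≐ Stabiliser (field′ E′) E′⊆Ê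
      ηΓ-E≐Stabiliser =
        (λ {γ} (δ , ζ , δ∈ , ζ∈ , γ≈δζ) → S.resp {δ Γ.∙ ζ} {γ} (Γ.sym {γ} {δ Γ.∙ ζ} γ≈δζ)
          (S.∙-closed {δ} {ζ} (η⇒Stabiliser δ δ∈) λ x p → ζ∈ x (⊆E E′ p))) ,
        (λ {γ} γ∈ → let (δ , δ∈ , eq) = Stabiliser⇒η γ γ∈ in
          δ , (δ Γ.⁻¹) Γ.∙ γ , δ∈ , agreeOnE⇒quotient∈Γ-E δ γ eq , λ x → sym (Γ.inverseʳ δ (⟦ γ ⟧ x)))
        where module S = IsSubgroup (stabiliser-isSubgroup (field′ E′) E′⊆Ê)

      η-isSubgp : IsSubgp (ηL-set E′)
      η-isSubgp = record
        { isSubgroup   = η-isSubgroup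
        ; ⊆𝔾           = λ {γ} γ∈ → η⇒𝔾 γ γ∈
        ; HΓE-subgroup = isSubgroup-≐ Γ {Stabiliser (field′ E′) E′⊆Ê} {ηL-set E′ · Γ-E}
            ((λ {γ} → proj₂ ηΓ-E≐Stabiliser {γ}) , λ {γ} → proj₁ ηΓ-E≐Stabiliser {γ})
            (stabiliser-isSubgroup (field′ E′) E′⊆Ê)
        }

      -- `fixedByStabiliser⇒inSpan` over the base k, with E′ as the stabilised field: `y` is a
      -- k-combination of a k-basis of E′.
      fixedByStabiliser⇒∈ : ∀ y (p : y ∈ᶠ Ê) →
        (∀ (γ : Γ.Carrier) → γ ∈ Stabiliser (field′ E′) E′⊆Ê → proj₁ (⟦ γ ⟧ (y , p)) ≈ y) → y ∈ᶠ field′ E′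
      fixedByStabiliser⇒∈ y p fixed =
        let F = field′ E′
            (m , b , span , independent) = subfield-finite em k F E (k⊆ E′) (⊆E E′) k⊆E PG.finite
            spanned a = trans (combination-homo (incl k F (k⊆ E′)) (embedding F) a b)
              (sym (combination-homo (incl k Ê k⊆Ê) (embedding Ê) a (_⟶_.⟦_⟧ (incl F Ê E′⊆Ê) ∘ b)))
            (a , eq) = ArtinΓ.fixedByStabiliser⇒inSpan (incl F Ê E′⊆Ê) b
              (independent-incl k F Ê (k⊆ E′) E′⊆Ê k⊆Ê b independent)
              (λ x → let (a , x≈) = span x in a , trans x≈ (spanned a))
              (y , p) λ γ _ γ-fixes → fixed γ λ x q → γ-fixes (x , q)
        in resp F (trans (spanned a) (sym eq)) (proj₂ (combination (incl k F (k⊆ E′)) a b))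

      -- On E the stabiliser of E′ acts through η_L(E′), so an element of E fixed by η_L(E′) is
      -- fixed by the whole stabiliser.
      εη : (E^ ηL-set E′) ⊆ field′ E′ × field′ E′ ⊆ (E^ ηL-set E′)
      εη =
        (λ {x} (p , q , x-fixed) → fixedByStabiliser⇒∈ x q λ γ γ∈ →
          let (δ , δ∈ , eq) = Stabiliser⇒η γ γ∈ in
          trans (value-cong Ê (value γ) refl q (E⊆Ê p)) (trans (sym (eq p))
            (trans (value-cong Ê (value δ) refl (E⊆Ê p) q) (x-fixed δ δ∈)))) ,
        (λ {x} p → ⊆E E′ p , E′⊆Ê p , λ γ γ∈ → η⇒Stabiliser γ γ∈ x p)

  -- Degrees and orders

  AgreeOnE : Γ.Carrier → Γ.Carrier → Set ℓ
  AgreeOnE γ δ = ∀ {x} (p : x ∈ᶠ E) → proj₁ (⟦ γ ⟧ (x , E⊆Ê p)) ≈ proj₁ (⟦ δ ⟧ (x , E⊆Ê p))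

  -- Members of P representing the restrictions to E of the automorphisms over B
  record Representatives (B : Subfield) (B⊆E : B ⊆ E) (P : Pred Γ.Carrier ℓ) : Set ℓ where
    field
      finite           : IsFinite (incl B E B⊆E)
      representative   : Fin (proj₁ finite) → Γ.Carrier
      representative∈P : ∀ i → representative i ∈ P
      agreeOnE⇒≡       : ∀ i j → AgreeOnE (representative i) (representative j) → i ≡ j
      exhaustive       : ∀ (γ : Γ.Carrier) → γ ∈ Stabiliser B (λ p → E⊆Ê (B⊆E p)) → ∃[ i ] AgreeOnE γ (representative i)

  opaque
    -- Artin's lemma finds [E : B] members of P that differ on a B-basis of E, and Dedekind's leaves
    -- no other embedding of E over B. Hence `exhaustive` covers the full stabiliser of B even when
    -- P is only known to have fixed field B, as for HΓ_E.
    fixedField⇒representatives : (B : Subfield) (k⊆B : k ⊆ B) (B⊆E : B ⊆ E) (P : Pred Γ.Carrier ℓ) →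
      IsSubgroup Γ P → (∀ (γ : Γ.Carrier) → γ ∈ P → γ ∈ Stabiliser B (λ p → E⊆Ê (B⊆E p))) →
      (∀ y (p : y ∈ᶠ Ê) → (∀ (γ : Γ.Carrier) → γ ∈ P → proj₁ (⟦ γ ⟧ (y , p)) ≈ y) → y ∈ᶠ B) →
      Representatives B B⊆E P
    fixedField⇒representatives B k⊆B B⊆E P P-isSubgroup P-fixes fixedByP⇒∈B =
      let (m , b , span , independent) = finite
          (g , g∈P , distinct) = ArtinP.distinctAutomorphisms (_⟶_.⟦_⟧ (incl E Ê E⊆Ê) ∘ b)
            (independent-incl B E Ê B⊆E E⊆Ê B⊆Ê b independent) ℕ.≤-refl
      in record
        { finite           = finite
        ; representative   = g
        ; representative∈P = g∈P
        ; agreeOnE⇒≡       = λ i j agree → by-contradiction λ i≢j →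
            let (l , ≉) = distinct i j i≢j in ≉ (agree (proj₂ (b l)))
        ; exhaustive       = λ γ γ∈ →
            let (i , eq) = exhaust em B E B⊆E b span (λ i → restriction E Ê E⊆Ê (g i))
                  (λ i → P-fixes (g i) (g∈P i)) distinct (restriction E Ê E⊆Ê γ) γ∈
            in i , λ p → eq (_ , p)
        }
      where
      B⊆Ê : B ⊆ Ê
      B⊆Ê p = E⊆Ê (B⊆E p)
      finite : IsFinite (incl B E B⊆E)
      finite = finite-over em k B E k⊆B B⊆E k⊆E PG.finite
      module ArtinP = Artin em (incl k Ê k⊆Ê) (incl B Ê B⊆Ê) (subfield-isField Ê) (subfield-isField B) P-isSubgroup
        (λ (y , p) fixed → (y , fixedByP⇒∈B y p fixed) , refl)
        (λ γ γ∈ (x , p) → P-fixes γ γ∈ x p)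

    -- Representatives of the stabiliser are moved into 𝔾 without changing their restriction to E;
    -- inside 𝔾 that restriction determines the element, so they enumerate η_L(E′).
    order-η : ∀ E′ → ∃[ m ] HasDegree (incl (field′ E′) E (⊆E E′)) m × HasOrder Γ (ηL-set E′) m
    order-η E′ = proj₁ finite , proj₂ finite , hasOrder′

      where
      open Representatives (fixedField⇒representatives (field′ E′) (k⊆ E′) (⊆E E′)
        (Stabiliser (field′ E′) (E′⊆Ê E′)) (stabiliser-isSubgroup (field′ E′) (E′⊆Ê E′))
        (λ γ γ∈ → γ∈) (fixedByStabiliser⇒∈ E′))
      lifted : ∀ i → Σ[ δ ∈ Γ.Carrier ] δ ∈ ηL-set E′ × ∀ {x} (p : x ∈ᶠ E) →
        proj₁ (⟦ δ ⟧ (x , E⊆Ê p)) ≈ proj₁ (⟦ representative i ⟧ (x , E⊆Ê p))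
      lifted i = Stabiliser⇒η E′ (representative i) (representative∈P i)
      g : Fin (proj₁ finite) → Γ.Carrier
      g i = proj₁ (lifted i)
      g∈η : ∀ i → g i ∈ ηL-set E′
      g∈η i = proj₁ (proj₂ (lifted i))
      g-injective : ∀ i j → g i Γ.≈ g j → i ≡ j
      g-injective i j eq = agreeOnE⇒≡ i j λ {x} p → trans (sym (proj₂ (proj₂ (lifted i)) p))
        (trans (eq (x , E⊆Ê p)) (proj₂ (proj₂ (lifted j)) p))
      g-agree : ∀ γ i → AgreeOnE γ (representative i) → AgreeOnE (g i) γ
      g-agree γ i γ≈gᵢ {x} p = trans (proj₂ (proj₂ (lifted i)) p) (sym (γ≈gᵢ p))
      g-equal : ∀ γ i → γ ∈ 𝔾 → AgreeOnE (g i) γ → g i Γ.≈ γ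
      g-equal γ i γ∈𝔾 agree = 𝔾-agreeOnE⇒≈ (g i) γ (η⇒𝔾 E′ (g i) (g∈η i)) γ∈𝔾 agree
      index : ∀ γ → γ ∈ ηL-set E′ → ∃[ i ] AgreeOnE γ (representative i)
      index γ γ∈ = exhaustive γ (η⇒Stabiliser E′ γ γ∈)
      g-surjective : ∀ γ → γ ∈ ηL-set E′ → ∃[ i ] g i Γ.≈ γ
      g-surjective γ γ∈ = let (i , γ≈gᵢ) = index γ γ∈ in
        i , g-equal γ i (η⇒𝔾 E′ γ γ∈) (g-agree γ i γ≈gᵢ)
      hasOrder′ : HasOrder Γ (ηL-set E′) (proj₁ finite)
      hasOrder′ = hasOrder Γ {ηL-set E′} {proj₁ finite} g g∈η g-injective g-surjective

  -- Recovering H from E^H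

  module _ (S : Subgp) where
    private
      H = proj₁ S
      module H = IsSubgp (proj₂ S)
      module HS = IsSubgroup H.isSubgroup

    opaque
      H⊆HΓ-E : ∀ {h : Γ.Carrier} → h ∈ H → h ∈ H · Γ-E
      H⊆HΓ-E {h} h∈ = h , Γ.ε , h∈ , (λ x p → refl) , λ _ → refl

      Γ-E⊆HΓ-E : ∀ {γ : Γ.Carrier} → γ ∈ Γ-E → γ ∈ H · Γ-E
      Γ-E⊆HΓ-E {γ} γ∈ = Γ.ε , γ , HS.ε-closed , γ∈ , λ _ → refl

      HΓ-E-fixes : ∀ (γ : Γ.Carrier) → γ ∈ H · Γ-E → γ ∈ Stabiliser (E^ H) (λ p → E⊆Ê (E^⊆E H p))
      HΓ-E-fixes γ (h , δ , h∈ , δ∈ , γ≈hδ) x (p , q , x-fixed) = trans (γ≈hδ (x , E⊆Ê p))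
        (trans (value-cong Ê (value h) (δ∈ x p) (proj₂ (⟦ δ ⟧ (x , E⊆Ê p))) q) (x-fixed h h∈))

      -- Invariance under Γ_E puts `y` into E, invariance under H into Ê^H.
      fixedByHΓ-E⇒∈ : ∀ y (p : y ∈ᶠ Ê) → (∀ (γ : Γ.Carrier) → γ ∈ H · Γ-E → proj₁ (⟦ γ ⟧ (y , p)) ≈ y) → y ∈ᶠ (E^ H)
      fixedByHΓ-E⇒∈ y p fixed =
        fixedByStabiliser⇒∈ (record { field′ = E ; k⊆ = k⊆E ; ⊆E = id }) y p (λ γ γ∈ → fixed γ (Γ-E⊆HΓ-E {γ} γ∈)) ,
        p , λ h h∈ → fixed h (H⊆HΓ-E {h} h∈)

      -- Here the condition that HΓ_E is a subgroup enters: it lets HΓ_E supply the representatives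
      -- over E^H. An element γ of η_L(E^H) thus agrees on E with some hδ, hence with h, and both γ
      -- and h lie in 𝔾.
      ηε : ηL-set (εL S) U.≐ H
      ηε =
        (λ {γ} γ∈ →
          let (i , γ≈gᵢ) = exhaustive γ (η⇒Stabiliser (εL S) γ γ∈)
              (h , δ , h∈ , δ∈ , gᵢ≈hδ) = representative∈P i
          in HS.resp {h} {γ} (𝔾-agreeOnE⇒≈ h γ (H.⊆𝔾 {h} h∈) (η⇒𝔾 (εL S) γ γ∈) λ {x} p → begin
               proj₁ (⟦ h ⟧ (x , E⊆Ê p))
                 ≈⟨ value-cong Ê (value h) (δ∈ x p) (proj₂ (⟦ δ ⟧ (x , E⊆Ê p))) (E⊆Ê p) ⟨
               proj₁ (⟦ h Γ.∙ δ ⟧ (x , E⊆Ê p))          ≈⟨ gᵢ≈hδ (x , E⊆Ê p) ⟨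
               proj₁ (⟦ representative i ⟧ (x , E⊆Ê p)) ≈⟨ γ≈gᵢ p ⟨
               proj₁ (⟦ γ ⟧ (x , E⊆Ê p))                ∎)
             h∈) ,
        (λ {h} h∈ → proj₂ (η≐𝔾∩Stabiliser (εL S)) {h} (H.⊆𝔾 {h} h∈ , HΓ-E-fixes h (H⊆HΓ-E {h} h∈)))
        where
        open Representatives (fixedField⇒representatives (E^ H) (k⊆E^ H) (E^⊆E H)
          (H · Γ-E) H.HΓE-subgroup HΓ-E-fixes fixedByHΓ-E⇒∈)
        open SetoidReasoning setoid

  opaque
    order-ε : ∀ S → ∃[ m ] HasDegree (incl (field′ (εL S)) E (⊆E (εL S))) m × HasOrder Γ (proj₁ S) m
    order-ε S = let (m , hasDegree , hasOrder) = order-η (εL S) in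
      m , hasDegree , hasOrder-≐ Γ {ηL-set (εL S)} {proj₁ S} (ηε S) hasOrder

  opaque
    -- `Inverseᵇ` quantifies over every S extensionally equal to η_L(E′), not over η_L(E′) alone.
    ε-inverse : ∀ E′ (S : Subgp) → proj₁ S U.≐ ηL-set E′ → εL S ≈ᶠ E′
    ε-inverse E′ (H , _) (H⊆η , η⊆H) =
      (λ (p , q , x-fixed) → proj₁ (εη E′) (p , q , λ γ γ∈ → x-fixed γ (η⊆H {γ} γ∈))) ,
      (λ p → let (q , r , x-fixed) = proj₂ (εη E′) p in q , r , λ γ γ∈ → x-fixed γ (H⊆η {γ} γ∈))

    η-antitone : ∀ F F′ → field′ F ⊆ field′ F′ → ∀ γ → γ ∈ ηL-set F′ → γ ∈ ηL-set F
    η-antitone F F′ F⊆F′ γ γ∈ = proj₂ (η≐𝔾∩Stabiliser F) {γ} (η⇒𝔾 F′ γ γ∈ , λ x p →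
      trans (value-cong Ê (value γ) refl (E′⊆Ê F p) (E′⊆Ê F′ (F⊆F′ p))) (η⇒Stabiliser F′ γ γ∈ x (F⊆F′ p)))

    η-inverse : ∀ (S : Subgp) E′ → E′ ≈ᶠ εL S → ηL-set E′ U.≐ proj₁ S
    η-inverse S E′ (E′⊆εS , εS⊆E′) =
      (λ {γ} γ∈ → proj₁ (ηε S) {γ} (η-antitone (εL S) E′ εS⊆E′ γ γ∈)) ,
      (λ {γ} γ∈ → η-antitone E′ (εL S) E′⊆εS γ (proj₂ (ηε S) {γ} γ∈))

  -- Descent of the Galois property from EL to E^H ⊗ L

  opaque
    res-∙ : ∀ (σ τ : GalEL.Carrier) → res (σ GalEL.∙ τ) Γ.≈ res σ Γ.∙ res τ
    res-∙ σ τ (x , p) = value-cong EL (valueEL σ) refl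
      (proj₂ (⟦ τ ⟧ (x , Ê⊆EL p))) (Ê⊆EL (proj₂ (⟦ res τ ⟧ (x , p))))

  res-isGroupHomomorphism : IsGroupHomomorphism GalEL.rawGroup Γ.rawGroup res
  res-isGroupHomomorphism = isGroupHomomorphism-from-∙ GalEL Γ res (λ {σ} {τ} → res-cong σ τ) res-∙

  -- The parameters are the two facts that a characteristic H supplies: HΓ_E is a subgroup, and H is
  -- normal in 𝔾(L).
  module PreGalois (H : Pred Γ.Carrier ℓ) (H-isSubgroup : IsSubgroup Γ H)
      (H⊆𝔾 : ∀ γ → γ ∈ H → γ ∈ 𝔾) (HΓ-E-isSubgroup : IsSubgroup Γ (H · Γ-E))
      (H-normal : IsNormal 𝔾L (within𝔾 H)) where

    S : Subgp
    S = H , record { isSubgroup = H-isSubgroup ; ⊆𝔾 = λ {γ} → H⊆𝔾 γ ; HΓE-subgroup = HΓ-E-isSubgroup }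

    M : Subfield
    M = E^ H

    k⊆M : k ⊆ M
    k⊆M = k⊆E^ H

    M⊆E : M ⊆ E
    M⊆E = E^⊆E H

    M⊆EL : M ⊆ EL
    M⊆EL p = E⊆EL (M⊆E p)

    private
      module HS = IsSubgroup H-isSubgroup
      module EL = CommutativeRing ⌞ EL ⌟
      module 𝔾L = Group 𝔾L

    H-fixes-M : ∀ γ → γ ∈ H → ∀ x (p : x ∈ᶠ M) → proj₁ (⟦ γ ⟧ (x , E⊆Ê (M⊆E p))) ≈ x
    H-fixes-M γ γ∈ = HΓ-E-fixes S γ (H⊆HΓ-E S {γ} γ∈)

    opaque
      fixesM⇒∈H : ∀ γ → γ ∈ 𝔾 → (∀ x (p : x ∈ᶠ M) → proj₁ (⟦ γ ⟧ (x , E⊆Ê (M⊆E p))) ≈ x) → γ ∈ H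
      fixesM⇒∈H γ γ∈𝔾 γ-fixes = proj₁ (ηε S) {γ} (proj₂ (η≐𝔾∩Stabiliser (εL S)) {γ} (γ∈𝔾 , γ-fixes))

    opaque
      H̃-fixes-M : ∀ (σ : GalEL.Carrier) → res σ ∈ H → ∀ x (p : x ∈ᶠ M) → proj₁ (⟦ σ ⟧ (x , M⊆EL p)) ≈ x
      H̃-fixes-M σ σ∈ x p = trans (sym (res-onE σ (M⊆E p))) (H-fixes-M (res σ) σ∈ x p)

    opaque
      basisM : ∃[ m ] Σ[ b ∈ (Fin m → ∃ (member M)) ] Spanning (incl k M k⊆M) b ×
        Independent (incl L EL L⊆EL) (_⟶_.⟦_⟧ (incl M EL M⊆EL) ∘ b)
      basisM =
        let (m , b , span , independent) = subfield-finite em k M E k⊆M M⊆E k⊆E PG.finite in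
        m , b , span , independentOverL (_⟶_.⟦_⟧ (incl M E M⊆E) ∘ b) (independent-incl k M E k⊆M M⊆E k⊆E b independent)

    b : Fin (proj₁ basisM) → ∃ (member M)
    b = proj₁ (proj₂ basisM)

    b-spanning : Spanning (incl k M k⊆M) b
    b-spanning = proj₁ (proj₂ (proj₂ basisM))

    opaque
      b-spansOverL : ∀ y → ∃[ l ] _⟶_.⟦_⟧ (incl M EL M⊆EL) y EL.≈ combination (incl L EL L⊆EL) l (_⟶_.⟦_⟧ (incl M EL M⊆EL) ∘ b)
      b-spansOverL y = let (a , y≈) = b-spanning y in _⟶_.⟦_⟧ (incl k L k⊆L) ∘ a , trans y≈ (trans
        (combination-homo (incl k M k⊆M) (embedding M) a b)
        (sym (combination-homo (incl L EL L⊆EL) (embedding EL) (_⟶_.⟦_⟧ (incl k L k⊆L) ∘ a) (_⟶_.⟦_⟧ (incl M EL M⊆EL) ∘ b))))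

    opaque
      fixesM⇒res∈H : ∀ (σ : GalEL.Carrier) →
        (∀ y → ⟦ σ ⟧ (_⟶_.⟦_⟧ (incl M EL M⊆EL) y) EL.≈ _⟶_.⟦_⟧ (incl M EL M⊆EL) y) → res σ ∈ H
      fixesM⇒res∈H σ σ-fixes = fixesM⇒∈H (res σ) (σ , λ _ → refl)
        λ y p → trans (res-onE σ (M⊆E p)) (σ-fixes (y , p))

    opaque
      -- Galois theory of EL/L: an automorphism over L that fixes M restricts into H, so an element
      -- fixed by all those restricting into H is an L-combination of a k-basis of M.
      fixedByH⇒inSpan : ∀ x → (∀ (σ : GalEL.Carrier) → res σ ∈ H → ⟦ σ ⟧ x EL.≈ x) →
        ∃[ l ] x EL.≈ combination (incl L EL L⊆EL) l (_⟶_.⟦_⟧ (incl M EL M⊆EL) ∘ b)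
      fixedByH⇒inSpan x x-fixed = ArtinEL.fixedByStabiliser⇒inSpan (incl M EL M⊆EL) b (proj₂ (proj₂ (proj₂ basisM)))
        b-spansOverL x λ σ _ σ-fixes → x-fixed σ (fixesM⇒res∈H σ σ-fixes)

    opaque
      conjugate∈H : ∀ (ρ τ : GalEL.Carrier) → res τ ∈ H → res (ρ GalEL.∙ τ GalEL.∙ ρ GalEL.⁻¹) ∈ H
      conjugate∈H ρ τ τ∈ = HS.resp {res ρ Γ.∙ res τ Γ.∙ res ρ Γ.⁻¹} {res (ρ GalEL.∙ τ GalEL.∙ ρ GalEL.⁻¹)}
        (Γ.sym {res (ρ GalEL.∙ τ GalEL.∙ ρ GalEL.⁻¹)} {res ρ Γ.∙ res τ Γ.∙ res ρ Γ.⁻¹}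
          (Γ.trans {res (ρ GalEL.∙ τ GalEL.∙ ρ GalEL.⁻¹)} {res (ρ GalEL.∙ τ) Γ.∙ res (ρ GalEL.⁻¹)}
            {res ρ Γ.∙ res τ Γ.∙ res ρ Γ.⁻¹}
            (res-∙ (ρ GalEL.∙ τ) (ρ GalEL.⁻¹))
            (Γ.∙-cong {res (ρ GalEL.∙ τ)} {res ρ Γ.∙ res τ} {res (ρ GalEL.⁻¹)} {res ρ Γ.⁻¹}
              (res-∙ ρ τ) (IsGroupHomomorphism.⁻¹-homo res-isGroupHomomorphism ρ))))
        (H-normal (res ρ , ρ , λ _ → refl) {res τ , H⊆𝔾 (res τ) τ∈} τ∈)

    AgreeOnM : Γ.Carrier → Γ.Carrier → Set ℓ
    AgreeOnM γ δ = ∀ x (p : x ∈ᶠ M) → proj₁ (⟦ γ ⟧ (x , E⊆Ê (M⊆E p))) ≈ proj₁ (⟦ δ ⟧ (x , E⊆Ê (M⊆E p)))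

    opaque
      -- Together with its converse, this replaces cosets of H by restrictions to M, so that the
      -- isomorphism with the quotient is verified on M alone.
      agreeOnM⇒quotient∈H : ∀ γ δ → AgreeOnM (proj₁ γ) (proj₁ δ) → (γ 𝔾L.⁻¹) 𝔾L.∙ δ ∈ within𝔾 H
      agreeOnM⇒quotient∈H (γ , γ∈) (δ , δ∈) agree = fixesM⇒∈H ((γ Γ.⁻¹) Γ.∙ δ)
        (proj₂ ((γ , γ∈) 𝔾L.⁻¹ 𝔾L.∙ (δ , δ∈)))
        λ x p → injective γ {⟦ (γ Γ.⁻¹) Γ.∙ δ ⟧ (x , E⊆Ê (M⊆E p))} {x , E⊆Ê (M⊆E p)}
          (trans (Γ.inverseʳ γ (⟦ δ ⟧ (x , E⊆Ê (M⊆E p)))) (sym (agree x p)))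

    opaque
      quotient∈H⇒agreeOnM : ∀ γ δ → (γ 𝔾L.⁻¹) 𝔾L.∙ δ ∈ within𝔾 H → AgreeOnM (proj₁ γ) (proj₁ δ)
      quotient∈H⇒agreeOnM (γ , _) (δ , _) γ⁻¹δ∈ x p = sym (trans (sym (Γ.inverseʳ γ (⟦ δ ⟧ (x , E⊆Ê (M⊆E p)))))
        (value-cong Ê (value γ) (H-fixes-M ((γ Γ.⁻¹) Γ.∙ δ) γ⁻¹δ∈ x p)
          (proj₂ (⟦ (γ Γ.⁻¹) Γ.∙ δ ⟧ (x , E⊆Ê (M⊆E p)))) (E⊆Ê (M⊆E p))))

    𝔾L/H : Group ℓ ℓ
    𝔾L/H = quotient 𝔾L (within𝔾-isSubgroup H-isSubgroup) H-normal

    -- T is M ⊗ₖ L; only these properties of it matter.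
    module Transport (T : CRing ℓ) (ι₁ : ⌞ M ⌟ ⟶ T) (ι₂ : ⌞ L ⌟ ⟶ T) (θ : T ⟶ ⌞ EL ⌟)
        (ι₁≈ι₂ : ∀ x (p : x ∈ᶠ k) → CommutativeRing._≈_ T (_⟶_.⟦_⟧ ι₁ (x , k⊆M p)) (_⟶_.⟦_⟧ ι₂ (x , k⊆L p)))
        (ext : ∀ (s t : T ⟶ ⌞ EL ⌟) →
          (∀ x → _⟶_.⟦_⟧ s (_⟶_.⟦_⟧ ι₁ x) EL.≈ _⟶_.⟦_⟧ t (_⟶_.⟦_⟧ ι₁ x)) →
          (∀ l → _⟶_.⟦_⟧ s (_⟶_.⟦_⟧ ι₂ l) EL.≈ _⟶_.⟦_⟧ t (_⟶_.⟦_⟧ ι₂ l)) →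
          ∀ x → _⟶_.⟦_⟧ s x EL.≈ _⟶_.⟦_⟧ t x)
        (θ-ι₁ : ∀ x (p : x ∈ᶠ M) → proj₁ (_⟶_.⟦_⟧ θ (_⟶_.⟦_⟧ ι₁ (x , p))) ≈ x)
        (θ-ι₂ : ∀ l (p : l ∈ᶠ L) → proj₁ (_⟶_.⟦_⟧ θ (_⟶_.⟦_⟧ ι₂ (l , p))) ≈ l)
        (θ-injective : IsInjective θ)
        (fixedByH⇒image : ∀ (x : ∃ (member EL)) → (∀ (σ : GalEL.Carrier) → res σ ∈ H → ⟦ σ ⟧ x EL.≈ x) →
          ∃[ t ] _⟶_.⟦_⟧ θ t EL.≈ x)
        (T-algebraic : IsAlgebraic ι₂) where
      private
        module T = CommutativeRing T
        module ι₁ = _⟶_ ι₁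
        module ι₂ = _⟶_ ι₂
        module θ = _⟶_ θ

      opaque
        agreeOnM⇒agree : ∀ (σ : GalEL.Carrier) (s : T ⟶ ⌞ EL ⌟) →
          (∀ x (p : x ∈ᶠ M) → proj₁ (⟦ σ ⟧ (x , M⊆EL p)) ≈ proj₁ (_⟶_.⟦_⟧ s ι₁.⟦ x , p ⟧)) →
          (∀ l (p : l ∈ᶠ L) → proj₁ (_⟶_.⟦_⟧ s ι₂.⟦ l , p ⟧) ≈ l) →
          ∀ t → proj₁ (⟦ σ ⟧ θ.⟦ t ⟧) ≈ proj₁ (_⟶_.⟦_⟧ s t)
        agreeOnM⇒agree σ s agree s-fixes = ext (automorphism⇒homomorphism σ ∘ʰ θ) s
          (λ (x , p) → trans (value-cong EL (valueEL σ) (θ-ι₁ x p) (proj₂ θ.⟦ ι₁.⟦ x , p ⟧ ⟧) (M⊆EL p)) (agree x p))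
          (λ (l , p) → trans (value-cong EL (valueEL σ) (θ-ι₂ l p) (proj₂ θ.⟦ ι₂.⟦ l , p ⟧ ⟧) (L⊆EL p))
            (trans (fixes σ (l , p)) (sym (s-fixes l p))))

      opaque
        H-fixes-image : ∀ (σ : GalEL.Carrier) → res σ ∈ H → ∀ t → proj₁ (⟦ σ ⟧ θ.⟦ t ⟧) ≈ proj₁ θ.⟦ t ⟧
        H-fixes-image σ σ∈ = agreeOnM⇒agree σ θ
          (λ x p → trans (H̃-fixes-M σ σ∈ x p) (sym (θ-ι₁ x p))) θ-ι₂

      opaque
        -- For τ restricting into H, τσ = σ(σ⁻¹τσ), and by normality σ⁻¹τσ restricts into H as well
        -- and fixes the image of θ. The σ-image is therefore fixed by H and back in the image of θ.
        image-stable : ∀ (σ : GalEL.Carrier) t → ∃[ u ] proj₁ θ.⟦ u ⟧ ≈ proj₁ (⟦ σ ⟧ θ.⟦ t ⟧)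
        -- `conjugate∈H` concerns ρτρ⁻¹, so ρ is taken to be σ⁻¹ and σ is rewritten as the inverse
        -- of ρ.
        image-stable σ t = fixedByH⇒image (⟦ σ ⟧ θ.⟦ t ⟧) λ τ τ∈ → fixed (σ GalEL.⁻¹) τ (⁻¹-involutive σ θ.⟦ t ⟧) τ∈
          where
          open GroupProperties GalEL using (⁻¹-involutive)
          fixed : ∀ (ρ τ : GalEL.Carrier) → proj₁ (⟦ ρ GalEL.⁻¹ ⟧ θ.⟦ t ⟧) ≈ proj₁ (⟦ σ ⟧ θ.⟦ t ⟧) → res τ ∈ H →
            proj₁ (⟦ τ ⟧ (⟦ σ ⟧ θ.⟦ t ⟧)) ≈ proj₁ (⟦ σ ⟧ θ.⟦ t ⟧)
          fixed ρ τ ρ⁻¹≈σ τ∈ = trans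
            (⟦⟧-cong τ {⟦ σ ⟧ θ.⟦ t ⟧} {⟦ ρ GalEL.⁻¹ ⟧ θ.⟦ t ⟧} (sym ρ⁻¹≈σ))
            (trans (injective ρ {⟦ τ ⟧ (⟦ ρ GalEL.⁻¹ ⟧ θ.⟦ t ⟧)} {⟦ ρ GalEL.⁻¹ ⟧ θ.⟦ t ⟧}
                (trans (H-fixes-image (ρ GalEL.∙ τ GalEL.∙ ρ GalEL.⁻¹) (conjugate∈H ρ τ τ∈) t)
                  (sym (GalEL.inverseʳ ρ θ.⟦ t ⟧))))
              ρ⁻¹≈σ)

      opaque
        -- The image of θ is the fixed field of H, so the inverse in EL of an element of the image
        -- lies in the image again.
        T-isField : IsField T
        T-isField = record
          { 1≉0     = λ 1∼0 → 1≉0 (trans (sym θ.1#-homo) (trans (θ.⟦⟧-cong 1∼0) θ.0#-homo))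
          ; inverse = λ t t≁0 →
              let (x , x∈) = θ.⟦ t ⟧
                  (y , xy≈1) = inverse x λ x≈0 → t≁0 (θ-injective (trans x≈0 (sym θ.0#-homo)))
                  y∈ = inv-closed EL x∈ xy≈1
                  (u , θu≈y) = fixedByH⇒image (y , y∈) λ σ σ∈ → FieldProperties.inverse-unique isField
                    (trans (*-congʳ (sym (H-fixes-image σ σ∈ t))) (value-inverse EL (valueEL σ) x∈ y∈ xy≈1)) xy≈1
              in u , θ-injective (trans (θ.*-homo t u) (trans (*-congˡ θu≈y) (trans xy≈1 (sym θ.1#-homo))))
          }

      restricted : GalEL.Carrier → Automorphism ι₂
      restricted σ = restrictAutomorphism ι₂ (incl L EL L⊆EL) θ (λ {s} {t} → θ-injective {s} {t})
        (λ (l , p) → θ-ι₂ l p) σ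
        (λ t → proj₁ (image-stable σ t)) (λ t → proj₂ (image-stable σ t))
        (λ t → proj₁ (image-stable (σ GalEL.⁻¹) t)) (λ t → proj₂ (image-stable (σ GalEL.⁻¹) t))

      opaque
        T-galois : IsGalois ι₂
        T-galois = record
          { base-isField = subfield-isField L
          ; top-isField  = T-isField
          ; algebraic    = T-algebraic
          ; fixed⇒base   = λ t t-fixed →
              let x∈L = fixedByGalEL⇒∈L θ.⟦ t ⟧ λ σ → trans (sym (proj₂ (image-stable σ t))) (θ.⟦⟧-cong (t-fixed (restricted σ)))
              in (proj₁ θ.⟦ t ⟧ , x∈L) , θ-injective (sym (θ-ι₂ (proj₁ θ.⟦ t ⟧) x∈L))
          }

      private
        module GalM = Group (Gal ι₂)

      opaque
        -- θ ∘ τ on M is an embedding over k, and Gal(EL/L) realises every such embedding by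
        -- counting.
        extension : ∀ (τ : GalM.Carrier) → Σ[ σ ∈ GalEL.Carrier ] ∀ x (p : x ∈ᶠ M) →
          proj₁ θ.⟦ ⟦ τ ⟧ ι₁.⟦ x , p ⟧ ⟧ ≈ proj₁ (⟦ σ ⟧ (x , M⊆EL p))
        extension τ = restricts-to-GalEL M k⊆M M⊆E (embedding EL ∘ʰ θ ∘ʰ automorphism⇒homomorphism τ ∘ʰ ι₁) λ x p →
          trans (θ.⟦⟧-cong (T.trans (⟦⟧-cong τ (ι₁≈ι₂ x p)) (fixes τ (x , k⊆L p)))) (θ-ι₂ x (k⊆L p))

      opaque
        extension-θ : ∀ (τ : GalM.Carrier) t → proj₁ (⟦ proj₁ (extension τ) ⟧ θ.⟦ t ⟧) ≈ proj₁ θ.⟦ ⟦ τ ⟧ t ⟧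
        extension-θ τ = agreeOnM⇒agree (proj₁ (extension τ)) (θ ∘ʰ automorphism⇒homomorphism τ)
          (λ x p → sym (proj₂ (extension τ) x p))
          (λ l p → trans (θ.⟦⟧-cong (fixes τ (l , p))) (θ-ι₂ l p))

      opaque
        -- The extension of τ is an arbitrary choice, determined only modulo H; the laws below are
        -- accordingly stated as agreement on M.
        to𝔾 : GalM.Carrier → 𝔾L.Carrier
        to𝔾 τ = res (proj₁ (extension τ)) , proj₁ (extension τ) , λ _ → refl

        to𝔾-image : ∀ (τ : GalM.Carrier) x (p : x ∈ᶠ Ê) →
          proj₁ (⟦ proj₁ (to𝔾 τ) ⟧ (x , p)) ≈ proj₁ (⟦ proj₁ (extension τ) ⟧ (x , Ê⊆EL p))
        to𝔾-image τ x p = refl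

        to𝔾-onM : ∀ (τ : GalM.Carrier) x (p : x ∈ᶠ M) →
          proj₁ (⟦ proj₁ (to𝔾 τ) ⟧ (x , E⊆Ê (M⊆E p))) ≈ proj₁ θ.⟦ ⟦ τ ⟧ ι₁.⟦ x , p ⟧ ⟧
        to𝔾-onM τ x p = trans (res-onE (proj₁ (extension τ)) (M⊆E p)) (sym (proj₂ (extension τ) x p))

      opaque
        to𝔾-∙ : ∀ (τ τ′ : GalM.Carrier) → AgreeOnM (proj₁ (to𝔾 (τ GalM.∙ τ′))) (proj₁ (to𝔾 τ 𝔾L.∙ to𝔾 τ′))
        to𝔾-∙ τ τ′ x p = trans (to𝔾-onM (τ GalM.∙ τ′) x p)
          (trans (sym (extension-θ τ (⟦ τ′ ⟧ ι₁.⟦ x , p ⟧)))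
            (trans (value-cong EL (valueEL (proj₁ (extension τ))) (sym (to𝔾-onM τ′ x p))
              (proj₂ θ.⟦ ⟦ τ′ ⟧ ι₁.⟦ x , p ⟧ ⟧) (Ê⊆EL τ′x∈))
              (sym (to𝔾-image τ _ τ′x∈))))
          where
          τ′x∈ : proj₁ (⟦ proj₁ (to𝔾 τ′) ⟧ (x , E⊆Ê (M⊆E p))) ∈ᶠ Ê
          τ′x∈ = proj₂ (⟦ proj₁ (to𝔾 τ′) ⟧ (x , E⊆Ê (M⊆E p)))

      opaque
        to𝔾-cong : ∀ (τ τ′ : GalM.Carrier) → τ GalM.≈ τ′ → AgreeOnM (proj₁ (to𝔾 τ)) (proj₁ (to𝔾 τ′))
        to𝔾-cong τ τ′ eq x p = trans (to𝔾-onM τ x p) (trans (θ.⟦⟧-cong (eq ι₁.⟦ x , p ⟧)) (sym (to𝔾-onM τ′ x p)))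

      opaque
        to𝔾-injective : ∀ (τ τ′ : GalM.Carrier) → AgreeOnM (proj₁ (to𝔾 τ)) (proj₁ (to𝔾 τ′)) → τ GalM.≈ τ′
        to𝔾-injective τ τ′ agree t = θ-injective (trans (sym (extension-θ τ t))
          (agreeOnM⇒agree (proj₁ (extension τ)) (θ ∘ʰ automorphism⇒homomorphism τ′)
            (λ x p → trans (sym (proj₂ (extension τ) x p)) (trans (sym (to𝔾-onM τ x p)) (trans (agree x p) (to𝔾-onM τ′ x p))))
            (λ l p → trans (θ.⟦⟧-cong (fixes τ′ (l , p))) (θ-ι₂ l p)) t))

      opaque
        to𝔾-restricted : ∀ (γ : Γ.Carrier) (σ : GalEL.Carrier) → res σ Γ.≈ γ → ∀ (τ : GalM.Carrier) →
          τ GalM.≈ restricted σ → AgreeOnM (proj₁ (to𝔾 τ)) γ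
        to𝔾-restricted γ σ σ≈γ τ τ≈ x p = begin
          proj₁ (⟦ proj₁ (to𝔾 τ) ⟧ (x , E⊆Ê (M⊆E p)))           ≈⟨ to𝔾-onM τ x p ⟩
          proj₁ θ.⟦ ⟦ τ ⟧ ι₁.⟦ x , p ⟧ ⟧                ≈⟨ θ.⟦⟧-cong (τ≈ ι₁.⟦ x , p ⟧) ⟩
          proj₁ θ.⟦ ⟦ restricted σ ⟧ ι₁.⟦ x , p ⟧ ⟧     ≈⟨ proj₂ (image-stable σ ι₁.⟦ x , p ⟧) ⟩
          proj₁ (⟦ σ ⟧ θ.⟦ ι₁.⟦ x , p ⟧ ⟧)
            ≈⟨ value-cong EL (valueEL σ) (θ-ι₁ x p) (proj₂ θ.⟦ ι₁.⟦ x , p ⟧ ⟧) (Ê⊆EL (E⊆Ê (M⊆E p))) ⟩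
          proj₁ (⟦ res σ ⟧ (x , E⊆Ê (M⊆E p)))           ≈⟨ σ≈γ (x , E⊆Ê (M⊆E p)) ⟩
          proj₁ (⟦ γ ⟧ (x , E⊆Ê (M⊆E p)))               ∎
          where open SetoidReasoning setoid

      GalM≅𝔾L/H : Gal ι₂ ≅ 𝔾L/H
      GalM≅𝔾L/H = ≅-quotient (Gal ι₂) 𝔾L {within𝔾 H} (within𝔾-isSubgroup H-isSubgroup) H-normal to𝔾
        (λ τ τ′ eq → agreeOnM⇒quotient∈H (to𝔾 τ) (to𝔾 τ′) (to𝔾-cong τ τ′ eq))
        (λ τ τ′ → agreeOnM⇒quotient∈H (to𝔾 (τ GalM.∙ τ′)) (to𝔾 τ 𝔾L.∙ to𝔾 τ′) (to𝔾-∙ τ τ′))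
        (λ τ τ′ q → to𝔾-injective τ τ′ (quotient∈H⇒agreeOnM (to𝔾 τ) (to𝔾 τ′) q))
        (λ γ → let (σ , σ≈γ) = proj₂ γ in restricted σ , λ τ τ≈ →
          agreeOnM⇒quotient∈H (to𝔾 τ) γ (to𝔾-restricted (proj₁ γ) σ σ≈γ τ τ≈))

    private
      tensorRing : CRing ℓ
      tensorRing = Tensor.tensorRing (incl k M k⊆M) (incl k L k⊆L)
      ι₁ : ⌞ M ⌟ ⟶ tensorRing
      ι₁ = TensorProperties.ι₁ (incl k M k⊆M) (incl k L k⊆L)
      ι₂ : ⌞ L ⌟ ⟶ tensorRing
      ι₂ = Tensor.ι₂ (incl k M k⊆M) (incl k L k⊆L)
      θ : tensorRing ⟶ ⌞ EL ⌟
      θ = TensorMap.θ M k⊆M M⊆E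

    opaque
      -- An element of the kernel expands over L in the basis of M, which stays independent over L
      -- in EL, so all its coefficients vanish.
      θ-injectiveM : IsInjective θ
      θ-injectiveM = trivialKernel⇒injective θ λ t θt≈0 →
        let (l , t∼) = TensorProperties.spanning-⊗ (incl k M k⊆M) (incl k L k⊆L) b b-spanning t
            l≈0 = proj₂ (proj₂ (proj₂ basisM)) l (trans (sym (TensorMap.θ-combination M k⊆M M⊆E l b))
              (trans (θ.⟦⟧-cong (⊗R.sym t∼)) θt≈0))
        in ⊗R.trans t∼ (⊗R.trans
          (combination-cong {a = l} {λ _ → 0# , 0-closed L} {_⟶_.⟦_⟧ ι₁ ∘ b} {_⟶_.⟦_⟧ ι₁ ∘ b} l≈0 (λ _ → ⊗R.refl))
          (combination-0 (_⟶_.⟦_⟧ ι₁ ∘ b)))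
        where
        open Combination ι₂
        module ⊗R = CommutativeRing tensorRing
        module θ = _⟶_ θ

    opaque
      fixedByH⇒image : ∀ x → (∀ (σ : GalEL.Carrier) → res σ ∈ H → ⟦ σ ⟧ x EL.≈ x) → ∃[ t ] _⟶_.⟦_⟧ θ t EL.≈ x
      fixedByH⇒image x x-fixed = let (l , x≈) = fixedByH⇒inSpan x x-fixed in
        combination ι₂ l (_⟶_.⟦_⟧ ι₁ ∘ b) , trans (TensorMap.θ-combination M k⊆M M⊆E l b) (sym x≈)

    module M⊗L-transport = Transport tensorRing ι₁ ι₂ θ
      (λ x p → TensorProperties.ι₁∘f∼ι₂∘g (incl k M k⊆M) (incl k L k⊆L) (x , p))
      (tensor-ext (incl k M k⊆M) (incl k L k⊆L)) (TensorMap.θ-ι₁ M k⊆M M⊆E) (TensorMap.θ-ι₂ M k⊆M M⊆E)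
      (λ {s} {t} → θ-injectiveM {s} {t}) fixedByH⇒image
      (Dimension.spanning⇒algebraic em ι₂ (subfield-isField L) (_⟶_.⟦_⟧ ι₁ ∘ b)
        (TensorProperties.spanning-⊗ (incl k M k⊆M) (incl k L k⊆L) b b-spanning))

    isPotentiallyGalois : IsPotentiallyGalois (incl k M k⊆M) (incl k L k⊆L)
    isPotentiallyGalois = record
      { k-isField = subfield-isField k
      ; E-isField = subfield-isField M
      ; L-isField = subfield-isField L
      ; finite    = subfield-finite em k M E k⊆M M⊆E k⊆E PG.finite
      ; galois    = M⊗L-transport.T-galois
      }

    isPotentiallyGaloisWithGroup : IsPotentiallyGaloisWithGroup (incl k M k⊆M) (incl k L k⊆L) 𝔾L/H
    isPotentiallyGaloisWithGroup = isPotentiallyGalois , M⊗L-transport.GalM≅𝔾L/H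

  -- Normality of 𝔾(L) in Γ when L/k is Galois

  module Normality (L-galois : IsGalois (incl k L k⊆L)) where

    opaque
      Γ-representatives : Representatives k k⊆E (λ _ → ⊤)
      Γ-representatives = fixedField⇒representatives k id k⊆E (λ _ → ⊤) (wholeGroup Γ)
        (λ γ _ x p → fixes γ (x , p))
        (λ y p fixed → let ((a , a∈k) , y≈a) = IsGalois.fixed⇒base GC.galois (y , p) (λ γ → fixed γ _) in
          resp k (sym y≈a) a∈k)

    open Representatives Γ-representatives

    d : ℕ
    d = proj₁ finite

    -- The action of Γ on the coset space Γ/Γ_E, seen as the d restrictions to E and recorded by
    -- indices.
    index : ∀ (γ : Γ.Carrier) (i : Fin d) → Σ[ j ∈ Fin d ] AgreeOnE (γ Γ.∙ representative i) (representative j)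
    index γ i = exhaustive (γ Γ.∙ representative i) λ x p → fixes (γ Γ.∙ representative i) (x , p)

    opaque
      representatives-separate : ∀ (γ δ : Γ.Carrier) →
        (∀ i → AgreeOnE (γ Γ.∙ representative i) (δ Γ.∙ representative i)) → γ Γ.≈ δ
      representatives-separate γ δ agree (x , p) =
        let (q , eq) = conjugateField-least (equalizer Ê (value γ) (value δ)) conjugates (Ê⊆conjugateField p)
        in trans (value-cong Ê (value γ) refl p q) (trans eq (value-cong Ê (value δ) refl q p))
        where
        conjugates : ∀ (ζ : Γ.Carrier) {x} (p : x ∈ᶠ E) →
          proj₁ (⟦ ζ ⟧ (x , E⊆Ê p)) ∈ᶠ equalizer Ê (value γ) (value δ)
        conjugates ζ {x} p =
          let (i , ζ≈gᵢ) = exhaustive ζ λ x p → fixes ζ (x , p)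
              q = proj₂ (⟦ ζ ⟧ (x , E⊆Ê p))
              r = proj₂ (⟦ representative i ⟧ (x , E⊆Ê p))
          in q , trans (value-cong Ê (value γ) (ζ≈gᵢ p) q r)
                   (trans (agree i p) (value-cong Ê (value δ) (sym (ζ≈gᵢ p)) r q))

      index-injective : ∀ (γ δ : Γ.Carrier) → (∀ i → proj₁ (index γ i) ≡ proj₁ (index δ i)) → γ Γ.≈ δ
      index-injective γ δ eq = representatives-separate γ δ agree
        where
        agree : ∀ i → AgreeOnE (γ Γ.∙ representative i) (δ Γ.∙ representative i)
        agree i {x} p = trans (proj₂ (index γ i) p) (trans
          (reflexive (≡.cong (λ j → proj₁ (⟦ representative j ⟧ (x , E⊆Ê p))) (eq i)))
          (sym (proj₂ (index δ i) p)))

      -- An automorphism over k is determined by its action on the d restrictions to E.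
      Ê-bounded : Dimension.Bounded em (incl k Ê k⊆Ê) (subfield-isField k) (d ℕ.^ d)
      Ê-bounded dᵈ<r v independent =
        let (g , _ , distinct) = ArtinΓ.distinctAutomorphisms v independent ℕ.≤-refl
            -- `d ^ d` is the number of maps from `Fin d` to itself, coded by `funToFin`. More
            -- automorphisms than that include two with the same action, and these are equal
            -- although distinct on `v`.
            (i , j , i<j , eq) = pigeonhole dᵈ<r λ j → funToFin (λ l → proj₁ (index (g j) l))
            (l , ≉) = distinct i j (<⇒≢ i<j)
        in ≉ (index-injective (g i) (g j) (λ l → ≡.trans (≡.sym (finToFun-funToFin _ l))
             (≡.trans (≡.cong (λ c → finToFun c l) eq) (finToFun-funToFin _ l))) (v l))

    Ê∩L : Subfield
    Ê∩L = Ê ∩ L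

    k⊆Ê∩L : k ⊆ Ê∩L
    k⊆Ê∩L p = k⊆Ê p , k⊆L p

    module ArtinL = Artin em (incl k L k⊆L) (incl k L k⊆L) (subfield-isField L) (subfield-isField k)
      (wholeGroup (Gal (incl k L k⊆L)))
      (λ x fixed → IsGalois.fixed⇒base L-galois x λ τ → fixed τ _)
      (λ τ _ → fixes τ)

    opaque
      -- Counting the embeddings of Ê ∩ L takes a finite basis over k, while Ê/k comes only as an
      -- algebraic extension; this is what the bound on Ê is for.
      finite-Ê∩L : IsFinite (incl k Ê∩L k⊆Ê∩L)
      finite-Ê∩L = Dimension.bounded⇒finite em (incl k Ê∩L k⊆Ê∩L) (subfield-isField k)
        {d ℕ.^ d} (subfield-bounded em k Ê∩L Ê k⊆Ê∩L proj₁ k⊆Ê Ê-bounded)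

    opaque
      -- γ on Ê ∩ L is an embedding over k. Since L/k is Galois, Gal(L/k) already realises all of
      -- them, so γ acts there as an automorphism of L.
      Ê∩L-stable : ∀ (γ : Γ.Carrier) x (p : x ∈ᶠ Ê) → x ∈ᶠ L → proj₁ (⟦ γ ⟧ (x , p)) ∈ᶠ L
      Ê∩L-stable γ x p q =
        let (m , b , span , independent) = finite-Ê∩L
            (g , _ , distinct) = ArtinL.distinctAutomorphisms (_⟶_.⟦_⟧ (incl Ê∩L L proj₂) ∘ b)
              (independent-incl k Ê∩L L k⊆Ê∩L proj₂ k⊆L b independent) ℕ.≤-refl
            (i , eq) = exhaust em k Ê∩L k⊆Ê∩L b span (λ i → restriction Ê∩L L proj₂ (g i))
              (λ i x p → fixes (g i) (x , p)) distinct
              (restriction Ê∩L Ê proj₁ γ) (λ x p → fixes γ (x , p))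
        in resp L (sym (eq (x , p , q))) (proj₂ (⟦ g i ⟧ (x , q)))

    𝔾-fixes-L : ∀ (γ : Γ.Carrier) → γ ∈ 𝔾 → ∀ x (p : x ∈ᶠ Ê) → x ∈ᶠ L → proj₁ (⟦ γ ⟧ (x , p)) ≈ x
    𝔾-fixes-L γ (σ , σ≈γ) x p q = trans (sym (σ≈γ (x , p)))
      (trans (value-cong EL (valueEL σ) refl (Ê⊆EL p) (L⊆EL q)) (fixes σ (x , q)))

    -- The fixed field of 𝔾 in Ê is Ê ∩ L because that of Gal(EL/L) in EL is L.
    module Artin𝔾 = Artin em (incl k Ê k⊆Ê) (incl Ê∩L Ê proj₁) (subfield-isField Ê) (subfield-isField Ê∩L)
      𝔾-isSubgroup
      (λ (y , p) fixed → (y , p , fixedByGalEL⇒∈L (y , Ê⊆EL p) λ σ → fixed (res σ) (σ , λ _ → refl)) , refl)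
      (λ γ γ∈ (x , p , q) → 𝔾-fixes-L γ γ∈ x p q)

    e : Fin (proj₁ PG.finite) → ∃ (member E)
    e = proj₁ (proj₂ PG.finite)

    opaque
      -- E and Ê ∩ L generate Ê, by Galois theory for 𝔾 since only the identity of 𝔾 fixes E.
      Ê-spanned : ∀ y → ∃[ a ] CommutativeRing._≈_ ⌞ Ê ⌟ y (combination (incl Ê∩L Ê proj₁) a (_⟶_.⟦_⟧ (incl E Ê E⊆Ê) ∘ e))
      Ê-spanned y = Artin𝔾.fixedByStabiliser⇒inSpan (incl E Ê E⊆Ê) e
        (λ a eq → independentOverL e (proj₂ (proj₂ (proj₂ PG.finite)))
          (_⟶_.⟦_⟧ (incl Ê∩L L proj₂) ∘ a) (trans
            (combination-homo (incl L EL L⊆EL) (embedding EL) (_⟶_.⟦_⟧ (incl Ê∩L L proj₂) ∘ a) (_⟶_.⟦_⟧ (incl E EL E⊆EL) ∘ e))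
            (trans (sym (combination-homo (incl Ê∩L Ê proj₁) (embedding Ê) a (_⟶_.⟦_⟧ (incl E Ê E⊆Ê) ∘ e))) eq)))
        (λ x → let (a , x≈) = proj₁ (proj₂ (proj₂ PG.finite)) x in _⟶_.⟦_⟧ (incl k Ê∩L k⊆Ê∩L) ∘ a , trans x≈ (trans
          (combination-homo (incl k E k⊆E) (embedding E) a e)
          (sym (combination-homo (incl Ê∩L Ê proj₁) (embedding Ê) (_⟶_.⟦_⟧ (incl k Ê∩L k⊆Ê∩L) ∘ a) (_⟶_.⟦_⟧ (incl E Ê E⊆Ê) ∘ e)))))
        y (λ γ γ∈ γ-fixes → 𝔾-agreeOnE⇒≈ γ Γ.ε γ∈ (IsSubgroup.ε-closed 𝔾-isSubgroup) (λ p → γ-fixes (_ , p)) y)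

    opaque
      agreeOnE∪Ê∩L⇒≈ : ∀ (γ δ : Γ.Carrier) → AgreeOnE γ δ →
        (∀ x (p : x ∈ᶠ Ê) → x ∈ᶠ L → proj₁ (⟦ γ ⟧ (x , p)) ≈ proj₁ (⟦ δ ⟧ (x , p))) → γ Γ.≈ δ
      agreeOnE∪Ê∩L⇒≈ γ δ agree agree′ y = let (a , y≈) = Ê-spanned y in
        trans (value-cong Ê (value γ) y≈ (proj₂ y) (proj₂ (combination (incl Ê∩L Ê proj₁) a (_⟶_.⟦_⟧ (incl E Ê E⊆Ê) ∘ e))))
          (trans (combination-agree (incl Ê∩L Ê proj₁) (value γ) (value δ) a (_⟶_.⟦_⟧ (incl E Ê E⊆Ê) ∘ e)
              (λ i → agree′ (proj₁ (a i)) (proj₁ (proj₂ (a i))) (proj₂ (proj₂ (a i)))) (λ i → agree (proj₂ (e i))))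
            (value-cong Ê (value δ) (sym y≈) (proj₂ (combination (incl Ê∩L Ê proj₁) a (_⟶_.⟦_⟧ (incl E Ê E⊆Ê) ∘ e))) (proj₂ y)))

    opaque
      -- Some member of 𝔾 agrees with γ on E. Both fix Ê ∩ L, and Ê is spanned over Ê ∩ L by
      -- elements of E, so they are equal.
      fixesÊ∩L⇒∈𝔾 : ∀ (γ : Γ.Carrier) → (∀ x (p : x ∈ᶠ Ê) → x ∈ᶠ L → proj₁ (⟦ γ ⟧ (x , p)) ≈ x) → γ ∈ 𝔾
      fixesÊ∩L⇒∈𝔾 γ γ-fixes = let (σ , σ≈γ) = restriction-Γ⇒res γ in
        σ , agreeOnE∪Ê∩L⇒≈ (res σ) γ σ≈γ λ x p q →
          trans (𝔾-fixes-L (res σ) (σ , λ _ → refl) x p q) (sym (γ-fixes x p q))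

    opaque
      -- 𝔾 is the stabiliser of Ê ∩ L, and γ⁻¹ maps Ê ∩ L into itself, where δ acts trivially.
      𝔾-isNormal : IsNormal Γ 𝔾
      𝔾-isNormal γ {δ} δ∈ = fixesÊ∩L⇒∈𝔾 (γ Γ.∙ δ Γ.∙ γ Γ.⁻¹) λ x p q →
        let y = ⟦ γ Γ.⁻¹ ⟧ (x , p)
            γ⁻¹x∈L = Ê∩L-stable (γ Γ.⁻¹) x p q
        in trans (value-cong Ê (value γ) (𝔾-fixes-L δ δ∈ (proj₁ y) (proj₂ y) γ⁻¹x∈L) (proj₂ (⟦ δ ⟧ y)) (proj₂ y))
             (Γ.inverseʳ γ (x , p))

    opaque
      characteristic⇒HΓ-E-isSubgroup : ∀ H → IsSubgroup Γ H → H U.⊆ 𝔾 →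
        IsCharacteristic 𝔾L (within𝔾 H) → IsSubgroup Γ (H · Γ-E)
      characteristic⇒HΓ-E-isSubgroup H H-isSubgroup H⊆𝔾 H-char = normal-⊙-isSubgroup Γ {H} {Γ-E} H-isSubgroup
        (characteristic-in-normal⇒normal Γ {𝔾} {H} 𝔾-isSubgroup 𝔾-isNormal (λ {h} → H⊆𝔾 {h}) H-char)
        (stabiliser-isSubgroup E E⊆Ê)

    characteristic⇒preGalois : ∀ H (H-isSubgroup : IsSubgroup Γ H) → H U.⊆ 𝔾 →
      (H-char : IsCharacteristic 𝔾L (within𝔾 H)) →
      IsPreGaloisWithGroup (incl k (E^ H) (k⊆E^ H)) (incl k L k⊆L) (𝔾L/ H-isSubgroup H-char)
    characteristic⇒preGalois H H-isSubgroup H⊆𝔾 H-char = L-galois ,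
      PreGalois.isPotentiallyGaloisWithGroup H H-isSubgroup (λ γ → H⊆𝔾 {γ})
        (characteristic⇒HΓ-E-isSubgroup H H-isSubgroup (λ {γ} → H⊆𝔾 {γ}) H-char) (characteristic⇒normal 𝔾L H-char)

proposition2p21 : ∀ {ℓ : Level} →
  (∀ {a} → ExcludedMiddle a) →
  (Ω : Field ℓ) → let open Subfields Ω in
  (k E L Ê : Subfield) (k⊆E : k ⊆ E) (k⊆L : k ⊆ L) (E⊆Ê : E ⊆ Ê) →
  IsPotentiallyGalois (incl k E k⊆E) (incl k L k⊆L) →
  IsGaloisClosure k E Ê k⊆E E⊆Ê →
  let open Correspondence Ω k E L Ê k⊆E k⊆L E⊆Ê in
  Σ[ restrictable ∈ Restrictable ]
  let open Restriction restrictable in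
  Σ[ η-isSubgp ∈ (∀ E′ → IsSubgp (ηL-set E′)) ]
  let ηL : Subfld → Subgp
      ηL = λ E′ → ηL-set E′ , η-isSubgp E′
  in
    Inverseᵇ _≈ᵍ_ _≈ᶠ_ εL ηL
  × (∀ (H : Subgp) → ∃[ n ] HasDegree (incl (field′ (εL H)) E (⊆E (εL H))) n × HasOrder Γ (proj₁ H) n)
  × (∀ (E′ : Subfld) → ∃[ n ] HasDegree (incl (field′ E′) E (⊆E E′)) n × HasOrder Γ (ηL-set E′) n)
  × (∀ (E′ : Subfld) → εL (ηL E′) ≈ᶠ E′)
  × (∀ (H : Subgp) → ηL (εL H) ≈ᵍ H)
  × (IsGalois (incl k L k⊆L) →
     ∀ H (H-isSubgroup : IsSubgroup Γ H) → H U.⊆ 𝔾 →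
     (H-char : IsCharacteristic 𝔾L (within𝔾 H)) →
       IsSubgroup Γ (H · Γ-E)
     × IsPreGaloisWithGroup (incl k (E^ H) (k⊆E^ H)) (incl k L k⊆L) (𝔾L/ H-isSubgroup H-char))
proposition2p21 em Ω k E L Ê k⊆E k⊆L E⊆Ê potentiallyGalois galoisClosure =
  restrictable , η-isSubgp ,
  ( (λ {E′} {S} S≈ηE′ → ε-inverse E′ S S≈ηE′)
  , (λ {S} {E′} E′≈εS → η-inverse S E′ E′≈εS)
  ) ,
  order-ε , order-η , (λ E′ → εη E′) , (λ S → ηε S) ,
  λ L-galois H H-isSubgroup H⊆𝔾 H-char → let open Normality L-galois in
    characteristic⇒HΓ-E-isSubgroup H H-isSubgroup H⊆𝔾 H-char ,
    characteristic⇒preGalois H H-isSubgroup H⊆𝔾 H-char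
  where
  open GaloisTheory em Ω k E L Ê k⊆E k⊆L E⊆Ê potentiallyGalois galoisClosure
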